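{- Let $m$ and $n$ be positive integers, and let $p$ be a prime. Define \[T(x):=\Phi_{p^m}\left(\Phi_{2^n}(x)\right),\] where $\Phi_k(x)$ is the cyclotomic polynomial of index $k$. Then $T(x)$ is irreducible over $\mathbb{Q}$ and monogenic.
   Context: $\Phi_k(x)\in\mathbb{Z}[x]$ denotes the cyclotomic polynomial of index $k$, i.e. the minimal polynomial over $\mathbb{Q}$ of a primitive $k$th root of unity. A monic polynomial $f(x)\in\mathbb{Z}[x]$ is called monogenic if $f(x)$ is irreducible over $\mathbb{Q}$ and, for $\theta$ a root of $f(x)$ and $K=\mathbb{Q}(\theta)$ with ring of integers $\mathbb{Z}_K$, one has $[\mathbb{Z}_K:\mathbb{Z}[\theta]]=1$; equivalently, $\{1,\theta,\theta^2,\ldots,\theta^{\deg(f)-1}\}$ is a $\mathbb{Z}$-basis of $\mathbb{Z}_K$. -}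

module Defs where

open import Level using (Level; 0ℓ)
open import Algebra.Apartness.Bundles using (HeytingField)
open import Algebra.Bundles using (CommutativeRing)
open import Algebra.Bundles.Raw using (RawRing)
import Algebra.Definitions.RawSemiring as RawSemiringDefinitions
open import Algebra.Morphism.Structures using (IsRingHomomorphism)
open import Data.Integer.Base as ℤ using (ℤ)
open import Data.List.Base using (List; []; _∷_; foldr; map)
open import Data.Nat.Base using (ℕ; zero; suc; _<_)
open import Data.Product.Base using (Σ-syntax; ∃-syntax; _×_)
open import Data.Rational.Base as ℚ using (ℚ)
open import Relation.Nullary.Negation.Core using (¬_)
open import Relation.Unary using (Pred; _∈_; _⊆_)

private
  variable
    a c ℓ : Level
    A : Set a

-- The polynomial c₀ + c₁ X + ⋯ + cₖ Xᵏ is the list c₀ ∷ c₁ ∷ ⋯ ∷ cₖ ∷ [].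
-- Trailing zeros are allowed, so equality of polynomials is _≋_ below.
module Polynomial (R : RawRing c ℓ) where
  open RawRing R

  coeff : List Carrier → ℕ → Carrier
  coeff []      _       = 0#
  coeff (x ∷ _) zero    = x
  coeff (_ ∷ f) (suc i) = coeff f i

  infix 4 _≋_
  _≋_ : List Carrier → List Carrier → Set ℓ
  f ≋ g = ∀ i → coeff f i ≈ coeff g i

  add : List Carrier → List Carrier → List Carrier
  add []      g       = g
  add (x ∷ f) []      = x ∷ f
  add (x ∷ f) (y ∷ g) = (x + y) ∷ add f g

  mul : List Carrier → List Carrier → List Carrier
  mul []      g = []
  mul (x ∷ f) g = add (map (x *_) g) (0# ∷ mul f g)

  polynomialRawRing : RawRing c ℓ
  polynomialRawRing = record
    { Carrier = List Carrier
    ; _≈_     = _≋_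
    ; _+_     = add
    ; _*_     = mul
    ; -_      = map (-_)
    ; 0#      = []
    ; 1#      = 1# ∷ []
    }

  Monic : List Carrier → Set ℓ
  Monic f = ∃[ d ] (coeff f d ≈ 1# × (∀ i → d < i → coeff f i ≈ 0#))

-- The value at x of a polynomial whose coefficients are mapped into S by ι.
eval : (S : RawRing c ℓ) → (A → RawRing.Carrier S) →
       List A → RawRing.Carrier S → RawRing.Carrier S
eval S ι f x = foldr (λ a r → ι a + x * r) 0# f
  where open RawRing S

module ℤ[X] = Polynomial ℤ.+-*-rawRing
module ℚ[X] = Polynomial ℚ.+-*-rawRing

ℤ[X] : Set
ℤ[X] = List ℤ

ℚ[X] : Set
ℚ[X] = List ℚ

module ℚ[X]-Divisibility =
  RawSemiringDefinitions (RawRing.rawSemiring ℚ[X].polynomialRawRing)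

infixr 9 _∘ₚ_
_∘ₚ_ : ℤ[X] → ℤ[X] → ℤ[X]
f ∘ₚ g = eval ℤ[X].polynomialRawRing (λ a → a ∷ []) f g

toℚ : ℤ → ℚ
toℚ a = a ℚ./ 1

toℚ[X] : ℤ[X] → ℚ[X]
toℚ[X] = map toℚ

IrreducibleOverℚ : ℤ[X] → Set
IrreducibleOverℚ f = ℚ[X]-Divisibility.Irreducible (toℚ[X] f)

-- A field extension of ℚ.  The trivial ring is not a Heyting field, because
-- there 0# - 0# would be invertible, contradicting irreflexivity of _#_; hence
-- ι is injective.
record Extension : Set₁ where
  field
    field′ : HeytingField 0ℓ 0ℓ 0ℓ

  open HeytingField field′ public

  rawRing : RawRing 0ℓ 0ℓ
  rawRing = CommutativeRing.rawRing (record { isCommutativeRing = isCommutativeRing })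

  field
    ι                : ℚ → Carrier
    ι-isHomomorphism : IsRingHomomorphism ℚ.+-*-rawRing rawRing ι

  open RawSemiringDefinitions (RawRing.rawSemiring rawRing) public using (_^_)

  evalℚ : ℚ[X] → Carrier → Carrier
  evalℚ = eval rawRing ι

  evalℤ : ℤ[X] → Carrier → Carrier
  evalℤ f = evalℚ (toℚ[X] f)

  IsPrimitiveRootOfUnity : ℕ → Carrier → Set
  IsPrimitiveRootOfUnity k ζ =
    ζ ^ k ≈ 1# × (∀ d → 0 < d → d < k → ¬ (ζ ^ d ≈ 1#))

  -- f is the monic generator of the ideal of rational polynomials vanishing
  -- at x.
  record IsMinimalPolynomial (x : Carrier) (f : ℚ[X]) : Set where
    field
      monic  : ℚ[X].Monic f
      root   : evalℚ f x ≈ 0#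
      divide : ∀ g → evalℚ g x ≈ 0# → f ℚ[X]-Divisibility.∣ g

  -- The subfield ℚ(θ): the fractions g(θ) / h(θ) with h(θ) nonzero.
  ℚ⟨_⟩ : Carrier → Pred Carrier 0ℓ
  ℚ⟨ θ ⟩ α = ∃[ g ] ∃[ h ] (evalℚ h θ # 0# × α * evalℚ h θ ≈ evalℚ g θ)

  -- The subring ℤ[θ].
  ℤ⟨_⟩ : Carrier → Pred Carrier 0ℓ
  ℤ⟨ θ ⟩ α = ∃[ r ] (α ≈ evalℤ r θ)

  Integral : Pred Carrier 0ℓ
  Integral α = ∃[ h ] (ℤ[X].Monic h × evalℤ h α ≈ 0#)

  -- The ring of integers of ℚ(θ).
  𝒪⟨_⟩ : Carrier → Pred Carrier 0ℓ
  𝒪⟨ θ ⟩ α = α ∈ ℚ⟨ θ ⟩ × Integral α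

-- Φ is the cyclotomic polynomial of index k.  The field in which the primitive
-- root of unity lives is immaterial, since all of them share one minimal
-- polynomial.
IsCyclotomic : ℕ → ℤ[X] → Set₁
IsCyclotomic k Φ =
  Σ[ L ∈ Extension ] let open Extension L in
    ∃[ ζ ] (IsPrimitiveRootOfUnity k ζ × IsMinimalPolynomial ζ (toℚ[X] Φ))

-- As f is monic, ℤ[θ] is contained in the ring of integers of ℚ(θ), so the
-- index of ℤ[θ] in it is 1 exactly when the reverse inclusion holds.
record Monogenic (f : ℤ[X]) : Set₁ where
  field
    monic       : ℤ[X].Monic f
    irreducible : IrreducibleOverℚ f
    index-one   : (K : Extension) → let open Extension K in
                  ∀ θ → evalℤ f θ ≈ 0# → 𝒪⟨ θ ⟩ ⊆ ℤ⟨ θ ⟩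

{-# OPTIONS --safe #-}
module Submission where

-- Let N = 2ⁿ⁻¹.  Since Φ_{2ⁿ} = X^N + 1, the polynomial T = Φ_{pᵐ}(X^N + 1) is congruent to a power of X
-- modulo p and has constant term Φ_{pᵐ}(1) = p, so it is Eisenstein at p and hence irreducible.
--
-- For a root θ of T put R = ℤ[θ] and ζ = 1 + θ^N, a pᵐ-th root of unity.  Every element of ℚ(θ) is β / c with
-- β ∈ R and c ∈ ℕ, so it is enough that for each prime q an integral β with qβ ∈ R lies in R.  This holds when
-- some π ∈ R and k ≥ 1 satisfy π^k = q s with s a unit modulo (q, π), and R/(q, π) is reduced: if π^(i+1) β ∈ R,
-- then a power of it lies in πR because β is integral, so it lies in (q, π) itself and π^i β ∈ R up to a unit
-- modulo q.  Reducedness follows from θ^Q ≡ θ for some power Q > 1 of q, for then y ↦ y^Q is the identity of R/(q, π).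
-- For q = p take π = θ.  If q ∤ pN take π = q: ζ, hence θ^N = ζ - 1, is fixed by a power of Frobenius, and so θ is
-- a root of unity of order prime to q modulo q.  In the remaining case q = 2 ∣ N and p is odd; writing ζ = ξ^N,
-- take π = θ - (ξ - 1), whose N-th power is twice a unit modulo (2, π).

open import Defs
open import Algebra.Bundles using (CommutativeRing; RawRing)
import Algebra.Definitions.RawMagma as RawMagma
import Algebra.Definitions.RawSemiring as RawSemiringDefinitions
import Algebra.Morphism.Construct.Composition as Composition
import Algebra.Morphism.Construct.Identity as Identity
import Algebra.Morphism.RingMonomorphism as RingMonomorphism
open import Algebra.Morphism.Structures using (IsRingHomomorphism; IsRingMonomorphism)
import Algebra.Solver.Ring
open import Algebra.Solver.Ring.AlmostCommutativeRing
  using (fromCommutativeRing; _-Raw-AlmostCommutative⟶_)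
open import Data.Fin.Base as Fin using (Fin; zero; suc; toℕ; fromℕ; fromℕ<; inject₁)
import Data.Fin.Properties as Fin
open import Data.Integer.Base as ℤ using (ℤ; +_; -[1+_]; _⊖_; 0ℤ; 1ℤ)
import Data.Integer.Divisibility.Signed as ℤ∣
import Data.Integer.Properties as ℤ
open import Data.List.Base using (List; []; _∷_; map)
open import Data.List.Relation.Unary.All using (All; []; _∷_)
import Data.Maybe.Base as Maybe
open import Data.Nat.Base as ℕ using (ℕ; zero; suc; s≤s; z≤n; NonZero)
open import Data.Nat.Combinatorics using (_C_; nCk≡n!/k![n-k]!; k![n∸k]!∣n!; nCn≡1)
open import Data.Nat.Coprimality using (Coprime; coprime-divisor)
open import Data.Nat.DivMod using (_%_; _/_; m%n<n; m≡m%n+[m/n]*n; m/n*n≡m)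
open import Data.Nat.Divisibility as ℕ∣ using (_∣_; _∣?_; divides)
open import Data.Nat.Induction using (<-rec)
open import Data.Nat.ListAction using (product)
open import Data.Nat.Primality
  using (Prime; euclidsLemma; prime⇒nonTrivial; prime⇒nonZero; prime⇒irreducible; prime[2])
open import Data.Nat.Primality.Factorisation using (factorise; module PrimeFactorisation)
import Data.Nat.Properties as ℕ
open import Data.Product.Base using (_,_; _×_; ∃-syntax; ∃₂; proj₁; proj₂)
open import Data.Rational.Base as ℚ using (ℚ; mkℚ; 0ℚ; 1ℚ)
import Data.Rational.Properties as ℚ
import Data.Rational.Unnormalised.Base as ℚᵘ
import Data.Rational.Unnormalised.Properties as ℚᵘ
open import Data.Sum.Base as Sum using (_⊎_; inj₁; inj₂; [_,_])
open import Function.Base using (id; _∘_)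
open import Level using (Level; 0ℓ; _⊔_)
open import Relation.Binary.PropositionalEquality as ≡ using (_≡_; _≢_)
open import Relation.Nullary using (¬_; contradiction; Dec; yes; no)
open import Relation.Nullary.Decidable using (dec⇒maybe)
open import Relation.Unary using (_⊆_)

-- Integrality enters only through denominators: if `D β = y` with D and y in R, then some power of
-- y lies in D R. No integral basis and no discriminant is computed. θ is a root in an arbitrary
-- extension, whose equality need not be decidable, while the descent has to divide by π.
-- Irreducibility of T supplies the decision: Bézout for h and T in ℚ[X] shows that h(θ) is zero or
-- invertible. R is represented by ℤ[X] with equality of values at θ. A unit s modulo (q, π) is a
-- unit modulo q, because π is nilpotent there; and a multiple of s turns q into a multiple of π^k,
-- hence carries the ideal (q, π) into πR. At q = 2 put a = ξ - 1. Comparing θ^N = (π + a)^N with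
-- ξ^N - 1 = (a + 1)^N - 1 modulo 4 gives π^N = 2s with s ≡ a^(N/2) ≡ θ^(N/2) modulo (2, π), a unit
-- because θ divides the odd prime p. Both cyclotomic polynomials are given only as minimal
-- polynomials. The case N = 1 of the Eisenstein computation, which is the substitution of X + 1,
-- identifies them as geometric sums.

private
  variable
    c ℓ c′ ℓ′ c″ ℓ″ : Level

-- Commutative rings

module RingTheory (R : CommutativeRing c ℓ) where
  open CommutativeRing R public hiding (zero)
  open import Algebra.Properties.Ring ring public
    using (-‿involutive; -0#≈0#; -‿+-comm; -‿distribˡ-*; -‿distribʳ-*; +-cancelʳ; +-cancelˡ)
  open import Algebra.Properties.Semiring.Mult semiring public
    using (×-homo-+; ×1-homo-*; ×-assocˡ; ×-congʳ; ×-congˡ; ×-assoc-*)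
    renaming (_×_ to _·_)
  open import Algebra.Properties.CommutativeSemiring.Exp commutativeSemiring public
    using (_^_; ^-congˡ; ^-congʳ; ^-homo-*; ^-assocʳ; ^-distrib-*)
  open import Relation.Binary.Reasoning.Setoid setoid

  private
    fromℤ : ℤ → Carrier
    fromℤ (+ n)    = n · 1#
    fromℤ -[1+ n ] = - (suc n · 1#)

    neg-homo : ∀ i → fromℤ (ℤ.- i) ≈ - fromℤ i
    neg-homo (+ zero)  = sym -0#≈0#
    neg-homo (+ suc n) = refl
    neg-homo -[1+ n ]  = sym (-‿involutive _)

    ⊖-homo : ∀ m n → fromℤ (m ⊖ n) ≈ m · 1# + - (n · 1#)
    ⊖-homo zero    zero    = trans (sym (+-identityˡ 0#)) (+-congˡ (sym -0#≈0#))
    ⊖-homo zero    (suc n) = sym (+-identityˡ _)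
    ⊖-homo (suc m) zero    = trans (sym (+-identityʳ _)) (+-congˡ (sym -0#≈0#))
    ⊖-homo (suc m) (suc n) rewrite ℤ.[1+m]⊖[1+n]≡m⊖n m n = begin
      fromℤ (m ⊖ n)                    ≈⟨ ⊖-homo m n ⟩
      m · 1# + - (n · 1#)              ≈⟨ +-congʳ (+-identityʳ _) ⟨
      m · 1# + 0# + - (n · 1#)         ≈⟨ +-congʳ (+-congˡ (-‿inverseʳ 1#)) ⟨
      m · 1# + (1# + - 1#) + - (n · 1#) ≈⟨ +-congʳ (+-assoc _ _ _) ⟨
      m · 1# + 1# + - 1# + - (n · 1#)  ≈⟨ +-assoc _ _ _ ⟩
      m · 1# + 1# + (- 1# + - (n · 1#)) ≈⟨ +-cong (+-comm _ _) (-‿+-comm _ _) ⟩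
      1# + m · 1# + - (1# + n · 1#)    ∎

    +-homo′ : ∀ i j → fromℤ (i ℤ.+ j) ≈ fromℤ i + fromℤ j
    +-homo′ (+ m)    (+ n)    = ×-homo-+ 1# m n
    +-homo′ (+ m)    -[1+ n ] = ⊖-homo m (suc n)
    +-homo′ -[1+ m ] (+ n)    = trans (⊖-homo n (suc m)) (+-comm _ _)
    +-homo′ -[1+ m ] -[1+ n ] = begin
      - (suc (suc (m ℕ.+ n)) · 1#)         ≡⟨ ≡.cong (λ k → - (k · 1#)) (ℕ.+-suc (suc m) n) ⟨
      - ((suc m ℕ.+ suc n) · 1#)           ≈⟨ -‿cong (×-homo-+ 1# (suc m) (suc n)) ⟩
      - (suc m · 1# + suc n · 1#)          ≈⟨ -‿+-comm _ _ ⟨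
      - (suc m · 1#) + - (suc n · 1#)      ∎

    pos-*-homo : ∀ m n → fromℤ (+ m ℤ.* + n) ≈ m · 1# * n · 1#
    pos-*-homo m n = trans (reflexive (≡.cong fromℤ (≡.sym (ℤ.pos-* m n)))) (×1-homo-* m n)

    *-homo′ : ∀ i j → fromℤ (i ℤ.* j) ≈ fromℤ i * fromℤ j
    *-homo′ (+ m) (+ n) = pos-*-homo m n
    *-homo′ (+ m) -[1+ n ] = begin
      fromℤ (+ m ℤ.* -[1+ n ])       ≡⟨ ≡.cong fromℤ (ℤ.neg-distribʳ-* (+ m) (+ suc n)) ⟨
      fromℤ (ℤ.- (+ m ℤ.* + suc n))  ≈⟨ neg-homo (+ m ℤ.* + suc n) ⟩
      - fromℤ (+ m ℤ.* + suc n)      ≈⟨ -‿cong (pos-*-homo m (suc n)) ⟩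
      - (m · 1# * suc n · 1#)        ≈⟨ -‿distribʳ-* _ _ ⟩
      m · 1# * - (suc n · 1#)        ∎
    *-homo′ -[1+ m ] (+ n) = begin
      fromℤ (-[1+ m ] ℤ.* + n)       ≡⟨ ≡.cong fromℤ (ℤ.neg-distribˡ-* (+ suc m) (+ n)) ⟨
      fromℤ (ℤ.- (+ suc m ℤ.* + n))  ≈⟨ neg-homo (+ suc m ℤ.* + n) ⟩
      - fromℤ (+ suc m ℤ.* + n)      ≈⟨ -‿cong (pos-*-homo (suc m) n) ⟩
      - (suc m · 1# * n · 1#)        ≈⟨ -‿distribˡ-* _ _ ⟩
      - (suc m · 1#) * n · 1#        ∎
    *-homo′ -[1+ m ] -[1+ n ] = begin
      fromℤ (+ suc m ℤ.* + suc n)      ≈⟨ pos-*-homo (suc m) (suc n) ⟩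
      suc m · 1# * suc n · 1#          ≈⟨ -‿involutive _ ⟨
      - - (suc m · 1# * suc n · 1#)    ≈⟨ -‿cong (-‿distribʳ-* _ _) ⟩
      - (suc m · 1# * - (suc n · 1#))  ≈⟨ -‿distribˡ-* _ _ ⟩
      - (suc m · 1#) * - (suc n · 1#)  ∎

    -- The solver reads con (+ 1) as ⟦ + 1 ⟧, which has to be 1# on the nose.
    ⟦_⟧ : ℤ → Carrier
    ⟦ + 1 ⟧ = 1#
    ⟦ i ⟧   = fromℤ i

    ⟦⟧≈fromℤ : ∀ i → ⟦ i ⟧ ≈ fromℤ i
    ⟦⟧≈fromℤ (+ 0)             = refl
    ⟦⟧≈fromℤ (+ 1)             = sym (+-identityʳ 1#)
    ⟦⟧≈fromℤ (+ suc (suc n))   = refl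
    ⟦⟧≈fromℤ -[1+ n ]          = refl

    morphism : ℤ.+-*-rawRing -Raw-AlmostCommutative⟶ fromCommutativeRing R
    morphism = record
      { ⟦_⟧    = ⟦_⟧
      ; +-homo = λ i j → trans (⟦⟧≈fromℤ (i ℤ.+ j))
          (trans (+-homo′ i j) (sym (+-cong (⟦⟧≈fromℤ i) (⟦⟧≈fromℤ j))))
      ; *-homo = λ i j → trans (⟦⟧≈fromℤ (i ℤ.* j))
          (trans (*-homo′ i j) (sym (*-cong (⟦⟧≈fromℤ i) (⟦⟧≈fromℤ j))))
      ; -‿homo = λ i → trans (⟦⟧≈fromℤ (ℤ.- i)) (trans (neg-homo i) (sym (-‿cong (⟦⟧≈fromℤ i))))
      ; 0-homo = refl
      ; 1-homo = refl }

  open Algebra.Solver.Ring ℤ.+-*-rawRing (fromCommutativeRing R) morphism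
    (λ i j → Maybe.map (λ i≡j → reflexive (≡.cong ⟦_⟧ i≡j)) (dec⇒maybe (i ℤ.≟ j))) public
    using (solve; _:=_; _:+_; _:*_; :-_; _:-_; con)

  -- Stated so that the last premise is a ring identity, left to the solver.
  linear : ∀ {a b x y} t → a ≈ b → x + t * b ≈ y + t * a → x ≈ y
  linear {a} {b} {x} {y} t a≈b e = +-cancelʳ (t * b) x y (trans e (+-congˡ (*-congˡ a≈b)))

  1^n≈1 : ∀ n → 1# ^ n ≈ 1#
  1^n≈1 zero    = refl
  1^n≈1 (suc n) = trans (*-identityˡ _) (1^n≈1 n)

  0^n≈0 : ∀ n .{{_ : ℕ.NonZero n}} → 0# ^ n ≈ 0#
  0^n≈0 (suc n) = zeroˡ _

  ^-swap : ∀ x m n → (x ^ m) ^ n ≈ (x ^ n) ^ m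
  ^-swap x m n = trans (^-assocʳ x m n)
    (trans (^-congʳ x (ℕ.*-comm m n)) (sym (^-assocʳ x n m)))

  geom : ℕ → Carrier → Carrier
  geom zero    x = 0#
  geom (suc n) x = 1# + x * geom n x

  geom-cong : ∀ n {x y} → x ≈ y → geom n x ≈ geom n y
  geom-cong zero    e = refl
  geom-cong (suc n) e = +-congˡ (*-cong e (geom-cong n e))

  -- The identity `(x - 1) * geom n x = x ^ n - 1` with its negative terms moved across, a form
  -- suited to `linear`.
  geom-telescope : ∀ n x → x * geom n x + 1# ≈ geom n x + x ^ n
  geom-telescope zero    x = +-congʳ (zeroʳ x)
  geom-telescope (suc n) x = linear x (geom-telescope n x)
    (solve 3 (λ x g e → (x :* (con (+ 1) :+ x :* g) :+ con (+ 1)) :+ x :* (g :+ e)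
        := ((con (+ 1) :+ x :* g) :+ x :* e) :+ x :* (x :* g :+ con (+ 1))) refl x (geom n x) (x ^ n))

  geom-1 : ∀ n → geom n 1# ≈ n · 1#
  geom-1 zero    = refl
  geom-1 (suc n) = +-congˡ (trans (*-identityˡ _) (geom-1 n))

-- Binomial coefficients modulo p and Frobenius

private
  prime∤! : ∀ {p} → Prime p → ∀ k → k ℕ.< p → ¬ p ∣ k ℕ.!
  prime∤! {p} pp zero    k<p p∣ = ℕ.nonTrivial⇒≢1 {{prime⇒nonTrivial pp}} (ℕ∣.∣1⇒≡1 p∣)
  prime∤! {p} pp (suc k) k<p p∣ with euclidsLemma (suc k) (k ℕ.!) pp p∣
  ... | inj₁ d = ℕ.<⇒≱ k<p (ℕ∣.∣⇒≤ d)
  ... | inj₂ d = prime∤! pp k (ℕ.<-trans (ℕ.n<1+n k) k<p) d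

-- `p` divides `p !`, but neither of the factorials `k !` and `(p - k) !` in the denominator.
prime∣C : ∀ {p} → Prime p → ∀ k → 0 ℕ.< k → k ℕ.< p → p ∣ (p C k)
prime∣C {p} pp k 0<k k<p with euclidsLemma (p C k) (k ℕ.! ℕ.* (p ℕ.∸ k) ℕ.!) pp p∣
  where
  instance _ = k ℕ.!* (p ℕ.∸ k) !≢0
           _ = prime⇒nonZero pp
  eq : (p C k) ℕ.* (k ℕ.! ℕ.* (p ℕ.∸ k) ℕ.!) ≡ p ℕ.!
  eq = ≡.trans (≡.cong (ℕ._* (k ℕ.! ℕ.* (p ℕ.∸ k) ℕ.!)) (nCk≡n!/k![n-k]! (ℕ.<⇒≤ k<p)))
               (m/n*n≡m (k![n∸k]!∣n! (ℕ.<⇒≤ k<p)))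
  p∣p! : ∀ n .{{_ : ℕ.NonZero n}} → n ∣ n ℕ.!
  p∣p! (suc n) = ℕ∣.m∣m*n (n ℕ.!)
  p∣ : p ∣ (p C k) ℕ.* (k ℕ.! ℕ.* (p ℕ.∸ k) ℕ.!)
  p∣ = ≡.subst (p ∣_) (≡.sym eq) (p∣p! p)
... | inj₁ d = d
... | inj₂ d with euclidsLemma (k ℕ.!) ((p ℕ.∸ k) ℕ.!) pp d
...   | inj₁ d′ = contradiction d′ (prime∤! pp k k<p)
...   | inj₂ d′ = contradiction d′ (prime∤! pp (p ℕ.∸ k) (ℕ.∸-monoʳ-< 0<k (ℕ.<⇒≤ k<p)))

module _ (R : CommutativeRing c ℓ) where
  open RingTheory R

  module Frobenius {p : ℕ} (pp : Prime p) (p·1≈0 : p · 1# ≈ 0#) where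
    open import Algebra.Properties.CommutativeSemiring.Binomial commutativeSemiring
      using (binomialTerm) renaming (theorem to binomial-theorem)
    open import Algebra.Properties.CommutativeMonoid.Sum +-commutativeMonoid
      using (sum; sum-init-last; sum-cong-≋; sum-replicate-zero)
    open import Relation.Binary.Reasoning.Setoid setoid

    ∣⇒·≈0 : ∀ {k} → p ∣ k → ∀ x → k · x ≈ 0#
    ∣⇒·≈0 (divides q ≡.refl) x = begin
      (q ℕ.* p) · x       ≈⟨ ×-assocˡ x q p ⟨
      q · (p · x)         ≈⟨ ×-congʳ q (×-congʳ p (*-identityˡ x)) ⟨
      q · (p · (1# * x))  ≈⟨ ×-congʳ q (×-assoc-* p 1# x) ⟨
      q · (p · 1# * x)    ≈⟨ ×-congʳ q (trans (*-congʳ p·1≈0) (zeroˡ x)) ⟩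
      q · 0#              ≈⟨ q·0 q ⟩
      0#                  ∎
      where
      q·0 : ∀ q → q · 0# ≈ 0#
      q·0 zero    = refl
      q·0 (suc q) = trans (+-identityˡ _) (q·0 q)

    ^p-homo-+ : ∀ x y → (x + y) ^ p ≈ x ^ p + y ^ p
    ^p-homo-+ x y = go p ≡.refl
      where
      -- A copy of `p` that can be matched as `suc n`, so that the first and the last term of the
      -- binomial sum split off.
      go : ∀ n → n ≡ p → (x + y) ^ n ≈ x ^ n + y ^ n
      go zero    ≡.refl = contradiction ≡.refl (ℕ.≢-nonZero⁻¹ 0 {{prime⇒nonZero pp}})
      go (suc n) ≡.refl = begin
        (x + y) ^ suc n
          ≈⟨ binomial-theorem (suc n) x y ⟩
        binomialTerm x y (suc n) zero + sum (λ i → binomialTerm x y (suc n) (suc i))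
          ≈⟨ +-cong first (trans (sum-init-last (λ i → binomialTerm x y (suc n) (suc i))) (+-cong middle last)) ⟩
        y ^ suc n + (0# + x ^ suc n)
          ≈⟨ trans (+-congˡ (+-identityˡ _)) (+-comm _ _) ⟩
        x ^ suc n + y ^ suc n ∎
        where
        first : binomialTerm x y (suc n) zero ≈ y ^ suc n
        first = trans (+-identityʳ _) (*-identityˡ _)
        last : binomialTerm x y (suc n) (suc (fromℕ n)) ≈ x ^ suc n
        last rewrite Fin.toℕ-fromℕ n | nCn≡1 (suc n) | ℕ.n∸n≡0 n =
          trans (+-identityʳ _) (*-identityʳ _)
        middle : sum {n} (λ i → binomialTerm x y (suc n) (suc (inject₁ i))) ≈ 0#
        middle = trans (sum-cong-≋ {n} (λ i → ∣⇒·≈0 (prime∣C pp _ (s≤s z≤n)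
            (s≤s (≡.subst (ℕ._< n) (≡.sym (Fin.toℕ-inject₁ i)) (Fin.toℕ<n i)))) _))
          (sum-replicate-zero n)

    ^pʲ-homo-+ : ∀ j x y → (x + y) ^ (p ℕ.^ j) ≈ x ^ (p ℕ.^ j) + y ^ (p ℕ.^ j)
    ^pʲ-homo-+ zero    x y = trans (*-identityʳ _) (sym (+-cong (*-identityʳ x) (*-identityʳ y)))
    ^pʲ-homo-+ (suc j) x y = begin
      (x + y) ^ (p ℕ.* Q)            ≈⟨ ^-assocʳ _ p Q ⟨
      ((x + y) ^ p) ^ Q              ≈⟨ ^-congˡ Q (^p-homo-+ x y) ⟩
      (x ^ p + y ^ p) ^ Q            ≈⟨ ^pʲ-homo-+ j _ _ ⟩
      (x ^ p) ^ Q + (y ^ p) ^ Q      ≈⟨ +-cong (^-assocʳ x p Q) (^-assocʳ y p Q) ⟩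
      x ^ (p ℕ.* Q) + y ^ (p ℕ.* Q)  ∎
      where Q = p ℕ.^ j

-- Quotients by ideals with two generators

module _ (R : CommutativeRing c ℓ) where
  open RingTheory R

  module Quotient (u v : Carrier) where

    infix 4 _∼_
    _∼_ : Carrier → Carrier → Set _
    x ∼ y = ∃₂ λ a b → x ≈ y + (u * a + v * b)

    ≈⇒∼ : ∀ {x y} → x ≈ y → x ∼ y
    ≈⇒∼ {x} {y} e = 0# , 0# , trans e
      (solve 3 (λ y u v → y := y :+ (u :* con (+ 0) :+ v :* con (+ 0))) refl y u v)

    private
      ∼-sym : ∀ {x y} → x ∼ y → y ∼ x
      ∼-sym {x} {y} (a , b , e) = - a , - b , linear 1# (sym e)
        (solve 6 (λ x y a b u v → y :+ con (+ 1) :* x := x :+ (u :* (:- a) :+ v :* (:- b))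
          :+ con (+ 1) :* (y :+ (u :* a :+ v :* b))) refl x y a b u v)

      ∼-trans : ∀ {x y z} → x ∼ y → y ∼ z → x ∼ z
      ∼-trans {x} {y} {z} (a , b , e) (a′ , b′ , e′) = a + a′ , b + b′ , trans e (trans (+-congʳ e′)
        (solve 7 (λ z a b a′ b′ u v → z :+ (u :* a′ :+ v :* b′) :+ (u :* a :+ v :* b)
          := z :+ (u :* (a :+ a′) :+ v :* (b :+ b′))) refl z a b a′ b′ u v))

      ∼-+-cong : ∀ {x y x′ y′} → x ∼ y → x′ ∼ y′ → (x + x′) ∼ (y + y′)
      ∼-+-cong {y = y} {y′ = y′} (a , b , e) (a′ , b′ , e′) = a + a′ , b + b′ , trans (+-cong e e′)
        (solve 8 (λ y y′ a b a′ b′ u v → (y :+ (u :* a :+ v :* b)) :+ (y′ :+ (u :* a′ :+ v :* b′))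
          := (y :+ y′) :+ (u :* (a :+ a′) :+ v :* (b :+ b′))) refl y y′ a b a′ b′ u v)

      ∼-*-cong : ∀ {x y x′ y′} → x ∼ y → x′ ∼ y′ → (x * x′) ∼ (y * y′)
      ∼-*-cong {y = y} {y′ = y′} (a , b , e) (a′ , b′ , e′) =
        y * a′ + a * y′ + a * (u * a′ + v * b′) , y * b′ + b * y′ + b * (u * a′ + v * b′) ,
        trans (*-cong e e′)
        (solve 8 (λ y y′ a b a′ b′ u v → (y :+ (u :* a :+ v :* b)) :* (y′ :+ (u :* a′ :+ v :* b′))
          := (y :* y′) :+ (u :* (y :* a′ :+ a :* y′ :+ a :* (u :* a′ :+ v :* b′))
                :+ v :* (y :* b′ :+ b :* y′ :+ b :* (u :* a′ :+ v :* b′)))) refl y y′ a b a′ b′ u v)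

      ∼-neg-cong : ∀ {x y} → x ∼ y → - x ∼ - y
      ∼-neg-cong {y = y} (a , b , e) = - a , - b , trans (-‿cong e)
        (solve 5 (λ y a b u v → :- (y :+ (u :* a :+ v :* b)) := (:- y) :+ (u :* (:- a) :+ v :* (:- b)))
          refl y a b u v)

    -- Only the equality is coarsened, so the projection is the identity on carriers. A proof of
    -- `x ∼ y` keeps the two coefficients, which the descent uses as elements of the ring. Principal
    -- ideals arise as `v = 0#` or `v = u`.
    quotient : CommutativeRing _ _
    quotient = record
      { Carrier = Carrier ; _≈_ = _∼_ ; _+_ = _+_ ; _*_ = _*_ ; -_ = -_ ; 0# = 0# ; 1# = 1#
      ; isCommutativeRing = record
        { isRing = record
          { +-isAbelianGroup = record
            { isGroup = record
              { isMonoid = record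
                { isSemigroup = record
                  { isMagma = record
                    { isEquivalence = record { refl = ≈⇒∼ refl ; sym = ∼-sym ; trans = ∼-trans }
                    ; ∙-cong = ∼-+-cong }
                  ; assoc = λ x y z → ≈⇒∼ (+-assoc x y z) }
                ; identity = (λ x → ≈⇒∼ (+-identityˡ x)) , (λ x → ≈⇒∼ (+-identityʳ x)) }
              ; inverse = (λ x → ≈⇒∼ (-‿inverseˡ x)) , (λ x → ≈⇒∼ (-‿inverseʳ x))
              ; ⁻¹-cong = ∼-neg-cong }
            ; comm = λ x y → ≈⇒∼ (+-comm x y) }
          ; *-cong = ∼-*-cong
          ; *-assoc = λ x y z → ≈⇒∼ (*-assoc x y z)
          ; *-identity = (λ x → ≈⇒∼ (*-identityˡ x)) , (λ x → ≈⇒∼ (*-identityʳ x))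
          ; distrib = (λ x y z → ≈⇒∼ (distribˡ x y z)) , (λ x y z → ≈⇒∼ (distribʳ x y z)) }
        ; *-comm = λ x y → ≈⇒∼ (*-comm x y) } }

    u∼0 : u ∼ 0#
    u∼0 = 1# , 0# , solve 2 (λ u v → u := con (+ 0) :+ (u :* con (+ 1) :+ v :* con (+ 0))) refl u v

    v∼0 : v ∼ 0#
    v∼0 = 0# , 1# , solve 2 (λ u v → v := con (+ 0) :+ (u :* con (+ 0) :+ v :* con (+ 1))) refl u v

-- Polynomial rings and evaluation

module PolynomialRing (R : CommutativeRing c ℓ) where
  open RingTheory R
  open Polynomial (CommutativeRing.rawRing R) public
  open import Relation.Binary.Reasoning.Setoid setoid

  Poly : Set c
  Poly = List Carrier

  -- A record, so that f and g can be inferred from a proof of f ≃ g.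
  infix 4 _≃_
  record _≃_ (f g : Poly) : Set ℓ where
    constructor coeffs
    field coeff-≈ : f ≋ g
  open _≃_ public

  coeff-add : ∀ f g i → coeff (add f g) i ≈ coeff f i + coeff g i
  coeff-add []      g       i       = sym (+-identityˡ _)
  coeff-add (x ∷ f) []      i       = sym (+-identityʳ _)
  coeff-add (x ∷ f) (y ∷ g) zero    = refl
  coeff-add (x ∷ f) (y ∷ g) (suc i) = coeff-add f g i

  coeff-scale : ∀ x f i → coeff (map (x *_) f) i ≈ x * coeff f i
  coeff-scale x []      i       = sym (zeroʳ x)
  coeff-scale x (y ∷ f) zero    = refl
  coeff-scale x (y ∷ f) (suc i) = coeff-scale x f i

  coeff-neg : ∀ f i → coeff (map (-_) f) i ≈ - coeff f i
  coeff-neg []      i       = sym -0#≈0#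
  coeff-neg (y ∷ f) zero    = refl
  coeff-neg (y ∷ f) (suc i) = coeff-neg f i

  coeff-mul-∷ : ∀ x f g i → coeff (mul (x ∷ f) g) i ≈ x * coeff g i + coeff (0# ∷ mul f g) i
  coeff-mul-∷ x f g i = trans (coeff-add (map (x *_) g) (0# ∷ mul f g) i) (+-congʳ (coeff-scale x g i))

  private
    shift-≋ : ∀ f g → f ≋ g → (0# ∷ f) ≋ (0# ∷ g)
    shift-≋ f g e zero    = refl
    shift-≋ f g e (suc i) = e i

    mul-zeroʳ : ∀ f → mul f [] ≋ []
    mul-zeroʳ []      i       = refl
    mul-zeroʳ (x ∷ f) zero    = refl
    mul-zeroʳ (x ∷ f) (suc i) = mul-zeroʳ f i

    mul-congʳ : ∀ f g h → g ≋ h → mul f g ≋ mul f h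
    mul-congʳ []      g h e i = refl
    mul-congʳ (x ∷ f) g h e i = begin
      coeff (mul (x ∷ f) g) i                ≈⟨ coeff-mul-∷ x f g i ⟩
      x * coeff g i + coeff (0# ∷ mul f g) i
        ≈⟨ +-cong (*-congˡ (e i)) (shift-≋ (mul f g) (mul f h) (mul-congʳ f g h e) i) ⟩
      x * coeff h i + coeff (0# ∷ mul f h) i ≈⟨ coeff-mul-∷ x f h i ⟨
      coeff (mul (x ∷ f) h) i                ∎

    -- The mirror image of the defining equation of `mul`, which recurses on the left factor only;
    -- commutativity follows from it.
    mul-∷ʳ : ∀ f y g → mul f (y ∷ g) ≋ add (map (y *_) f) (0# ∷ mul f g)
    mul-∷ʳ []      y g zero    = refl
    mul-∷ʳ []      y g (suc i) = refl
    mul-∷ʳ (x ∷ f) y g zero    = +-congʳ (*-comm x y)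
    mul-∷ʳ (x ∷ f) y g (suc i) = begin
      coeff (add (map (x *_) g) (mul f (y ∷ g))) i
        ≈⟨ coeff-add (map (x *_) g) (mul f (y ∷ g)) i ⟩
      coeff (map (x *_) g) i + coeff (mul f (y ∷ g)) i
        ≈⟨ +-cong (coeff-scale x g i) (mul-∷ʳ f y g i) ⟩
      x * coeff g i + coeff (add (map (y *_) f) (0# ∷ mul f g)) i
        ≈⟨ +-congˡ (coeff-add (map (y *_) f) (0# ∷ mul f g) i) ⟩
      x * coeff g i + (coeff (map (y *_) f) i + coeff (0# ∷ mul f g) i)
        ≈⟨ solve 3 (λ a b c → a :+ (b :+ c) := b :+ (a :+ c)) refl _ _ _ ⟩
      coeff (map (y *_) f) i + (x * coeff g i + coeff (0# ∷ mul f g) i)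
        ≈⟨ +-congˡ (coeff-mul-∷ x f g i) ⟨
      coeff (map (y *_) f) i + coeff (mul (x ∷ f) g) i
        ≈⟨ coeff-add (map (y *_) f) (mul (x ∷ f) g) i ⟨
      coeff (add (map (y *_) f) (mul (x ∷ f) g)) i ∎

    mul-comm : ∀ f g → mul f g ≋ mul g f
    mul-comm []      g i = sym (mul-zeroʳ g i)
    mul-comm (x ∷ f) g i = begin
      coeff (mul (x ∷ f) g) i                          ≈⟨ coeff-add (map (x *_) g) (0# ∷ mul f g) i ⟩
      coeff (map (x *_) g) i + coeff (0# ∷ mul f g) i  ≈⟨ +-congˡ (shift-≋ (mul f g) (mul g f) (mul-comm f g) i) ⟩
      coeff (map (x *_) g) i + coeff (0# ∷ mul g f) i  ≈⟨ coeff-add (map (x *_) g) (0# ∷ mul g f) i ⟨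
      coeff (add (map (x *_) g) (0# ∷ mul g f)) i      ≈⟨ mul-∷ʳ g x f i ⟨
      coeff (mul g (x ∷ f)) i                          ∎

    coeff-shift-add : ∀ f g i → coeff (0# ∷ add f g) i ≈ coeff (0# ∷ f) i + coeff (0# ∷ g) i
    coeff-shift-add f g zero    = sym (+-identityʳ 0#)
    coeff-shift-add f g (suc i) = coeff-add f g i

    mul-distribʳ : ∀ h f g → mul (add f g) h ≋ add (mul f h) (mul g h)
    mul-distribʳ h []      g       i = refl
    mul-distribʳ h (x ∷ f) []      i = sym (trans (coeff-add (mul (x ∷ f) h) [] i) (+-identityʳ _))
    mul-distribʳ h (x ∷ f) (y ∷ g) i = begin
      coeff (mul ((x + y) ∷ add f g) h) i
        ≈⟨ coeff-mul-∷ (x + y) (add f g) h i ⟩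
      (x + y) * coeff h i + coeff (0# ∷ mul (add f g) h) i
        ≈⟨ +-congˡ (trans (shift-≋ (mul (add f g) h) (add (mul f h) (mul g h)) (mul-distribʳ h f g) i)
                          (coeff-shift-add (mul f h) (mul g h) i)) ⟩
      (x + y) * coeff h i + (coeff (0# ∷ mul f h) i + coeff (0# ∷ mul g h) i)
        ≈⟨ solve 5 (λ x y h a b → (x :+ y) :* h :+ (a :+ b) := (x :* h :+ a) :+ (y :* h :+ b)) refl
             x y (coeff h i) _ _ ⟩
      (x * coeff h i + coeff (0# ∷ mul f h) i) + (y * coeff h i + coeff (0# ∷ mul g h) i)
        ≈⟨ +-cong (coeff-mul-∷ x f h i) (coeff-mul-∷ y g h i) ⟨
      coeff (mul (x ∷ f) h) i + coeff (mul (y ∷ g) h) i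
        ≈⟨ coeff-add (mul (x ∷ f) h) (mul (y ∷ g) h) i ⟨
      coeff (add (mul (x ∷ f) h) (mul (y ∷ g) h)) i ∎

    mul-scale : ∀ x f g → mul (map (x *_) f) g ≋ map (x *_) (mul f g)
    mul-scale x []      g i = refl
    mul-scale x (y ∷ f) g i = begin
      coeff (mul (x * y ∷ map (x *_) f) g) i
        ≈⟨ coeff-mul-∷ (x * y) (map (x *_) f) g i ⟩
      x * y * coeff g i + coeff (0# ∷ mul (map (x *_) f) g) i
        ≈⟨ +-cong (*-assoc _ _ _) (shift-scale i) ⟩
      x * (y * coeff g i) + x * coeff (0# ∷ mul f g) i
        ≈⟨ distribˡ _ _ _ ⟨
      x * (y * coeff g i + coeff (0# ∷ mul f g) i)
        ≈⟨ *-congˡ (coeff-mul-∷ y f g i) ⟨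
      x * coeff (mul (y ∷ f) g) i
        ≈⟨ coeff-scale x (mul (y ∷ f) g) i ⟨
      coeff (map (x *_) (mul (y ∷ f) g)) i ∎
      where
      shift-scale : ∀ i → coeff (0# ∷ mul (map (x *_) f) g) i ≈ x * coeff (0# ∷ mul f g) i
      shift-scale zero    = sym (zeroʳ x)
      shift-scale (suc i) = trans (mul-scale x f g i) (coeff-scale x (mul f g) i)

    mul-shift : ∀ f g → mul (0# ∷ f) g ≋ (0# ∷ mul f g)
    mul-shift f g i = trans (coeff-mul-∷ 0# f g i) (trans (+-congʳ (zeroˡ _)) (+-identityˡ _))

    mul-assoc : ∀ f g h → mul (mul f g) h ≋ mul f (mul g h)
    mul-assoc []      g h i = refl
    mul-assoc (x ∷ f) g h i = begin
      coeff (mul (add (map (x *_) g) (0# ∷ mul f g)) h) i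
        ≈⟨ mul-distribʳ h (map (x *_) g) (0# ∷ mul f g) i ⟩
      coeff (add (mul (map (x *_) g) h) (mul (0# ∷ mul f g) h)) i
        ≈⟨ coeff-add (mul (map (x *_) g) h) (mul (0# ∷ mul f g) h) i ⟩
      coeff (mul (map (x *_) g) h) i + coeff (mul (0# ∷ mul f g) h) i
        ≈⟨ +-cong (mul-scale x g h i) (trans (mul-shift (mul f g) h i)
             (shift-≋ (mul (mul f g) h) (mul f (mul g h)) (mul-assoc f g h) i)) ⟩
      coeff (map (x *_) (mul g h)) i + coeff (0# ∷ mul f (mul g h)) i
        ≈⟨ coeff-add (map (x *_) (mul g h)) (0# ∷ mul f (mul g h)) i ⟨
      coeff (mul (x ∷ f) (mul g h)) i ∎

    mul-identityˡ : ∀ f → mul (1# ∷ []) f ≋ f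
    mul-identityˡ f i = trans (coeff-mul-∷ 1# [] f i) (trans (+-cong (*-identityˡ _) (zeros i)) (+-identityʳ _))
      where
      zeros : ∀ i → coeff (0# ∷ []) i ≈ 0#
      zeros zero    = refl
      zeros (suc i) = refl

    ≃-trans : ∀ {f g h} → f ≃ g → g ≃ h → f ≃ h
    ≃-trans (coeffs e) (coeffs e′) = coeffs λ i → trans (e i) (e′ i)

    mul-comm′ : ∀ f g → mul f g ≃ mul g f
    mul-comm′ f g = coeffs (mul-comm f g)

    add-cong : ∀ {f f′ g g′} → f ≃ f′ → g ≃ g′ → add f g ≃ add f′ g′
    add-cong {f} {f′} {g} {g′} (coeffs e) (coeffs e′) = coeffs λ i →
      trans (coeff-add f g i) (trans (+-cong (e i) (e′ i)) (sym (coeff-add f′ g′ i)))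

    mul-cong : ∀ {f f′ g g′} → f ≃ f′ → g ≃ g′ → mul f g ≃ mul f′ g′
    mul-cong {f} {f′} {g} {g′} (coeffs e) (coeffs e′) =
      ≃-trans (coeffs (mul-congʳ f g g′ e′)) (≃-trans (mul-comm′ f g′)
        (≃-trans (coeffs (mul-congʳ g′ f f′ e)) (mul-comm′ g′ f′)))

    add-comm : ∀ f g → add f g ≃ add g f
    add-comm f g = coeffs λ i →
      trans (coeff-add f g i) (trans (+-comm _ _) (sym (coeff-add g f i)))

    add-assoc : ∀ f g h → add (add f g) h ≃ add f (add g h)
    add-assoc f g h = coeffs λ i → begin
      coeff (add (add f g) h) i            ≈⟨ coeff-add (add f g) h i ⟩
      coeff (add f g) i + coeff h i        ≈⟨ +-congʳ (coeff-add f g i) ⟩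
      coeff f i + coeff g i + coeff h i    ≈⟨ +-assoc _ _ _ ⟩
      coeff f i + (coeff g i + coeff h i)  ≈⟨ +-congˡ (coeff-add g h i) ⟨
      coeff f i + coeff (add g h) i        ≈⟨ coeff-add f (add g h) i ⟨
      coeff (add f (add g h)) i            ∎

    add-identityʳ : ∀ f → add f [] ≃ f
    add-identityʳ f = coeffs λ i → trans (coeff-add f [] i) (+-identityʳ _)

    add-inverseʳ : ∀ f → add f (map (-_) f) ≃ []
    add-inverseʳ f = coeffs λ i →
      trans (coeff-add f (map (-_) f) i) (trans (+-congˡ (coeff-neg f i)) (-‿inverseʳ _))

    neg-cong : ∀ {f g} → f ≃ g → map (-_) f ≃ map (-_) g
    neg-cong {f} {g} (coeffs e) = coeffs λ i →
      trans (coeff-neg f i) (trans (-‿cong (e i)) (sym (coeff-neg g i)))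

  polynomialRing : CommutativeRing c ℓ
  polynomialRing = record
    { Carrier = Poly ; _≈_ = _≃_ ; _+_ = add ; _*_ = mul ; -_ = map (-_) ; 0# = [] ; 1# = 1# ∷ []
    ; isCommutativeRing = record
      { isRing = record
        { +-isAbelianGroup = record
          { isGroup = record
            { isMonoid = record
              { isSemigroup = record
                { isMagma = record
                  { isEquivalence = record
                    { refl = coeffs λ i → refl
                    ; sym = λ (coeffs e) → coeffs λ i → sym (e i)
                    ; trans = ≃-trans }
                  ; ∙-cong = add-cong }
                ; assoc = add-assoc }
              ; identity = (λ f → coeffs λ i → refl) , add-identityʳ }
            ; inverse = (λ f → ≃-trans (add-comm (map (-_) f) f) (add-inverseʳ f)) , add-inverseʳ
            ; ⁻¹-cong = neg-cong }
          ; comm = add-comm }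
        ; *-cong = mul-cong
        ; *-assoc = λ f g h → coeffs (mul-assoc f g h)
        ; *-identity = (λ f → coeffs (mul-identityˡ f))
                     , (λ f → ≃-trans (mul-comm′ f _) (coeffs (mul-identityˡ f)))
        ; distrib = (λ h f g → ≃-trans (mul-comm′ h (add f g))
                      (≃-trans (coeffs (mul-distribʳ h f g)) (add-cong (mul-comm′ f h) (mul-comm′ g h))))
                  , (λ h f g → coeffs (mul-distribʳ h f g)) }
      ; *-comm = mul-comm′ } }

  X : Poly
  X = 0# ∷ 1# ∷ []

  shift≃X* : ∀ f → (0# ∷ f) ≃ mul X f
  shift≃X* f = coeffs λ i → sym (trans (mul-shift (1# ∷ []) f i)
    (shift-≋ (mul (1# ∷ []) f) f (mul-identityˡ f) i))

  horner : ∀ x f → (x ∷ f) ≃ add (x ∷ []) (mul X f)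
  horner x f = ≃-trans (coeffs λ { zero → sym (+-identityʳ x) ; (suc i) → refl })
    (add-cong {x ∷ []} {x ∷ []} {0# ∷ f} {mul X f} (coeffs λ i → refl) (shift≃X* f))

  const-*ₚ : ∀ x f → mul (x ∷ []) f ≃ map (x *_) f
  const-*ₚ x f = coeffs λ i → trans (coeff-mul-∷ x [] f i)
    (trans (+-congˡ (zeros i)) (trans (+-identityʳ _) (sym (coeff-scale x f i))))
    where
    zeros : ∀ i → coeff (0# ∷ []) i ≈ 0#
    zeros zero    = refl
    zeros (suc i) = refl

  const-isHomomorphism : IsRingHomomorphism (CommutativeRing.rawRing R)
    (CommutativeRing.rawRing polynomialRing) (_∷ [])
  const-isHomomorphism = record
    { isSemiringHomomorphism = record
      { isNearSemiringHomomorphism = record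
        { +-isMonoidHomomorphism = record
          { isMagmaHomomorphism = record
            { isRelHomomorphism = record { cong = λ e → coeffs λ { zero → e ; (suc i) → refl } }
            ; homo = λ x y → coeffs λ i → refl }
          ; ε-homo = coeffs λ { zero → refl ; (suc i) → refl } }
        ; *-homo = λ x y → coeffs λ { zero → sym (+-identityʳ _) ; (suc i) → refl } }
      ; 1#-homo = coeffs λ i → refl }
    ; -‿homo = λ x → coeffs λ i → refl }

  Below : Poly → ℕ → Set ℓ
  Below f n = ∀ i → n ℕ.≤ i → coeff f i ≈ 0#

  MonicOfDegree : ℕ → Poly → Set ℓ
  MonicOfDegree d f = coeff f d ≈ 1# × Below f (suc d)

  below⇒≃[] : ∀ {f} → Below f 0 → f ≃ []
  below⇒≃[] e = coeffs λ i → e i z≤n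

  below-resp : ∀ {f g n} → f ≃ g → Below f n → Below g n
  below-resp (coeffs e) b i n≤i = trans (sym (e i)) (b i n≤i)

  -- Degrees are upper bounds here, so that zero divisors do no harm; that leading coefficients do
  -- not vanish comes in later, from monicity or from a field.
  mul-top : ∀ f g a b → Below f (suc a) → Below g (suc b) →
            coeff (mul f g) (a ℕ.+ b) ≈ coeff f a * coeff g b × Below (mul f g) (suc (a ℕ.+ b))
  mul-top []      g a       b f< g< = sym (zeroˡ _) , (λ _ _ → refl)
  mul-top (x ∷ f) g zero    b f< g< = top , below
    where
    fg≈0 : ∀ i → coeff (0# ∷ mul f g) i ≈ 0#
    fg≈0 zero    = refl
    fg≈0 (suc i) = coeff-≈ (mul-cong {f} {[]} {g} {g} (below⇒≃[] λ i _ → f< (suc i) (s≤s z≤n))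
                                     (coeffs λ i → refl)) i
    at : ∀ i → coeff (mul (x ∷ f) g) i ≈ x * coeff g i
    at i = trans (coeff-mul-∷ x f g i) (trans (+-congˡ (fg≈0 i)) (+-identityʳ _))
    top = at b
    below : Below (mul (x ∷ f) g) (suc b)
    below i b<i = trans (at i) (trans (*-congˡ (g< i b<i)) (zeroʳ x))
  mul-top (x ∷ f) g (suc a) b f< g< with mul-top f g a b (λ i a<i → f< (suc i) (s≤s a<i)) g<
  ... | top′ , below′ = trans (at (a ℕ.+ b) (s≤s (ℕ.m≤n+m b a))) top′ , below
    where
    at : ∀ i → suc b ℕ.≤ suc i → coeff (mul (x ∷ f) g) (suc i) ≈ coeff (mul f g) i
    at i b<i = trans (coeff-mul-∷ x f g (suc i))
      (trans (+-congʳ (trans (*-congˡ (g< (suc i) b<i)) (zeroʳ x))) (+-identityˡ _))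
    below : Below (mul (x ∷ f) g) (suc (suc a ℕ.+ b))
    below (suc i) (s≤s le) = trans (at i (s≤s (ℕ.≤-trans (ℕ.m≤n+m b (suc a)) le))) (below′ i le)

  monic-* : ∀ {f g a b} → MonicOfDegree a f → MonicOfDegree b g → MonicOfDegree (a ℕ.+ b) (mul f g)
  monic-* {f} {g} {a} {b} (fa , f<) (gb , g<) with mul-top f g a b f< g<
  ... | top , below = trans top (trans (*-cong fa gb) (*-identityˡ 1#)) , below

  -- Long division in Horner form: if `f` leaves the remainder `r`, then `x + X f` leaves `x + X r`,
  -- of degree at most `d`, and subtracting `t` times the monic `h` removes its coefficient `t` at
  -- `d`.
  divMod : ∀ {h d} → MonicOfDegree d h → ∀ f → ∃₂ λ w r → f ≃ add (mul w h) r × Below r d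
  divMod {h} {d} (hd≈1 , h<) []      = [] , [] , coeffs (λ i → refl) , (λ i _ → refl)
  divMod {h} {d} (hd≈1 , h<) (x ∷ f) with divMod {h} {d} (hd≈1 , h<) f
  ... | w , r , coeffs e , r< = t ∷ w , r′ , coeffs f≈ , r′<
    where
    t  = coeff (x ∷ r) d
    r′ = add (x ∷ r) (map (-_) (map (t *_) h))
    coeff-r′ : ∀ i → coeff r′ i ≈ coeff (x ∷ r) i + - (t * coeff h i)
    coeff-r′ i = trans (coeff-add (x ∷ r) (map (-_) (map (t *_) h)) i)
      (+-congˡ (trans (coeff-neg (map (t *_) h) i) (-‿cong (coeff-scale t h i))))
    r′< : Below r′ d
    r′< i d≤i with ℕ.m≤n⇒m<n∨m≡n d≤i
    ... | inj₂ ≡.refl = trans (coeff-r′ d)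
      (trans (+-congˡ (-‿cong (trans (*-congˡ hd≈1) (*-identityʳ t)))) (-‿inverseʳ t))
    r′< (suc i) d≤i | inj₁ (s≤s d≤i′) = trans (coeff-r′ (suc i))
      (trans (+-cong (r< i d≤i′) (-‿cong (trans (*-congˡ (h< (suc i) (s≤s d≤i′))) (zeroʳ t))))
        (trans (+-identityˡ _) -0#≈0#))
    f≈ : (x ∷ f) ≋ add (mul (t ∷ w) h) r′
    f≈ i = begin
      coeff (x ∷ f) i
        ≈⟨ shifted i ⟩
      coeff (0# ∷ mul w h) i + coeff (x ∷ r) i
        ≈⟨ solve 4 (λ a b t h → a :+ b := (t :* h :+ a) :+ (b :- t :* h)) refl _ _ t (coeff h i) ⟩
      (t * coeff h i + coeff (0# ∷ mul w h) i) + (coeff (x ∷ r) i + - (t * coeff h i))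
        ≈⟨ +-cong (coeff-mul-∷ t w h i) (coeff-r′ i) ⟨
      coeff (mul (t ∷ w) h) i + coeff r′ i
        ≈⟨ coeff-add (mul (t ∷ w) h) r′ i ⟨
      coeff (add (mul (t ∷ w) h) r′) i ∎
      where
      shifted : ∀ i → coeff (x ∷ f) i ≈ coeff (0# ∷ mul w h) i + coeff (x ∷ r) i
      shifted zero    = sym (+-identityˡ x)
      shifted (suc i) = trans (e i) (coeff-add (mul w h) r i)

module RingHom (R : CommutativeRing c ℓ) (S : CommutativeRing c′ ℓ′)
  {φ : CommutativeRing.Carrier R → CommutativeRing.Carrier S}
  (φ-isHom : IsRingHomomorphism (CommutativeRing.rawRing R) (CommutativeRing.rawRing S) φ) where
  open IsRingHomomorphism φ-isHom public
    renaming (⟦⟧-cong to φ-cong; +-homo to φ-+; *-homo to φ-*; -‿homo to φ-neg; 0#-homo to φ-0; 1#-homo to φ-1)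
  private
    module R = RingTheory R
    module S = RingTheory S
  open S

  φ-^ : ∀ x n → φ (x R.^ n) ≈ φ x ^ n
  φ-^ x zero    = φ-1
  φ-^ x (suc n) = trans (φ-* x _) (*-congˡ (φ-^ x n))

  φ-· : ∀ n x → φ (n R.· x) ≈ n · φ x
  φ-· zero    x = φ-0
  φ-· (suc n) x = trans (φ-+ x _) (+-congˡ (φ-· n x))

  φ-geom : ∀ n x → φ (R.geom n x) ≈ geom n (φ x)
  φ-geom zero    x = φ-0
  φ-geom (suc n) x = trans (φ-+ _ _) (+-cong φ-1 (trans (φ-* _ _) (*-congˡ (φ-geom n x))))

∘-isRingHom : ∀ (R : CommutativeRing c ℓ) (S : CommutativeRing c′ ℓ′) (T : CommutativeRing c″ ℓ″) {f g} →
  IsRingHomomorphism (CommutativeRing.rawRing R) (CommutativeRing.rawRing S) f →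
  IsRingHomomorphism (CommutativeRing.rawRing S) (CommutativeRing.rawRing T) g →
  IsRingHomomorphism (CommutativeRing.rawRing R) (CommutativeRing.rawRing T) (λ x → g (f x))
∘-isRingHom R S T = Composition.isRingHomomorphism (CommutativeRing.trans T)

module Evaluation (R : CommutativeRing c ℓ) (S : CommutativeRing c′ ℓ′)
  {ι : CommutativeRing.Carrier R → CommutativeRing.Carrier S}
  (ι-isHom : IsRingHomomorphism (CommutativeRing.rawRing R) (CommutativeRing.rawRing S) ι) where
  private
    module R = CommutativeRing R
  open PolynomialRing R
  open RingHom R S ι-isHom
  open RingTheory S
  open import Relation.Binary.Reasoning.Setoid setoid

  ev : Poly → Carrier → Carrier
  ev = eval (CommutativeRing.rawRing S) ι

  module _ (x : Carrier) where
    ev-zero : ∀ f → f ≃ [] → ev f x ≈ 0#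
    ev-zero []      e          = refl
    ev-zero (a ∷ f) (coeffs e) = trans (+-cong (trans (φ-cong (e 0)) φ-0)
      (trans (*-congˡ (ev-zero f (coeffs λ i → e (suc i)))) (zeroʳ x))) (+-identityʳ 0#)

    ev-cong : ∀ f g → f ≃ g → ev f x ≈ ev g x
    ev-cong []      g       (coeffs e) = sym (ev-zero g (coeffs λ i → R.sym (e i)))
    ev-cong (a ∷ f) []      e = ev-zero (a ∷ f) e
    ev-cong (a ∷ f) (b ∷ g) (coeffs e) = +-cong (φ-cong (e 0)) (*-congˡ (ev-cong f g (coeffs λ i → e (suc i))))

    ev-add : ∀ f g → ev (add f g) x ≈ ev f x + ev g x
    ev-add []      g       = sym (+-identityˡ _)
    ev-add (a ∷ f) []      = sym (+-identityʳ _)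
    ev-add (a ∷ f) (b ∷ g) = trans (+-cong (φ-+ a b) (*-congˡ (ev-add f g)))
      (solve 5 (λ a b f g x → (a :+ b) :+ x :* (f :+ g) := (a :+ x :* f) :+ (b :+ x :* g)) refl
         (ι a) (ι b) (ev f x) (ev g x) x)

    ev-scale : ∀ a f → ev (map (a R.*_) f) x ≈ ι a * ev f x
    ev-scale a []      = sym (zeroʳ _)
    ev-scale a (b ∷ f) = trans (+-cong (φ-* a b) (*-congˡ (ev-scale a f)))
      (solve 4 (λ a b f x → a :* b :+ x :* (a :* f) := a :* (b :+ x :* f)) refl (ι a) (ι b) (ev f x) x)

    ev-neg : ∀ f → ev (map R.-_ f) x ≈ - ev f x
    ev-neg []      = sym -0#≈0#
    ev-neg (b ∷ f) = trans (+-cong (φ-neg b) (*-congˡ (ev-neg f)))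
      (solve 3 (λ b f x → :- b :+ x :* (:- f) := :- (b :+ x :* f)) refl (ι b) (ev f x) x)

    ev-mul : ∀ f g → ev (mul f g) x ≈ ev f x * ev g x
    ev-mul []      g = sym (zeroˡ _)
    ev-mul (a ∷ f) g = begin
      ev (add (map (a R.*_) g) (R.0# ∷ mul f g)) x
        ≈⟨ ev-add (map (a R.*_) g) (R.0# ∷ mul f g) ⟩
      ev (map (a R.*_) g) x + (ι R.0# + x * ev (mul f g) x)
        ≈⟨ +-cong (ev-scale a g) (+-cong φ-0 (*-congˡ (ev-mul f g))) ⟩
      ι a * ev g x + (0# + x * (ev f x * ev g x))
        ≈⟨ solve 4 (λ a f g x → a :* g :+ (con (+ 0) :+ x :* (f :* g)) := (a :+ x :* f) :* g) refl
             (ι a) (ev f x) (ev g x) x ⟩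
      (ι a + x * ev f x) * ev g x ∎

    ev-1 : ev (R.1# ∷ []) x ≈ 1#
    ev-1 = trans (+-cong φ-1 (zeroʳ x)) (+-identityʳ 1#)

    ev-const : ∀ a → ev (a ∷ []) x ≈ ι a
    ev-const a = trans (+-congˡ (zeroʳ x)) (+-identityʳ _)

    ev-X : ev X x ≈ x
    ev-X = trans (+-cong φ-0 (*-congˡ ev-1)) (trans (+-identityˡ _) (*-identityʳ x))

    ev-isHom : IsRingHomomorphism (CommutativeRing.rawRing polynomialRing) (CommutativeRing.rawRing S) (λ f → ev f x)
    ev-isHom = record
      { isSemiringHomomorphism = record
        { isNearSemiringHomomorphism = record
          { +-isMonoidHomomorphism = record
            { isMagmaHomomorphism = record
              { isRelHomomorphism = record { cong = λ {f} {g} → ev-cong f g }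
              ; homo = ev-add }
            ; ε-homo = refl }
          ; *-homo = ev-mul }
        ; 1#-homo = ev-1 }
      ; -‿homo = ev-neg }

  ev-congˣ : ∀ f {x y} → x ≈ y → ev f x ≈ ev f y
  ev-congˣ []      e = refl
  ev-congˣ (a ∷ f) e = +-congˡ (*-cong e (ev-congˣ f e))

-- Powers modulo M and modulo an ideal

coprime-^-divisor : ∀ {M a} i {t} → Coprime M a → M ∣ a ℕ.^ i ℕ.* t → M ∣ t
coprime-^-divisor         zero    {t} co d = ≡.subst (_ ∣_) (ℕ.*-identityˡ t) d
coprime-^-divisor {M} {a} (suc i) {t} co d = coprime-^-divisor i co
  (coprime-divisor co (≡.subst (M ∣_) (ℕ.*-assoc a (a ℕ.^ i) t) d))

-- Among the `M + 1` powers of `a` with exponents 0 to `M`, two agree modulo `M` by the pigeonhole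
-- principle, and the smaller one cancels because `a` is coprime to `M`.
power≡1 : ∀ a M .{{_ : NonZero a}} .{{_ : NonZero M}} → Coprime M a →
          ∃₂ λ j k → a ℕ.^ suc j ≡ 1 ℕ.+ M ℕ.* k
power≡1 a M co with Fin.pigeonhole (ℕ.n<1+n M) (λ i → fromℕ< (m%n<n (a ℕ.^ toℕ i) M))
... | i , j , i<j , eq = e , k , a^e′
  where
  open ≡.≡-Reasoning
  e t : ℕ
  -- The gap between the two exponents is `suc e`, hence positive; `M` is shown to divide
  -- `t = a ^ suc e - 1`.
  e = toℕ j ℕ.∸ suc (toℕ i)
  t = a ℕ.^ suc e ℕ.∸ 1
  A B : ℕ
  A = a ℕ.^ toℕ i
  B = a ℕ.^ toℕ j
  1+t : a ℕ.^ suc e ≡ 1 ℕ.+ t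
  1+t = ≡.sym (ℕ.m+[n∸m]≡n (ℕ.>-nonZero⁻¹ _ {{ℕ.m^n≢0 a (suc e)}}))
  B≡ : B ≡ A ℕ.+ A ℕ.* t
  B≡ = begin
    a ℕ.^ toℕ j                  ≡⟨ ≡.cong (a ℕ.^_) (≡.trans (ℕ.+-suc (toℕ i) e) (ℕ.m+[n∸m]≡n i<j)) ⟨
    a ℕ.^ (toℕ i ℕ.+ suc e)      ≡⟨ ℕ.^-distribˡ-+-* a (toℕ i) (suc e) ⟩
    A ℕ.* a ℕ.^ suc e            ≡⟨ ≡.cong (A ℕ.*_) 1+t ⟩
    A ℕ.* (1 ℕ.+ t)              ≡⟨ ℕ.*-suc A t ⟩
    A ℕ.+ A ℕ.* t                ∎
  %≡ : A % M ≡ B % M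
  %≡ = ≡.trans (≡.sym (Fin.toℕ-fromℕ< _)) (≡.trans (≡.cong toℕ eq) (Fin.toℕ-fromℕ< _))
  M∣ : M ∣ A ℕ.* t
  M∣ = ℕ∣.∣m+n∣m⇒∣n (divides (B / M) (ℕ.+-cancelˡ-≡ (A % M) _ _ (begin
    A % M ℕ.+ (A / M ℕ.* M ℕ.+ A ℕ.* t)  ≡⟨ ℕ.+-assoc (A % M) (A / M ℕ.* M) _ ⟨
    A % M ℕ.+ A / M ℕ.* M ℕ.+ A ℕ.* t    ≡⟨ ≡.cong (ℕ._+ A ℕ.* t) (m≡m%n+[m/n]*n A M) ⟨
    A ℕ.+ A ℕ.* t                        ≡⟨ B≡ ⟨
    B                                    ≡⟨ m≡m%n+[m/n]*n B M ⟩
    B % M ℕ.+ B / M ℕ.* M                ≡⟨ ≡.cong (ℕ._+ B / M ℕ.* M) %≡ ⟨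
    A % M ℕ.+ B / M ℕ.* M                ∎))) (ℕ∣.n∣m*n (A / M))
  M∣t : M ∣ t
  M∣t = coprime-^-divisor (toℕ i) co M∣
  k = ℕ∣.quotient M∣t
  a^e′ : a ℕ.^ suc e ≡ 1 ℕ.+ M ℕ.* k
  a^e′ = ≡.trans 1+t (≡.cong suc (ℕ∣.m∣n⇒n≡m*quotient M∣t))

prime∤1 : ∀ {q} → Prime q → ¬ q ∣ 1
prime∤1 pq d = ℕ.nonTrivial⇒≢1 {{prime⇒nonTrivial pq}} (ℕ∣.∣1⇒≡1 d)

prime∤⇒coprime : ∀ {q n} → Prime q → ¬ q ∣ n → Coprime n q
prime∤⇒coprime pq q∤n (d∣n , d∣q) with prime⇒irreducible pq d∣q
... | inj₁ d≡1    = d≡1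
... | inj₂ ≡.refl = contradiction d∣n q∤n

prime∣prime^ : ∀ {q p} → Prime q → Prime p → ∀ i → q ∣ p ℕ.^ i → q ≡ p
prime∣prime^ pq pp zero    d = contradiction d (prime∤1 pq)
prime∣prime^ {q} {p} pq pp (suc i) d with euclidsLemma p (p ℕ.^ i) pq d
... | inj₂ d′ = prime∣prime^ pq pp i d′
... | inj₁ d′ with prime⇒irreducible pp d′
...   | inj₁ ≡.refl = contradiction ℕ∣.∣-refl (prime∤1 pq)
...   | inj₂ q≡p    = q≡p

module _ (R : CommutativeRing c ℓ) where
  open RingTheory R

  ^-1+* : ∀ x M k → x ^ M ≈ 1# → x ^ (1 ℕ.+ M ℕ.* k) ≈ x
  ^-1+* x M k e = trans (*-congˡ (trans (sym (^-assocʳ x M k)) (trans (^-congˡ k e) (1^n≈1 k)))) (*-identityʳ x)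

  ^-fixed : ∀ {x Q} → x ^ Q ≈ x → ∀ i → x ^ (Q ℕ.^ i) ≈ x
  ^-fixed {x} e zero    = *-identityʳ x
  ^-fixed {x} {Q} e (suc i) = trans (sym (^-assocʳ x Q (Q ℕ.^ i))) (trans (^-congˡ (Q ℕ.^ i) e) (^-fixed e i))

  -- Iterating gives `x = x ^ (Q ^ e)`, and this is a multiple of `x ^ e` because `e ≤ Q ^ e`.
  fixed⇒reduced : ∀ {x Q} → 2 ℕ.≤ Q → x ^ Q ≈ x → ∀ e → x ^ e ≈ 0# → x ≈ 0#
  fixed⇒reduced {x} {Q} 2≤Q fix e x^e≈0 = trans (sym (^-fixed fix e)) (begin
    x ^ (Q ℕ.^ e)                        ≡⟨ ≡.cong (x ^_) (ℕ.m+[n∸m]≡n (e≤Q^e e)) ⟨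
    x ^ (e ℕ.+ (Q ℕ.^ e ℕ.∸ e))          ≈⟨ ^-homo-* x e _ ⟩
    x ^ e * x ^ (Q ℕ.^ e ℕ.∸ e)          ≈⟨ trans (*-congʳ x^e≈0) (zeroˡ _) ⟩
    0#                                   ∎)
    where
    open import Relation.Binary.Reasoning.Setoid setoid
    e≤Q^e : ∀ e → e ℕ.≤ Q ℕ.^ e
    e≤Q^e zero    = z≤n
    e≤Q^e (suc e) = ℕ.≤-trans (ℕ.+-mono-≤ (ℕ.>-nonZero⁻¹ _ {{ℕ.m^n≢0 Q e {{ℕ.>-nonZero (ℕ.<-trans (s≤s z≤n) 2≤Q)}}}}) (e≤Q^e e))
      (ℕ.≤-trans (ℕ.≤-reflexive (≡.cong (Q ℕ.^ e ℕ.+_) (≡.sym (ℕ.+-identityʳ _)))) (ℕ.*-monoˡ-≤ (Q ℕ.^ e) 2≤Q))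

  ^-double : ∀ x n → x ^ (2 ℕ.* n) ≈ x ^ n * x ^ n
  ^-double x n = trans (^-homo-* x n (n ℕ.+ 0)) (*-congˡ (^-congʳ x (ℕ.+-identityʳ n)))

  -- Squaring preserves the shape: the cross term of the two pure powers becomes the new middle
  -- term, and everything else picks up a factor 4. Precision 4 is required because the formula is
  -- later divided by 2 and then read modulo 2; the factor is written `2 * (2 * r)` for that
  -- division.
  ^2ⁱ-mod4 : ∀ i x y → ∃[ r ] (x + y) ^ (2 ℕ.^ suc i) ≈
    x ^ (2 ℕ.^ suc i) + y ^ (2 ℕ.^ suc i) + (1# + 1#) * (x ^ (2 ℕ.^ i) * y ^ (2 ℕ.^ i)) + (1# + 1#) * ((1# + 1#) * r)
  ^2ⁱ-mod4 zero x y = 0# , solve 2 (λ x y → (x :+ y) :* ((x :+ y) :* con (+ 1)) :=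
    x :* (x :* con (+ 1)) :+ y :* (y :* con (+ 1)) :+ (con (+ 1) :+ con (+ 1)) :* ((x :* con (+ 1)) :* (y :* con (+ 1)))
      :+ (con (+ 1) :+ con (+ 1)) :* ((con (+ 1) :+ con (+ 1)) :* con (+ 0))) refl x y
  ^2ⁱ-mod4 (suc i) x y with ^2ⁱ-mod4 i x y
  ... | r , e = _ , trans (^-double (x + y) n) (trans (*-cong e e) (trans
    (solve 4 (λ A B C r → let two = con (+ 1) :+ con (+ 1); z = A :+ B :+ two :* C :+ two :* (two :* r) in
      z :* z := A :* A :+ B :* B :+ two :* (A :* B) :+ two :* (two :*
        (C :* C :+ two :* (two :* (r :* r)) :+ (A :+ B) :* C :+ two :* ((A :+ B) :* r) :+ two :* (two :* (C :* r)))))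
      refl (x ^ n) (y ^ n) (x ^ (2 ℕ.^ i) * y ^ (2 ℕ.^ i)) r)
    (sym (+-congʳ (+-congʳ (+-cong (^-double x n) (^-double y n)))))))
    where n = 2 ℕ.^ suc i

module _ (B : CommutativeRing c ℓ) where
  open RingTheory B

  quotient-isHom : ∀ u v → IsRingHomomorphism (CommutativeRing.rawRing B) (CommutativeRing.rawRing (Quotient.quotient B u v)) id
  quotient-isHom u v = record
    { isSemiringHomomorphism = record
      { isNearSemiringHomomorphism = record
        { +-isMonoidHomomorphism = record
          { isMagmaHomomorphism = record
            { isRelHomomorphism = record { cong = Quot.≈⇒∼ }
            ; homo = λ _ _ → Quot.≈⇒∼ refl }
          ; ε-homo = Quot.≈⇒∼ refl }
        ; *-homo = λ _ _ → Quot.≈⇒∼ refl }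
      ; 1#-homo = Quot.≈⇒∼ refl }
    ; -‿homo = λ _ → Quot.≈⇒∼ refl }
    where module Quot = Quotient B u v

-- Integrality at one prime

module _ (K : CommutativeRing c ℓ) (B : CommutativeRing c′ ℓ′)
  {ι : CommutativeRing.Carrier B → CommutativeRing.Carrier K}
  (ι-isHom : IsRingHomomorphism (CommutativeRing.rawRing B) (CommutativeRing.rawRing K) ι) where
  private
    module K = RingTheory K
  open RingTheory B

  module Saturation (ι-injective : ∀ {x y} → ι x K.≈ ι y → x ≈ y) where

    open RingHom B K ι-isHom

    InImage : K.Carrier → Set _
    InImage β = ∃[ r ] β K.≈ ι r

    -- All that is needed of integrality: multiplying a monic equation for β by D ^ e turns D β = y into y ^ e ∈ D B.
    Integralˡ : K.Carrier → Set _
    Integralˡ β = ∀ D y → ι D K.* β K.≈ ι y → ∃₂ λ e t → y ^ e ≈ D * t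

    -- Reading `D (r β) = y` as `(D r) β = y` makes a power of `y` a multiple of `D r`, hence of
    -- `D`. This allows the prime factors of a denominator to be removed one at a time.
    Integralˡ-* : ∀ {β} r → Integralˡ β → Integralˡ (ι r K.* β)
    Integralˡ-* {β} r int D y e with int (D * r) y
      (K.trans (K.*-congʳ (φ-* D r)) (K.trans (K.*-assoc _ _ _) e))
    ... | i , t , e′ = i , r * t , trans e′ (*-assoc D r t)

    Invertible : K.Carrier → Set _
    Invertible x = ∃[ y ] y K.* x K.≈ K.1#

    -- From π ^ suc k β = s q β ∈ B the exponent of π is lowered one by one, at the cost of a factor σ ≡ 1 modulo q.
    module _ (q π s w′ σ x₀ : Carrier) (k : ℕ) where
      private
        module Quot = Quotient B q π
        module S = RingTheory Quot.quotient

      module Descent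
        (π^k : π ^ suc k ≈ q * s)
        (σ≈sw′ : σ ≈ s * w′)
        (σ≈ : σ ≈ 1# + q * x₀)
        (reduced : ∀ y e → y S.^ e S.≈ 0# → y S.≈ 0#)
        (q-inv : Invertible (ι q))
        (π-inv : ι π K.≈ K.0# ⊎ Invertible (ι π))
        where

        σ^ : ∀ J → ∃[ x ] σ ^ J ≈ 1# + q * x
        σ^ zero    = 0# , solve 1 (λ q → con (+ 1) := con (+ 1) :+ q :* con (+ 0)) refl q
        σ^ (suc J) with σ^ J
        ... | x , e = _ , trans (*-cong σ≈ e) (solve 3 (λ q x y →
          (con (+ 1) :+ q :* x) :* (con (+ 1) :+ q :* y) := con (+ 1) :+ q :* (x :+ y :+ q :* x :* y)) refl q x₀ x)

        module _ (β : K.Carrier) (β-int : Integralˡ β) (g : Carrier) (qβ : ι q K.* β K.≈ ι g) where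
          private
            -- Since `x = 1 + q y`, one has `β = x β - y (q β)`, and both terms lie in the image.
            cofactor : ∀ {x y r} → x ≈ 1# + q * y → ι x K.* β K.≈ ι r → InImage β
            cofactor {x} {y} {r} e e′ = r + - (y * g) , (begin
              β
                ≈⟨ K.solve 3 (λ q y β → β K.:= (K.con (+ 1) K.:+ q K.:* y) K.:* β K.:- y K.:* (q K.:* β)) K.refl (ι q) (ι y) β ⟩
              (K.1# K.+ ι q K.* ι y) K.* β K.- ι y K.* (ι q K.* β)
                ≈⟨ K.+-cong (K.trans (K.*-congʳ (K.sym ιx)) e′) (K.-‿cong (K.trans (K.*-congˡ qβ) (K.sym (φ-* y g)))) ⟩
              ι r K.- ι (y * g)
                ≈⟨ K.trans (φ-+ r (- (y * g))) (K.+-congˡ (φ-neg (y * g))) ⟨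
              ι (r + - (y * g)) ∎)
              where
              open import Relation.Binary.Reasoning.Setoid K.setoid
              ιx : ι x K.≈ K.1# K.+ ι q K.* ι y
              ιx = K.trans (φ-cong e) (K.trans (φ-+ _ _) (K.+-cong φ-1 (φ-* q y)))

            -- If π vanishes, so does `q s`, hence `s` because `q` is invertible in `K`, hence its
            -- multiple `σ`. As `σ` is 1 modulo `q`, `cofactor` applies with `σ β = 0`.
            degenerate : ι π K.≈ K.0# → InImage β
            degenerate ιπ≈0 = cofactor {σ} {x₀} {0#} σ≈ (K.trans (K.*-congʳ ισ≈0) (K.trans (K.zeroˡ β) (K.sym φ-0)))
              where
              open import Relation.Binary.Reasoning.Setoid K.setoid
              q⁻¹ = proj₁ q-inv
              ισ≈0 : ι σ K.≈ K.0#
              ισ≈0 = begin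
                ι σ                                     ≈⟨ K.trans (φ-cong σ≈sw′) (φ-* s w′) ⟩
                ι s K.* ι w′                            ≈⟨ K.*-congʳ (K.*-identityˡ _) ⟨
                K.1# K.* ι s K.* ι w′                   ≈⟨ K.*-congʳ (K.*-congʳ (proj₂ q-inv)) ⟨
                q⁻¹ K.* ι q K.* ι s K.* ι w′            ≈⟨ K.*-congʳ (K.*-assoc _ _ _) ⟩
                q⁻¹ K.* (ι q K.* ι s) K.* ι w′          ≈⟨ K.*-congʳ (K.*-congˡ (K.trans (φ-cong π^k) (φ-* q s))) ⟨
                q⁻¹ K.* ι (π * π ^ k) K.* ι w′          ≈⟨ K.*-congʳ (K.*-congˡ (K.trans (φ-* _ _) (K.trans (K.*-congʳ ιπ≈0) (K.zeroˡ _)))) ⟩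
                q⁻¹ K.* K.0# K.* ι w′                   ≈⟨ K.trans (K.*-congʳ (K.zeroʳ _)) (K.zeroˡ _) ⟩
                K.0#                                    ∎

            Descends : ℕ → Set _
            Descends i = ∃₂ λ J r → ι (σ ^ J * π ^ i) K.* β K.≈ ι r

            power∈⇒∈ : ∀ y m D t → y ^ m ≈ π * D * t → y Quot.∼ 0#
            power∈⇒∈ y m D t e = reduced y m (S.trans {y S.^ m} {y ^ m} {0#} y^m≈ y^m∼0)
              where
              y^m≈ : (y S.^ m) Quot.∼ (y ^ m)
              y^m≈ = S.sym {y ^ m} {y S.^ m} (RingHom.φ-^ B Quot.quotient (quotient-isHom B q π) y m)
              y^m∼0 : (y ^ m) Quot.∼ 0#
              y^m∼0 = 0# , D * t , trans e (solve 4 (λ q π D t →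
                π :* D :* t := con (+ 0) :+ (q :* con (+ 0) :+ π :* (D :* t))) refl q π D t)

            -- `σ` is a multiple of `s` and `q s = π ^ suc k`, so `σ` moves the generator `q` of the
            -- ideal (q, π) into the multiples of `π`.
            σ-absorbs : ∀ {y} → ((a , b , _) : y Quot.∼ 0#) → σ * y ≈ π * (π ^ k * w′ * a + σ * b)
            σ-absorbs {y} (a , b , y≈) = begin
              σ * y
                ≈⟨ *-congˡ y≈ ⟩
              σ * (0# + (q * a + π * b))
                ≈⟨ solve 5 (λ σ q π a b → σ :* (con (+ 0) :+ (q :* a :+ π :* b)) := σ :* (q :* a) :+ π :* (σ :* b)) refl σ q π a b ⟩
              σ * (q * a) + π * (σ * b)
                ≈⟨ +-congʳ (*-congʳ σ≈sw′) ⟩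
              s * w′ * (q * a) + π * (σ * b)
                ≈⟨ +-congʳ (solve 4 (λ s w q a → s :* w :* (q :* a) := q :* s :* (w :* a)) refl s w′ q a) ⟩
              q * s * (w′ * a) + π * (σ * b)
                ≈⟨ +-congʳ (*-congʳ π^k) ⟨
              π * π ^ k * (w′ * a) + π * (σ * b)
                ≈⟨ solve 5 (λ π z w a b → π :* z :* (w :* a) :+ π :* b := π :* (z :* w :* a :+ b)) refl π (π ^ k) w′ a (σ * b) ⟩
              π * (π ^ k * w′ * a + σ * b) ∎
              where open import Relation.Binary.Reasoning.Setoid setoid

            divide-π : Invertible (ι π) → ∀ {D y r} → ι (π * D) K.* β K.≈ ι y → σ * y ≈ π * r →
                       ι (σ * D) K.* β K.≈ ι r
            divide-π (π⁻¹ , π⁻¹π≈1) {D} {y} {r} e e′ = begin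
              ι (σ * D) K.* β
                ≈⟨ K.*-congʳ (φ-* σ D) ⟩
              ι σ K.* ι D K.* β
                ≈⟨ K.*-identityˡ _ ⟨
              K.1# K.* (ι σ K.* ι D K.* β)
                ≈⟨ K.*-congʳ π⁻¹π≈1 ⟨
              π⁻¹ K.* ι π K.* (ι σ K.* ι D K.* β)
                ≈⟨ K.solve 5 (λ i π σ D β → i K.:* π K.:* (σ K.:* D K.:* β) K.:= i K.:* (σ K.:* (π K.:* D K.:* β))) K.refl
                     π⁻¹ (ι π) (ι σ) (ι D) β ⟩
              π⁻¹ K.* (ι σ K.* (ι π K.* ι D K.* β))
                ≈⟨ K.*-congˡ (K.*-congˡ (K.trans (K.*-congʳ (K.sym (φ-* π D))) e)) ⟩
              π⁻¹ K.* (ι σ K.* ι y)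
                ≈⟨ K.*-congˡ (K.trans (K.sym (φ-* σ y)) (K.trans (φ-cong e′) (φ-* π r))) ⟩
              π⁻¹ K.* (ι π K.* ι r)
                ≈⟨ K.trans (K.sym (K.*-assoc _ _ _)) (K.trans (K.*-congʳ π⁻¹π≈1) (K.*-identityˡ _)) ⟩
              ι r ∎
              where open import Relation.Binary.Reasoning.Setoid K.setoid

            swap-π : ∀ J i → σ ^ J * π ^ suc i ≈ π * (σ ^ J * π ^ i)
            swap-π J i = trans (sym (*-assoc _ _ _)) (trans (*-congʳ (*-comm _ _)) (*-assoc _ _ _))

            step : Invertible (ι π) → ∀ i → Descends (suc i) → Descends i
            step inv i (J , y , e) =
              let D              = σ ^ J * π ^ i
                  e₁             = K.trans (K.*-congʳ (φ-cong (sym (swap-π J i)))) e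
                  -- Integrality is applied with the denominator `π * D` rather than `D`: the power
                  -- of `y` is then divisible by `π`, and `y` is nilpotent modulo (q, π).
                  m , t , y^m    = β-int (π * D) y e₁
                  y∼0            = power∈⇒∈ y m D t y^m
                  e₂             = divide-π inv e₁ (σ-absorbs y∼0)
              in suc J , _ , K.trans (K.*-congʳ (φ-cong (*-assoc σ (σ ^ J) (π ^ i)))) e₂

            descend : Invertible (ι π) → ∀ i → Descends i → Descends 0
            descend inv zero    d = d
            descend inv (suc i) d = descend inv i (step inv i d)

            start : Descends (suc k)
            start = 0 , s * g , K.trans (K.*-congʳ (K.trans (φ-cong (trans (*-identityˡ _) (trans π^k (*-comm q s)))) (φ-* s q)))
              (K.trans (K.*-assoc _ _ _) (K.trans (K.*-congˡ qβ) (K.sym (φ-* s g))))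

          saturated : InImage β
          saturated = [ degenerate , regular ] π-inv
            where
            regular : Invertible (ι π) → InImage β
            regular inv =
              let J , r , e = descend inv (suc k) start
                  x , e′    = σ^ J
              in cofactor {σ ^ J * 1#} {x} {r} (trans (*-identityʳ _) e′) e

    -- Here q = π ^ suc k up to a factor that is a unit modulo q.
    module _ (q π s w : Carrier) (k : ℕ) where
      private
        module Quot = Quotient B q π
        module S = RingTheory Quot.quotient

      module _
        (π^k : π ^ suc k ≈ q * s)
        (sw∼1 : s * w S.≈ 1#)
        (reduced : ∀ y e → y S.^ e S.≈ 0# → y S.≈ 0#)
        (q-inv : Invertible (ι q))
        (π-inv : ι π K.≈ K.0# ⊎ Invertible (ι π))
        where

        private
          -- `s w = 1 - x` modulo `q` with `x = - π b`. Multiplying by the geometric sum `G` gives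
          -- `1 - x ^ suc k`, and `x ^ suc k` is a multiple of `π ^ suc k = q s`. So a unit modulo
          -- (q, π) is already a unit modulo `q`.
          unit-mod-q : ∃₂ λ w′ x → s * w′ ≈ 1# + q * x
          unit-mod-q = w * G , a * G + - (s * (- b) ^ suc k) , (begin
              s * (w * G)
                ≈⟨ *-assoc s w G ⟨
              s * w * G
                ≈⟨ *-congʳ e ⟩
              (1# + (q * a + π * b)) * G
                ≈⟨ linear (- 1#) (geom-telescope (suc k) x) (solve 6 (λ q a π b G X →
                     (con (+ 1) :+ (q :* a :+ π :* b)) :* G :+ (:- con (+ 1)) :* (G :+ X)
                     := con (+ 1) :+ q :* a :* G :- X :+ (:- con (+ 1)) :* (π :* (:- b) :* G :+ con (+ 1)))
                     refl q a π b G (x ^ suc k)) ⟩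
              1# + q * a * G - x ^ suc k
                ≈⟨ +-congˡ (-‿cong (trans (^-distrib-* π (- b) (suc k)) (*-congʳ π^k))) ⟩
              1# + q * a * G - q * s * (- b) ^ suc k
                ≈⟨ solve 5 (λ q a G s Y → con (+ 1) :+ q :* a :* G :- q :* s :* Y
                     := con (+ 1) :+ q :* (a :* G :- s :* Y)) refl q a G s ((- b) ^ suc k) ⟩
              1# + q * (a * G + - (s * (- b) ^ suc k)) ∎)
            where
            a = proj₁ sw∼1
            b = proj₁ (proj₂ sw∼1)
            e = proj₂ (proj₂ sw∼1)
            x = π * - b
            G = geom (suc k) x
            open import Relation.Binary.Reasoning.Setoid setoid

        saturated : ∀ β → Integralˡ β → ∀ g → ι q K.* β K.≈ ι g → InImage β
        saturated = let w′ , x , e = unit-mod-q in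
          Descent.saturated q π s w′ (s * w′) x k π^k refl e reduced q-inv π-inv

-- Roots of unity and Frobenius in residue rings

module _ (R : CommutativeRing c ℓ) where
  open RingTheory R

  geom≈0⇒root-of-unity : ∀ {ζ} p P → geom p (ζ ^ P) ≈ 0# → ζ ^ (P ℕ.* p) ≈ 1#
  geom≈0⇒root-of-unity {ζ} p P e = begin
    ζ ^ (P ℕ.* p)                          ≈⟨ ^-assocʳ ζ P p ⟨
    (ζ ^ P) ^ p                            ≈⟨ +-identityˡ _ ⟨
    0# + (ζ ^ P) ^ p                       ≈⟨ +-congʳ e ⟨
    geom p (ζ ^ P) + (ζ ^ P) ^ p           ≈⟨ geom-telescope p (ζ ^ P) ⟨
    ζ ^ P * geom p (ζ ^ P) + 1#            ≈⟨ +-congʳ (trans (*-congˡ e) (zeroʳ _)) ⟩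
    0# + 1#                                ≈⟨ +-identityˡ 1# ⟩
    1#                                     ∎
    where open import Relation.Binary.Reasoning.Setoid setoid

  module _ {q : ℕ} (pq : Prime q) (q≈0 : q · 1# ≈ 0#) where
    open Frobenius R pq q≈0 using (^pʲ-homo-+)

    -- Since θ ^ N = ζ - 1 lies in the subring generated by ζ, on which a power of Frobenius is trivial.
    unramified-fixed : ∀ {θ τ N M} → Coprime M q → .{{_ : NonZero M}} → ¬ q ∣ N → θ * τ ≈ 1# →
                       (1# + θ ^ N) ^ M ≈ 1# → ∃[ j ] θ ^ (q ℕ.^ suc j) ≈ θ
    unramified-fixed {θ} {τ} {N} {M} co q∤N θτ≈1 ζ^M≈1 =
      let j , k , q^j≡ = power≡1 q M co
      in stage₂ j (M ℕ.* k) q^j≡ (^-1+* R ζ M k ζ^M≈1)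
      where
      instance _ = prime⇒nonZero pq
      open import Relation.Binary.Reasoning.Setoid setoid
      ζ = 1# + θ ^ N
      stage₂ : ∀ j E → q ℕ.^ suc j ≡ 1 ℕ.+ E → ζ ^ (1 ℕ.+ E) ≈ ζ → ∃[ j ] θ ^ (q ℕ.^ suc j) ≈ θ
      stage₂ j E q^j≡ ζ-fixed =
        -- `q` divides `1 + E` and hence not `E`. So the exponent in `θ ^ (N * E) = 1` is prime to
        -- `q`, and a power of `q` that is 1 modulo `N * E` fixes θ.
        let j₂ , k , q^j₂≡ = power≡1 q (N ℕ.* E) {{it}} {{ℕ.≢-nonZero (λ NE≡0 → q∤NE (≡.subst (q ∣_) (≡.sym NE≡0) (q ℕ∣.∣0)))}}
                               (prime∤⇒coprime pq q∤NE)
        in j₂ , trans (^-congʳ θ q^j₂≡) (^-1+* R θ (N ℕ.* E) k θ^NE≈1)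
        where
        it = prime⇒nonZero pq
        u = θ ^ N
        q∤E : ¬ q ∣ E
        q∤E q∣E = prime∤1 pq (ℕ∣.∣m+n∣m⇒∣n (≡.subst (q ∣_) (≡.trans q^j≡ (ℕ.+-comm 1 E)) (ℕ∣.m∣m*n _)) q∣E)
        q∤NE : ¬ q ∣ N ℕ.* E
        q∤NE d = [ q∤N , q∤E ] (euclidsLemma N E pq d)
        u-fixed : u * u ^ E ≈ u
        u-fixed = +-cancelˡ 1# _ _ (begin
          1# + u ^ (1 ℕ.+ E)                       ≈⟨ +-cong (1^n≈1 (q ℕ.^ suc j)) (^-congʳ u q^j≡) ⟨
          1# ^ (q ℕ.^ suc j) + u ^ (q ℕ.^ suc j)   ≈⟨ ^pʲ-homo-+ (suc j) 1# u ⟨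
          ζ ^ (q ℕ.^ suc j)                        ≈⟨ ^-congʳ ζ q^j≡ ⟩
          ζ ^ (1 ℕ.+ E)                            ≈⟨ ζ-fixed ⟩
          1# + u                                   ∎)
        uτ≈1 : u * τ ^ N ≈ 1#
        uτ≈1 = trans (sym (^-distrib-* θ τ N)) (trans (^-congˡ N θτ≈1) (1^n≈1 N))
        θ^NE≈1 : θ ^ (N ℕ.* E) ≈ 1#
        θ^NE≈1 = begin
          θ ^ (N ℕ.* E)          ≈⟨ ^-assocʳ θ N E ⟨
          u ^ E                  ≈⟨ *-identityˡ _ ⟨
          1# * u ^ E             ≈⟨ *-congʳ uτ≈1 ⟨
          u * τ ^ N * u ^ E      ≈⟨ solve 3 (λ u t e → u :* t :* e := (u :* e) :* t) refl u (τ ^ N) (u ^ E) ⟩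
          u * u ^ E * τ ^ N      ≈⟨ *-congʳ u-fixed ⟩
          u * τ ^ N              ≈⟨ uτ≈1 ⟩
          1#                     ∎

    1+-fixed : ∀ {θ ξ} j → ξ ≈ 1# + θ → ξ ^ (q ℕ.^ suc j) ≈ ξ → θ ^ (q ℕ.^ suc j) ≈ θ
    1+-fixed {θ} {ξ} j ξ≈ fix = +-cancelˡ 1# _ _ (begin
      1# + θ ^ Q          ≈⟨ +-congʳ (1^n≈1 Q) ⟨
      1# ^ Q + θ ^ Q      ≈⟨ ^pʲ-homo-+ (suc j) 1# θ ⟨
      (1# + θ) ^ Q        ≈⟨ ^-congˡ Q ξ≈ ⟨
      ξ ^ Q               ≈⟨ fix ⟩
      ξ                   ≈⟨ ξ≈ ⟩
      1# + θ              ∎)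
      where
      open import Relation.Binary.Reasoning.Setoid setoid
      Q = q ℕ.^ suc j

  -- θ divides `p`, and `p` is a unit where `q` vanishes, because some power `p ^ suc j` is 1 modulo
  -- `q`.
  prime-inverse : ∀ {p q θ t} → Prime p → Prime q → q ≢ p → q · 1# ≈ 0# → p · 1# + θ * t ≈ 0# → ∃[ τ ] θ * τ ≈ 1#
  prime-inverse {p} {q} {θ} {t} pp pq q≢p q≈0 e =
    let instance _ = prime⇒nonZero pp
                 _ = prime⇒nonZero pq
        j , k , p^j≡ = power≡1 p q (prime∤⇒coprime pp (λ p∣q → q≢p (≡.sym (prime∣prime^ pp pq 1 (≡.subst (p ∣_) (≡.sym (ℕ.*-identityʳ q)) p∣q)))))
    in - (t * ((p ℕ.^ j) · 1#)) , (begin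
      θ * - (t * ((p ℕ.^ j) · 1#))
        ≈⟨ linear (- ((p ℕ.^ j) · 1#)) e (solve 4 (λ θ t p z →
             θ :* (:- (t :* z)) :+ (:- z) :* con (+ 0) := p :* z :+ (:- z) :* (p :+ θ :* t)) refl θ t (p · 1#) ((p ℕ.^ j) · 1#)) ⟩
      p · 1# * (p ℕ.^ j) · 1#   ≈⟨ ×1-homo-* p (p ℕ.^ j) ⟨
      (p ℕ.^ suc j) · 1#        ≈⟨ ×-congˡ p^j≡ ⟩
      1# + (q ℕ.* k) · 1#       ≈⟨ +-congˡ (trans (×1-homo-* q k) (trans (*-congʳ q≈0) (zeroˡ _))) ⟩
      1# + 0#                   ≈⟨ +-identityʳ 1# ⟩
      1#                        ∎)
    where
    open import Relation.Binary.Reasoning.Setoid setoid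

module _ (B : CommutativeRing c ℓ) where
  open RingTheory B

  -- Generation as a ring, encoded as an induction principle: it carries a property from θ to all of
  -- `B` without a normal form for elements.
  GeneratedBy : Carrier → (ℓ′ : Level) → Set _
  GeneratedBy θ ℓ′ = ∀ (P : Carrier → Set ℓ′) → (∀ {x y} → x ≈ y → P x → P y) → P 0# → P 1# → P θ →
    (∀ {x y} → P x → P y → P (x + y)) → (∀ {x y} → P x → P y → P (x * y)) → (∀ {x} → P x → P (- x)) → ∀ x → P x

module _ (B : CommutativeRing c ℓ) where
  open RingTheory B

  module LocalRings (θ : Carrier) (generated : GeneratedBy B θ (c ⊔ ℓ)) {q : ℕ} (pq : Prime q) (π : Carrier) where

    private
      Q = q · 1#
      module Quot = Quotient B Q π
    module S = RingTheory Quot.quotient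
    open RingHom B Quot.quotient (quotient-isHom B Q π) public

    q≈0 : q S.· S.1# S.≈ S.0#
    q≈0 = S.trans {q S.· S.1#} {Q} {S.0#} (S.sym {Q} {q S.· S.1#} (φ-· q 1#)) Quot.u∼0

    private
      instance _ = prime⇒nonZero pq
               _ = prime⇒nonTrivial pq
      open Frobenius Quot.quotient pq q≈0 using (^pʲ-homo-+)

    -- In characteristic `q` the elements fixed by the `E`-th power map form a subring, which is
    -- everything once it contains the generator θ.
    fixed⇒quotient-reduced : ∀ j → θ S.^ (q ℕ.^ suc j) S.≈ θ → ∀ y e → y S.^ e S.≈ 0# → y S.≈ 0#
    fixed⇒quotient-reduced j fix y e = fixed⇒reduced Quot.quotient {y} 2≤ (all-fixed y) e
      where
      E = q ℕ.^ suc j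
      2≤ : 2 ℕ.≤ E
      2≤ = ℕ.≤-trans (ℕ.nonTrivial⇒n>1 q) (ℕ.m≤m*n q (q ℕ.^ j) {{ℕ.m^n≢0 q j}})
      Fixed : Carrier → Set _
      Fixed y = y S.^ E S.≈ y
      fixed-+ : ∀ {x y} → Fixed x → Fixed y → Fixed (x + y)
      fixed-+ {x} {y} fx fy = S.trans {(x + y) S.^ E} {x S.^ E + y S.^ E} {x + y} (^pʲ-homo-+ (suc j) x y)
        (S.+-cong {x S.^ E} {x} {y S.^ E} {y} fx fy)
      fixed-* : ∀ {x y} → Fixed x → Fixed y → Fixed (x * y)
      fixed-* {x} {y} fx fy = S.trans {(x * y) S.^ E} {x S.^ E * y S.^ E} {x * y} (S.^-distrib-* x y E)
        (S.*-cong {x S.^ E} {x} {y S.^ E} {y} fx fy)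
      fixed-0 : Fixed 0#
      fixed-0 = S.0^n≈0 E {{ℕ.m^n≢0 q (suc j)}}
      fixed-resp : ∀ {x y} → x ≈ y → Fixed x → Fixed y
      fixed-resp {x} {y} e fx = S.trans {y S.^ E} {x S.^ E} {y} (S.^-congˡ E {y} {x} (Quot.≈⇒∼ (sym e)))
        (S.trans {x S.^ E} {x} {y} fx (Quot.≈⇒∼ e))
      fixed-neg : ∀ {x} → Fixed x → Fixed (- x)
      -- Additivity at `x + (- x) = 0` settles even and odd `q` alike, without evaluating
      -- `(- 1) ^ E`.
      fixed-neg {x} fx = S.+-cancelˡ x ((- x) S.^ E) (- x) (begin
        x + (- x) S.^ E          ≈⟨ S.+-congʳ {_} {x S.^ E} {x} fx ⟨
        x S.^ E + (- x) S.^ E    ≈⟨ ^pʲ-homo-+ (suc j) x (- x) ⟨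
        (x + - x) S.^ E          ≈⟨ S.^-congˡ E {x + - x} {0#} (S.-‿inverseʳ x) ⟩
        0# S.^ E                 ≈⟨ fixed-0 ⟩
        0#                       ≈⟨ S.-‿inverseʳ x ⟨
        x + - x                  ∎)
        where open import Relation.Binary.Reasoning.Setoid S.setoid
      all-fixed : ∀ y → Fixed y
      all-fixed = generated Fixed fixed-resp fixed-0 (S.1^n≈1 E) fix fixed-+ fixed-* fixed-neg

-- The prime p, the primes not dividing pN, and the prime 2

module _ (K : CommutativeRing c ℓ) (B : CommutativeRing c′ ℓ′)
  {ι : CommutativeRing.Carrier B → CommutativeRing.Carrier K}
  (ι-isHom : IsRingHomomorphism (CommutativeRing.rawRing B) (CommutativeRing.rawRing K) ι) where
  private
    module K = RingTheory K
  open RingTheory B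

  module _ (ι-injective : ∀ {x y} → ι x K.≈ ι y → x ≈ y) where
    open Saturation K B ι-isHom ι-injective

    module LocalIntegrality (dichotomy : ∀ x → ι x K.≈ K.0# ⊎ Invertible (ι x))
      (θ : Carrier) (generated : GeneratedBy B θ (c′ ⊔ ℓ′))
      {p : ℕ} (pp : Prime p) (m n d : ℕ) (g : Carrier)
      (cyclotomic≈0 : geom p ((1# + θ ^ (2 ℕ.^ n)) ^ (p ℕ.^ m)) ≈ 0#)
      (eisenstein≈0 : θ ^ suc d + p · 1# * (1# + θ * g) ≈ 0#)
      where

      private
        -- `m` and `n` are one less than the exponents of the theorem: `N` is the degree of the
        -- cyclotomic polynomial of index `2 ^ suc n`, and `M = p ^ suc m` kills the root of unity
        -- `ζ`.
        N M : ℕ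
        N = 2 ℕ.^ n
        M = p ℕ.^ m ℕ.* p

        instance _ = prime⇒nonZero pp
                 M≢0 = ℕ.m*n≢0 (p ℕ.^ m) p {{ℕ.m^n≢0 p m}}

        ζ : Carrier
        ζ = 1# + θ ^ N

        ζ^M≈1 : ζ ^ M ≈ 1#
        ζ^M≈1 = geom≈0⇒root-of-unity B p (p ℕ.^ m) cyclotomic≈0

        -- The Eisenstein equation without its constant term, divided by θ. It exhibits θ as a
        -- divisor of `p`, hence as a unit modulo every other prime.
        t : Carrier
        t = p · 1# * g + θ ^ d

        p+θt≈0 : p · 1# + θ * t ≈ 0#
        p+θt≈0 = trans (solve 4 (λ p θ g z → p :+ θ :* (p :* g :+ z) := θ :* z :+ p :* (con (+ 1) :+ θ :* g)) refl
          (p · 1#) θ g (θ ^ d)) eisenstein≈0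

        Saturated : ℕ → Set _
        Saturated q = Invertible (ι (q · 1#)) → ∀ β → Integralˡ β → ∀ g → ι (q · 1#) K.* β K.≈ ι g → InImage β

        saturated-at-p : Saturated p
        -- The Eisenstein equation reads `θ ^ suc d = p s` with `s = - (1 + θ g)`, which is `- 1`
        -- modulo θ and so has the inverse `- 1#` there.
        saturated-at-p p-inv = saturated (p · 1#) θ (- (1# + θ * g)) (- 1#) d
          (linear 1# eisenstein≈0 (solve 3 (λ z p e → z :+ con (+ 1) :* con (+ 0) := p :* (:- e) :+ con (+ 1) :* (z :+ p :* e))
            refl (θ ^ suc d) (p · 1#) (1# + θ * g)))
          (0# , g , solve 3 (λ p θ g → (:- (con (+ 1) :+ θ :* g)) :* (:- con (+ 1)) := con (+ 1) :+ (p :* con (+ 0) :+ θ :* g))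
            refl (p · 1#) θ g)
          (fixed⇒quotient-reduced 0 θ-fixed)
          p-inv (dichotomy θ)
          where
          open LocalRings B θ generated pp θ
          open import Relation.Binary.Reasoning.Setoid S.setoid
          θ∼0 : θ S.≈ 0#
          θ∼0 = Quotient.v∼0 B (p · 1#) θ
          E = p ℕ.^ 1
          θ-fixed : θ S.^ E S.≈ θ
          θ-fixed = begin
            θ S.^ E    ≈⟨ S.^-congˡ E {θ} {0#} θ∼0 ⟩
            0# S.^ E   ≈⟨ S.0^n≈0 E {{ℕ.m^n≢0 p 1}} ⟩
            0#         ≈⟨ θ∼0 ⟨
            θ          ∎

        module AwayFromP {q : ℕ} (pq : Prime q) (q≢p : q ≢ p) (π : Carrier) where
          open LocalRings B θ generated pq π public

          M-coprime : Coprime M q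
          M-coprime = prime∤⇒coprime pq λ q∣M →
            [ (λ d → q≢p (prime∣prime^ pq pp m d))
            , (λ d → q≢p (prime∣prime^ pq pp 1 (≡.subst (q ∣_) (≡.sym (ℕ.*-identityʳ p)) d))) ]
            (euclidsLemma (p ℕ.^ m) p pq q∣M)

          θ-inverse : ∃[ τ ] θ * τ S.≈ 1#
          θ-inverse = prime-inverse Quot′ {θ = θ} {t = t} pp pq q≢p q≈0 (begin
            p S.· 1# + θ * t    ≈⟨ S.+-congʳ {θ * t} {p · 1#} {p S.· 1#} (φ-· p 1#) ⟨
            p · 1# + θ * t      ≈⟨ φ-cong p+θt≈0 ⟩
            0#                  ∎)
            where
            Quot′ = Quotient.quotient B (q · 1#) π
            open import Relation.Binary.Reasoning.Setoid S.setoid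

        saturated-unramified : ∀ {q} → Prime q → q ≢ p → ¬ q ∣ N → Saturated q
        -- With `s = w = 1` and `k = 0` the descent consists of a single step.
        saturated-unramified {q} pq q≢p q∤N q-inv = saturated (q · 1#) (q · 1#) 1# 1# 0
          refl
          (φ-cong (*-identityʳ 1#))
          (fixed⇒quotient-reduced (proj₁ θ-fixed) (proj₂ θ-fixed))
          q-inv (inj₂ q-inv)
          where
          open AwayFromP pq q≢p (q · 1#)
          open import Relation.Binary.Reasoning.Setoid S.setoid
          θ-fixed : ∃[ j ] θ S.^ (q ℕ.^ suc j) S.≈ θ
          θ-fixed = unramified-fixed (Quotient.quotient B (q · 1#) (q · 1#)) pq q≈0 {θ} {proj₁ θ-inverse} {N} {M}
            M-coprime q∤N (proj₂ θ-inverse) (begin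
              (1# + θ S.^ N) S.^ M   ≈⟨ S.^-congˡ M {1# + θ ^ N} {1# + θ S.^ N} (S.+-congˡ {1#} {θ ^ N} {θ S.^ N} (φ-^ θ N)) ⟨
              ζ S.^ M                ≈⟨ φ-^ ζ M ⟨
              ζ ^ M                  ≈⟨ φ-cong ζ^M≈1 ⟩
              1#                     ∎)

      -- Write ζ = ξ ^ N, which is possible since ζ has odd order.  Then θ ^ N = ζ - 1 ≡ (ξ - 1) ^ N modulo 2,
      -- and π = θ - (ξ - 1) satisfies an equation that is Eisenstein above 2.
      module AtTwo (2≢p : 2 ≢ p) (n′ : ℕ) (n≡ : n ≡ suc n′) where
        N′ : ℕ
        N′ = 2 ℕ.^ n′

        two : Carrier
        two = 2 · 1#

        order : ∃₂ λ j k → 2 ℕ.^ suc j ≡ 1 ℕ.+ M ℕ.* k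
        order = power≡1 2 M (prime∤⇒coprime prime[2] λ 2∣M →
            [ (λ d → 2≢p (prime∣prime^ prime[2] pp m d))
            , (λ d → 2≢p (prime∣prime^ prime[2] pp 1 (≡.subst (2 ∣_) (≡.sym (ℕ.*-identityʳ p)) d))) ]
            (euclidsLemma (p ℕ.^ m) p prime[2] 2∣M))

        j = proj₁ order
        E = 2 ℕ.^ suc j

        ζ-fixed : ζ ^ E ≈ ζ
        ζ-fixed = trans (^-congʳ ζ (proj₂ (proj₂ order))) (^-1+* B ζ M (proj₁ (proj₂ order)) ζ^M≈1)

        -- Chosen so that `r * N = E ^ n`: the `E`-th power map fixes `ζ`, and `ζ ^ r` is therefore
        -- an `N`-th root of `ζ`.
        r : ℕ
        r = 2 ℕ.^ (j ℕ.* n)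

        ξ a : Carrier
        ξ = ζ ^ r
        a = ξ - 1#

        ξ-fixed : ξ ^ E ≈ ξ
        ξ-fixed = trans (^-swap ζ r E) (^-congˡ r ζ-fixed)

        rN≡ : r ℕ.* N ≡ E ℕ.^ n
        rN≡ = ≡.trans (≡.sym (ℕ.^-distribˡ-+-* 2 (j ℕ.* n) n))
          (≡.trans (≡.cong (2 ℕ.^_) (ℕ.+-comm (j ℕ.* n) n)) (≡.sym (ℕ.^-*-assoc 2 (suc j) n)))

        ξ^N≈ζ : ξ ^ N ≈ ζ
        ξ^N≈ζ = trans (^-assocʳ ζ r N) (trans (^-congʳ ζ rN≡) (^-fixed B ζ-fixed n))

        module _ (π : Carrier) (θ≈ : θ ≈ π + a) where
          -- The multiples of 4 left over in the expansions of `θ ^ N = (π + a) ^ N` and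
          -- `ξ ^ N = (a + 1) ^ N`.
          c₁ = proj₁ (^2ⁱ-mod4 B n′ π a)
          c₂ = proj₁ (^2ⁱ-mod4 B n′ a 1#)

          -- Half of what remains when `1 + θ ^ N = ξ ^ N` is expanded on both sides and solved for
          -- `π ^ N`. Modulo (2, π) only `a ^ N′` survives.
          s : Carrier
          s = a ^ N′ - π ^ N′ * a ^ N′ + two * (c₂ - c₁)

          π^N≈ : π ^ N ≈ two * s
          π^N≈ = subst-N (linear 1# both (solve 6 (λ πN aN πN′ aN′ c₁ c₂ →
               -- `t` is the `1# + 1#` of the expansions, while `t′` is the unfolding of
               -- `two = 2 · 1#`, which ends in `0#`.
               let o = con (+ 1); t = o :+ o; t′ = o :+ (o :+ con (+ 0)); u = πN :+ aN :+ t :* (πN′ :* aN′) :+ t :* (t :* c₁)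
                   v = aN :+ t :* aN′ :+ t :* (t :* c₂)
               in πN :+ o :* v := t′ :* (aN′ :- πN′ :* aN′ :+ t′ :* (c₂ :- c₁)) :+ o :* u)
               refl (π ^ (2 ℕ.^ suc n′)) (a ^ (2 ℕ.^ suc n′)) (π ^ N′) (a ^ N′) c₁ c₂))
            where
            open import Relation.Binary.Reasoning.Setoid setoid
            subst-N : π ^ (2 ℕ.^ suc n′) ≈ two * s → π ^ N ≈ two * s
            subst-N = ≡.subst (λ k → π ^ (2 ℕ.^ k) ≈ two * s) (≡.sym n≡)
            ξ≈ : ξ ≈ a + 1#
            ξ≈ = solve 1 (λ ξ → ξ := (ξ :- con (+ 1)) :+ con (+ 1)) refl ξ
            both : π ^ (2 ℕ.^ suc n′) + a ^ (2 ℕ.^ suc n′) + (1# + 1#) * (π ^ N′ * a ^ N′) + (1# + 1#) * ((1# + 1#) * c₁)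
                 ≈ a ^ (2 ℕ.^ suc n′) + (1# + 1#) * a ^ N′ + (1# + 1#) * ((1# + 1#) * c₂)
            both = +-cancelˡ 1# _ _ (begin
              1# + (π ^ (2 ℕ.^ suc n′) + a ^ (2 ℕ.^ suc n′) + (1# + 1#) * (π ^ N′ * a ^ N′) + (1# + 1#) * ((1# + 1#) * c₁))
                ≈⟨ +-congˡ (trans (^-congˡ (2 ℕ.^ suc n′) θ≈) (proj₂ (^2ⁱ-mod4 B n′ π a))) ⟨
              1# + θ ^ (2 ℕ.^ suc n′)
                ≡⟨ ≡.cong (λ k → 1# + θ ^ (2 ℕ.^ k)) n≡ ⟨
              ζ
                ≈⟨ ξ^N≈ζ ⟨
              ξ ^ N
                ≡⟨ ≡.cong (λ k → ξ ^ (2 ℕ.^ k)) n≡ ⟩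
              ξ ^ (2 ℕ.^ suc n′)
                ≈⟨ trans (^-congˡ (2 ℕ.^ suc n′) ξ≈) (proj₂ (^2ⁱ-mod4 B n′ a 1#)) ⟩
              a ^ (2 ℕ.^ suc n′) + 1# ^ (2 ℕ.^ suc n′) + (1# + 1#) * (a ^ N′ * 1# ^ N′) + (1# + 1#) * ((1# + 1#) * c₂)
                ≈⟨ +-congʳ (+-cong (+-congˡ (1^n≈1 (2 ℕ.^ suc n′))) (*-congˡ (trans (*-congˡ (1^n≈1 N′)) (*-identityʳ _)))) ⟩
              a ^ (2 ℕ.^ suc n′) + 1# + (1# + 1#) * a ^ N′ + (1# + 1#) * ((1# + 1#) * c₂)
                ≈⟨ solve 3 (λ x y z → x :+ con (+ 1) :+ y :+ z := con (+ 1) :+ (x :+ y :+ z)) refl _ _ _ ⟩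
              1# + (a ^ (2 ℕ.^ suc n′) + (1# + 1#) * a ^ N′ + (1# + 1#) * ((1# + 1#) * c₂)) ∎)

          open AwayFromP prime[2] 2≢p π
          private
            module Quot = Quotient B two π
            τ = proj₁ θ-inverse
          open import Relation.Binary.Reasoning.Setoid S.setoid

          π∼0 : π S.≈ 0#
          π∼0 = Quot.v∼0

          a∼θ : a S.≈ θ
          a∼θ = begin
            a        ≈⟨ S.+-identityˡ a ⟨
            0# + a   ≈⟨ S.+-congʳ {a} {π} {0#} π∼0 ⟨
            π + a    ≈⟨ φ-cong θ≈ ⟨
            θ        ∎

          s∼ : s S.≈ θ S.^ N′
          s∼ = begin
            a ^ N′ - π ^ N′ * a ^ N′ + two * (c₂ - c₁)
              ≈⟨ S.+-cong {a ^ N′ - π ^ N′ * a ^ N′} {a ^ N′ - 0# * a ^ N′} {two * (c₂ - c₁)} {0# * (c₂ - c₁)}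
                   (S.+-congˡ {a ^ N′} { - (π ^ N′ * a ^ N′)} { - (0# * a ^ N′)}
                     (S.-‿cong {π ^ N′ * a ^ N′} {0# * a ^ N′} (S.*-congʳ {a ^ N′} {π ^ N′} {0#} π^N′∼0)))
                   (S.*-congʳ {c₂ - c₁} {two} {0#} Quot.u∼0) ⟩
            a ^ N′ - 0# * a ^ N′ + 0# * (c₂ - c₁)
              ≈⟨ φ-cong (solve 2 (λ x y → x :- con (+ 0) :* x :+ con (+ 0) :* y := x) refl (a ^ N′) (c₂ - c₁)) ⟩
            a ^ N′
              ≈⟨ φ-^ a N′ ⟩
            a S.^ N′
              ≈⟨ S.^-congˡ N′ {a} {θ} a∼θ ⟩
            θ S.^ N′ ∎
            where
            π^N′∼0 : π ^ N′ S.≈ 0#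
            π^N′∼0 = begin
              π ^ N′      ≈⟨ φ-^ π N′ ⟩
              π S.^ N′    ≈⟨ S.^-congˡ N′ {π} {0#} π∼0 ⟩
              0# S.^ N′   ≈⟨ S.0^n≈0 N′ {{ℕ.m^n≢0 2 n′}} ⟩
              0#          ∎

          s-unit : s * τ S.^ N′ S.≈ 1#
          s-unit = begin
            s * τ S.^ N′           ≈⟨ S.*-congʳ {τ S.^ N′} {s} {θ S.^ N′} s∼ ⟩
            θ S.^ N′ * τ S.^ N′    ≈⟨ S.^-distrib-* θ τ N′ ⟨
            (θ * τ) S.^ N′         ≈⟨ S.^-congˡ N′ {θ * τ} {1#} (proj₂ θ-inverse) ⟩
            1# S.^ N′              ≈⟨ S.1^n≈1 N′ ⟩
            1#                     ∎

          -- Modulo (2, π), θ equals `ξ - 1`, and ξ is a power of `ζ`. The exponent that fixes `ζ`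
          -- thus serves θ as well, although `N` is even.
          θ-fixed : θ S.^ E S.≈ θ
          θ-fixed = 1+-fixed (Quotient.quotient B two π) prime[2] q≈0 {θ} {ξ} j
            (begin
              ξ        ≈⟨ φ-cong (solve 1 (λ ξ → ξ := con (+ 1) :+ (ξ :- con (+ 1))) refl ξ) ⟩
              1# + a   ≈⟨ S.+-congˡ {1#} {a} {θ} a∼θ ⟩
              1# + θ   ∎)
            (begin
              ξ S.^ E  ≈⟨ φ-^ ξ E ⟨
              ξ ^ E    ≈⟨ φ-cong ξ-fixed ⟩
              ξ        ∎)

          saturated-at-2′ : Saturated 2
          saturated-at-2′ 2-inv = go N (ℕ.>-nonZero⁻¹ N {{ℕ.m^n≢0 2 n}}) π^N≈
            where
            -- Exposes the positive exponent `N` as the `suc k` that the descent works with.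
            go : ∀ k → 0 ℕ.< k → π ^ k ≈ two * s → ∀ β → Integralˡ β → ∀ g → ι two K.* β K.≈ ι g → InImage β
            go (suc k) _ e = saturated two π s (τ S.^ N′) k e s-unit (fixed⇒quotient-reduced j θ-fixed) 2-inv (dichotomy π)

        saturated-at-2 : Saturated 2
        saturated-at-2 = saturated-at-2′ (θ - a) (solve 2 (λ θ a → θ := (θ :- a) :+ a) refl θ a)

      saturated-at-prime : ∀ {q} → Prime q → Invertible (ι (q · 1#)) →
        ∀ β → Integralˡ β → ∀ g → ι (q · 1#) K.* β K.≈ ι g → InImage β
      saturated-at-prime {q} pq = go (q ℕ.≟ p) (q ∣? N) n ≡.refl
        where
        -- `n` is a module parameter, so its cases are taken on a copy `n′`. For `n′ = 0` one has
        -- `N = 1`, which no prime divides.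
        go : Dec (q ≡ p) → Dec (q ∣ N) → ∀ n′ → n ≡ n′ → Saturated q
        go (yes ≡.refl) _         _        _    = saturated-at-p
        go (no q≢p)     (no q∤N)  _        _    = saturated-unramified pq q≢p q∤N
        go (no q≢p)     (yes q∣N) zero     n≡   = contradiction (≡.subst (λ k → q ∣ 2 ℕ.^ k) n≡ q∣N) (prime∤1 pq)
        go (no q≢p)     (yes q∣N) (suc n′) n≡   = at-2 (prime∣prime^ pq prime[2] n q∣N)
          where
          at-2 : q ≡ 2 → Saturated q
          at-2 ≡.refl = AtTwo.saturated-at-2 q≢p n′ n≡

-- Polynomials over a discrete field

module _ (F : CommutativeRing c ℓ) where
  private
    module F = RingTheory F

  module FieldPolynomials
    (inverse? : ∀ x → x F.≈ F.0# ⊎ ∃[ y ] y F.* x F.≈ F.1#)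
    (1≉0 : ¬ F.1# F.≈ F.0#) where

    open PolynomialRing F public
    module P = RingTheory polynomialRing
    open P using (_+_; _*_; -_; _-_; 0#; 1#; solve; _:=_; _:+_; _:*_; :-_; _:-_; con; linear)

    Nonzero : F.Carrier → Set (c ⊔ ℓ)
    Nonzero x = ∃[ y ] y F.* x F.≈ F.1#

    nonzero≉0 : ∀ {x} → Nonzero x → ¬ x F.≈ F.0#
    nonzero≉0 (y , e) x≈0 = 1≉0 (F.trans (F.sym e) (F.trans (F.*-congˡ x≈0) (F.zeroʳ y)))

    nonzero-* : ∀ {x y} → Nonzero x → Nonzero y → Nonzero (x F.* y)
    nonzero-* {x} {y} (x′ , e) (y′ , e′) = x′ F.* y′ , F.trans
      (F.solve 4 (λ a b c d → (a F.:* b) F.:* (c F.:* d) F.:= (a F.:* c) F.:* (b F.:* d)) F.refl x′ y′ x y)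
      (F.trans (F.*-cong e e′) (F.*-identityʳ F.1#))

    HasDegree : ℕ → Poly → Set (c ⊔ ℓ)
    HasDegree e f = Nonzero (coeff f e) × Below f (suc e)

    degree? : ∀ f → f ≃ [] ⊎ ∃[ e ] HasDegree e f
    degree? []      = inj₁ (coeffs λ i → F.refl)
    degree? (x ∷ f) with degree? f | inverse? x
    ... | inj₂ (e , nz , f<)  | _        = inj₂ (suc e , nz , λ { (suc i) (s≤s le) → f< i le })
    ... | inj₁ (coeffs f≈[])  | inj₁ x≈0 = inj₁ (coeffs λ { zero → x≈0 ; (suc i) → f≈[] i })
    ... | inj₁ (coeffs f≈[])  | inj₂ nz  = inj₂ (0 , nz , λ { (suc i) _ → f≈[] i })

    degree-* : ∀ f g {a b} → HasDegree a f → HasDegree b g → HasDegree (a ℕ.+ b) (f * g)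
    degree-* f g {a} {b} (fa , f<) (gb , g<) =
      let top , below = mul-top f g a b f< g<
          y , e       = nonzero-* fa gb
      in (y , F.trans (F.*-congˡ top) e) , below

    degree-≤ : ∀ f {e n} → HasDegree e f → Below f n → e ℕ.< n
    degree-≤ f {e} {n} (nz , _) f< with e ℕ.<? n
    ... | yes e<n = e<n
    ... | no  e≮n = contradiction (f< e (ℕ.≮⇒≥ e≮n)) (nonzero≉0 nz)

    degree-≥ : ∀ f {e i} → HasDegree e f → Nonzero (coeff f i) → i ℕ.≤ e
    degree-≥ f {e} {i} (_ , f<) nz with i ℕ.≤? e
    ... | yes i≤e = i≤e
    ... | no  i≰e = contradiction (f< i (ℕ.≰⇒> i≰e)) (nonzero≉0 nz)

    monic-degree : ∀ f {d} → MonicOfDegree d f → HasDegree d f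
    monic-degree f (fd≈1 , f<) = (F.1# , F.trans (F.*-identityˡ _) fd≈1) , f<

    infix 4 _∣ₚ_
    _∣ₚ_ : Poly → Poly → Set (c ⊔ ℓ)
    f ∣ₚ g = ∃[ q ] (q * f) ≃ g

    degree-0⇒unit : ∀ f → HasDegree 0 f → f ∣ₚ 1#
    degree-0⇒unit f ((y , e) , f<) = (y ∷ []) , P.trans (const-*ₚ y f) (coeffs λ
      { zero    → F.trans (coeff-scale y f 0) e
      ; (suc i) → F.trans (coeff-scale y f (suc i)) (F.trans (F.*-congˡ (f< (suc i) (s≤s z≤n))) (F.zeroʳ y)) })

    unit⇒degree-0 : ∀ f {e} → HasDegree e f → f ∣ₚ 1# → e ≡ 0
    unit⇒degree-0 f {e} deg (u , uf≈1) with degree? u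
    ... | inj₁ u≈[]        = contradiction (coeff-≈ (P.trans (P.sym uf≈1) (P.trans (P.*-congʳ u≈[]) (P.zeroˡ f))) 0) 1≉0
    ... | inj₂ (a , deg-u) = ℕ.m+n≡0⇒n≡0 a (ℕ.n<1⇒n≡0
      (degree-≤ (u * f) (degree-* u f deg-u deg) (below-resp {1#} {u * f} {1} (P.sym uf≈1) λ { (suc i) _ → F.refl })))

    small-multiple : ∀ {T d f} u → MonicOfDegree d T → (u * T) ≃ f → Below f d → f ≃ []
    small-multiple {T} {d} {f} u T-monic uT≈f f< with degree? u
    ... | inj₁ u≈[]        = P.trans (P.sym uT≈f) (P.trans (P.*-congʳ u≈[]) (P.zeroˡ T))
    ... | inj₂ (a , deg-u) = contradiction (ℕ.m≤n+m d a) (ℕ.<⇒≱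
      (degree-≤ (u * T) (degree-* u T deg-u (monic-degree T T-monic)) (below-resp {f} {u * T} {d} (P.sym uT≈f) f<)))

    monic≄[] : ∀ f {d} → MonicOfDegree d f → ¬ f ≃ []
    monic≄[] f {d} (fd≈1 , _) (coeffs e) = 1≉0 (F.trans (F.sym fd≈1) (e d))

    degree-unique : ∀ f {a b} → HasDegree a f → HasDegree b f → a ≡ b
    degree-unique f da@(na , _) db@(nb , _) =
      ℕ.≤-antisym (degree-≥ f db na) (degree-≥ f da nb)

    -- A unit has degree 0, and comparing leading coefficients forces the constant to be 1.
    monic-associates : ∀ {a b f g} y → MonicOfDegree a f → MonicOfDegree b g → f ≃ (g * y) → y ∣ₚ 1# → f ≃ g
    monic-associates {a} {b} {f} {g} y f-monic g-monic f≈gy y∣1 with degree? y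
    ... | inj₁ y≈[] = contradiction (P.trans f≈gy (P.trans (P.*-congˡ {g} y≈[]) (P.zeroʳ g))) (monic≄[] f f-monic)
    ... | inj₂ (e , deg-y) with unit⇒degree-0 y deg-y y∣1
    ...   | ≡.refl = P.trans f≈gy (P.trans (P.*-congˡ {g} y≈1) (P.*-identityʳ g))
      where
      top = mul-top g y b 0 (proj₂ g-monic) (proj₂ deg-y)
      a≡b : a ≡ b
      a≡b = ≡.trans (degree-unique f (monic-degree f f-monic)
        (let (z , e) , below = degree-* g y (monic-degree g g-monic) deg-y
         in (z , F.trans (F.*-congˡ (coeff-≈ f≈gy (b ℕ.+ 0))) e) , below-resp {g * y} {f} (P.sym f≈gy) below)) (ℕ.+-identityʳ b)
      y₀≈1 : coeff y 0 F.≈ F.1#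
      y₀≈1 = begin
        coeff y 0                   ≈⟨ F.*-identityˡ _ ⟨
        F.1# F.* coeff y 0          ≈⟨ F.*-congʳ (proj₁ g-monic) ⟨
        coeff g b F.* coeff y 0     ≈⟨ proj₁ top ⟨
        coeff (g * y) (b ℕ.+ 0)     ≈⟨ coeff-≈ f≈gy (b ℕ.+ 0) ⟨
        coeff f (b ℕ.+ 0)           ≡⟨ ≡.cong (coeff f) (≡.trans (ℕ.+-identityʳ b) (≡.sym a≡b)) ⟩
        coeff f a                   ≈⟨ proj₁ f-monic ⟩
        F.1#                        ∎
        where open import Relation.Binary.Reasoning.Setoid F.setoid
      y≈1 : y ≃ 1#
      y≈1 = coeffs λ { zero → y₀≈1 ; (suc i) → proj₂ deg-y (suc i) (s≤s z≤n) }

    module _ {T : Poly} {d : ℕ} (T-monic : MonicOfDegree d T) where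

      -- Degrees add up to `d`, so a factor with a nonzero coefficient at `d` or above leaves degree
      -- 0 for the other. The premise is what Eisenstein's argument produces.
      full-degree⇒unit : ∀ x y → T ≃ (x * y) → ∃[ i ] (d ℕ.≤ i × Nonzero (coeff x i)) → y ∣ₚ 1#
      full-degree⇒unit x y T≈xy (i , d≤i , nz) with degree? x | degree? y
      ... | inj₁ x≈[]       | _               = contradiction (coeff-≈ x≈[] i) (nonzero≉0 nz)
      ... | inj₂ (a , dx)   | inj₁ y≈[]       =
        contradiction (P.trans T≈xy (P.trans (P.*-congˡ {x} y≈[]) (P.zeroʳ x))) (monic≄[] T T-monic)
      ... | inj₂ (a , dx)   | inj₂ (zero , dy)  = degree-0⇒unit y dy
      ... | inj₂ (a , dx)   | inj₂ (suc e , dy) = contradiction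
        (ℕ.≤-trans d≤i (degree-≥ x dx nz)) (ℕ.<⇒≱ a<d)
        where
        a<d : a ℕ.< d
        a<d = ℕ.≤-trans (ℕ.≤-trans (ℕ.≤-reflexive (ℕ.+-comm 1 a)) (ℕ.+-monoʳ-≤ a (s≤s z≤n)))
          (ℕ.s≤s⁻¹ (degree-≤ (x * y) (degree-* x y dx dy) (below-resp {T} {x * y} T≈xy (proj₂ T-monic))))

      module _ (split : ∀ x y → T ≃ (x * y) → x ∣ₚ 1# ⊎ y ∣ₚ 1#) where

        Coprime-T : Poly → Set _
        Coprime-T h = ∃₂ λ u v → (u * h + v * T) ≃ 1#

        -- Instead of Euclid's algorithm: replace h by the remainder of T modulo h.
        small⇒coprime : ∀ e → e ℕ.< d → ∀ h → HasDegree e h → Coprime-T h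
        small⇒coprime = <-rec _ go
          where
          go : ∀ e → (∀ {e′} → e′ ℕ.< e → e′ ℕ.< d → ∀ h → HasDegree e′ h → Coprime-T h) →
               e ℕ.< d → ∀ h → HasDegree e h → Coprime-T h
          go e rec e<d h deg@((c , ch≈1) , h<) = conclude (degree? r)
            where
            -- Normalises the leading coefficient, since `divMod` divides by monic polynomials.
            k = c ∷ []
            h₀ = k * h
            h₀-coeff : ∀ i → coeff h₀ i F.≈ c F.* coeff h i
            h₀-coeff i = F.trans (coeff-≈ (const-*ₚ c h) i) (coeff-scale c h i)
            h₀-monic : MonicOfDegree e h₀
            h₀-monic = F.trans (h₀-coeff e) ch≈1 ,
              λ i le → F.trans (h₀-coeff i) (F.trans (F.*-congˡ (h< i le)) (F.zeroʳ c))
            division = divMod h₀-monic T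
            w = proj₁ division
            r = proj₁ (proj₂ division)
            T≈ : T ≃ (w * h₀ + r)
            T≈ = proj₁ (proj₂ (proj₂ division))
            r< : Below r e
            r< = proj₂ (proj₂ (proj₂ division))
            conclude : r ≃ [] ⊎ ∃[ e′ ] HasDegree e′ r → Coprime-T h
            -- Now `T = w h₀`. Were `w` a unit, the nonzero `h₀`, of degree below `d`, would be a
            -- multiple of `T`; so `h₀` is the unit.
            conclude (inj₁ r≈[]) = [ w-unit , h₀-unit ] (split w h₀ T≈wh₀)
              where
              T≈wh₀ : T ≃ (w * h₀)
              T≈wh₀ = P.trans T≈ (P.trans (P.+-congˡ {w * h₀} r≈[]) (P.+-identityʳ _))
              h₀-unit : h₀ ∣ₚ 1# → Coprime-T h
              h₀-unit (u , e) = u * k , 0# ,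
                P.trans (solve 4 (λ u k h t → u :* k :* h :+ con (+ 0) :* t := u :* (k :* h)) P.refl u k h T) e
              w-unit : w ∣ₚ 1# → Coprime-T h
              w-unit (u , e) = contradiction (small-multiple {T} {d} u T-monic
                (P.trans (P.*-congˡ {u} T≈wh₀) (P.trans (P.sym (P.*-assoc u w h₀)) (P.trans (P.*-congʳ e) (P.*-identityˡ h₀))))
                (λ i d≤i → proj₂ h₀-monic i (ℕ.≤-trans e<d d≤i))) (monic≄[] h₀ h₀-monic)
            conclude (inj₂ (e′ , deg-r)) =
              let e′<e      = degree-≤ r deg-r r<
                  u , v , b = rec e′<e (ℕ.<-trans e′<e e<d) r deg-r
              in - (u * w * k) , u + v , P.trans (linear u T≈
                   (solve 7 (λ u w k h v t r → :- (u :* w :* k) :* h :+ (u :+ v) :* t :+ u :* (w :* (k :* h) :+ r)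
                     := u :* r :+ v :* t :+ u :* t) P.refl u w k h v T r)) b

        -- Evaluated at a root θ of `T`, the two alternatives say that `h(θ)` is zero or that it is
        -- invertible, which decides the matter without an equality test in the extension.
        bezout : ∀ h → T ∣ₚ h ⊎ Coprime-T h
        bezout h = conclude (degree? r)
          where
          division = divMod T-monic h
          w = proj₁ division
          r = proj₁ (proj₂ division)
          h≈ : h ≃ (w * T + r)
          h≈ = proj₁ (proj₂ (proj₂ division))
          conclude : r ≃ [] ⊎ ∃[ e′ ] HasDegree e′ r → T ∣ₚ h ⊎ Coprime-T h
          conclude (inj₁ r≈[]) = inj₁ (w , P.sym (P.trans h≈ (P.trans (P.+-congˡ {w * T} r≈[]) (P.+-identityʳ _))))
          conclude (inj₂ (e , deg-r)) =
            let u , v , b = small⇒coprime e (degree-≤ r deg-r (proj₂ (proj₂ (proj₂ division)))) r deg-r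
            in inj₂ (u , v - u * w , P.trans (linear u h≈
                 (solve 6 (λ u h v w t r → u :* h :+ (v :- u :* w) :* t :+ u :* (w :* t :+ r)
                   := u :* r :+ v :* t :+ u :* h) P.refl u h v w T r)) b)

-- Eisenstein's criterion

ℤ-ring = ℤ.+-*-commutativeRing
ℚ-ring = ℚ.+-*-commutativeRing

module ℤₚ = PolynomialRing ℤ-ring
module ℤₚ-ring = RingTheory ℤₚ.polynomialRing
module ℤᵣ = RingTheory ℤ-ring

module ModPrime {p : ℕ} (pp : Prime p) where
  open ℤₚ using (coeff; mul; _≃_; coeffs; coeff-≈; coeff-mul-∷)

  private
    instance _ = prime⇒nonZero pp

  infix 4 p∣_
  p∣_ : ℤ → Set
  p∣ a = + p ℤ∣.∣ a

  p∣-* : ∀ a b → p∣ a ℤ.* b → p∣ a ⊎ p∣ b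
  p∣-* a b d with euclidsLemma ℤ.∣ a ∣ ℤ.∣ b ∣ pp (≡.subst (p ℕ∣.∣_) (ℤ.abs-* a b) (ℤ∣.∣⇒∣ᵤ d))
  ... | inj₁ d′ = inj₁ (ℤ∣.∣ᵤ⇒∣ d′)
  ... | inj₂ d′ = inj₂ (ℤ∣.∣ᵤ⇒∣ d′)

  p∣0 : p∣ 0ℤ
  p∣0 = ℤ∣.divides 0ℤ ≡.refl

  PrefixDivisible : ℤ[X] → ℕ → Set
  PrefixDivisible f n = ∀ k → k ℕ.< n → p∣ coeff f k

  shift-divisible : ∀ f n → PrefixDivisible f n → PrefixDivisible (0ℤ ∷ f) (suc n)
  shift-divisible f n pre zero    _         = p∣0
  shift-divisible f n pre (suc k) (s≤s k<n) = pre k k<n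

  mul-divisible : ∀ f g n → PrefixDivisible g n → PrefixDivisible (mul f g) n
  mul-divisible []      g n pre k k<n = p∣0
  mul-divisible (x ∷ f) g n pre k k<n = ≡.subst p∣_ (≡.sym (coeff-mul-∷ x f g k))
    (ℤ∣.∣m∣n⇒∣m+n (ℤ∣.∣n⇒∣m*n x (pre k k<n))
      (shift-divisible (mul f g) n (mul-divisible f g n pre) k (ℕ.m≤n⇒m≤1+n k<n)))

  -- Every other product contributing to the coefficient at `i + j` contains a coefficient of `f`
  -- below `i` or one of `g` below `j`.
  mul-lowest : ∀ f g i j → PrefixDivisible f i → PrefixDivisible g j →
               ∃[ e ] coeff (mul f g) (i ℕ.+ j) ≡ coeff f i ℤ.* coeff g j ℤ.+ e × p∣ e
  mul-lowest []      g i       j       _ pre = 0ℤ , ≡.refl , p∣0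
  mul-lowest (x ∷ f) g zero    j       _ pre = _ , coeff-mul-∷ x f g j ,
    shift-divisible (mul f g) j (mul-divisible f g j pre) j (ℕ.n<1+n j)
  mul-lowest (x ∷ f) g (suc i) j pre-f pre with mul-lowest f g i j (λ k k<i → pre-f (suc k) (s≤s k<i)) pre
  ... | e , eq , p∣e = x ℤ.* coeff g (suc i ℕ.+ j) ℤ.+ e ,
    ≡.trans (coeff-mul-∷ x f g (suc i ℕ.+ j)) (≡.trans (≡.cong (λ z → x ℤ.* coeff g (suc i ℕ.+ j) ℤ.+ z) eq)
      (ℤᵣ.solve 3 (λ a b e → a ℤᵣ.:+ (b ℤᵣ.:+ e) ℤᵣ.:= b ℤᵣ.:+ (a ℤᵣ.:+ e)) ≡.refl (x ℤ.* coeff g (suc i ℕ.+ j)) (coeff f i ℤ.* coeff g j) e)) ,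
    ℤ∣.∣m∣n⇒∣m+n (ℤ∣.∣m⇒∣m*n (coeff g (suc i ℕ.+ j)) (pre-f 0 (s≤s z≤n))) p∣e

  first-indivisible : ∀ f → (∀ k → p∣ coeff f k) ⊎ ∃[ i ] (¬ p∣ coeff f i × PrefixDivisible f i)
  first-indivisible []      = inj₁ λ _ → p∣0
  first-indivisible (x ∷ f) with + p ℤ∣.∣? x | first-indivisible f
  ... | no p∤x  | _                     = inj₂ (0 , p∤x , λ _ ())
  ... | yes p∣x | inj₁ all              = inj₁ λ { zero → p∣x ; (suc k) → all k }
  ... | yes p∣x | inj₂ (i , p∤fi , pre) = inj₂ (suc i , p∤fi , λ { zero _ → p∣x ; (suc k) (s≤s k<i) → pre k k<i })

  divide : ∀ f → (∀ k → p∣ coeff f k) → ∃[ f′ ] f ≃ map (+ p ℤ.*_) f′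
  divide []      all = [] , coeffs λ _ → ≡.refl
  divide (x ∷ f) all with all 0 | divide f (all ∘ suc)
  ... | ℤ∣.divides q eq | f′ , e = q ∷ f′ , coeffs λ { zero → ≡.trans eq (ℤ.*-comm q (+ p)) ; (suc k) → coeff-≈ e k }

  module _ {T : ℤ[X]} {d : ℕ} (T-monic : coeff T d ≡ 1ℤ) (T-low : ∀ k → k ≢ d → p∣ coeff T k)
           (T₀≡p : coeff T 0 ≡ + p) where

    FullDegree : ℤ[X] → Set
    FullDegree f = ∃[ i ] (d ℕ.≤ i × coeff f i ≢ 0ℤ)

    -- Takes the place of Gauss's lemma: `c` is the common denominator of a factorisation over ℚ. If
    -- `p` divides all of `x` or all of `y`, it is cancelled against `c`, which becomes smaller; the
    -- other primes in `c` do not disturb the argument at `p`.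
    eisenstein : ∀ c → NonZero c → ∀ x y → (∀ i → + c ℤ.* coeff T i ≡ coeff (mul x y) i) → FullDegree x ⊎ FullDegree y
    eisenstein = <-rec _ go
      where
      go : ∀ c → (∀ {c₁} → c₁ ℕ.< c → NonZero c₁ → ∀ x y → (∀ i → + c₁ ℤ.* coeff T i ≡ coeff (mul x y) i) →
                   FullDegree x ⊎ FullDegree y) →
           NonZero c → ∀ x y → (∀ i → + c ℤ.* coeff T i ≡ coeff (mul x y) i) → FullDegree x ⊎ FullDegree y
      go c rec c≢0 x y cT≡xy = split (first-indivisible x) (first-indivisible y)
        where
        at-d : + c ≡ coeff (mul x y) d
        at-d = ≡.trans (≡.sym (≡.trans (≡.cong (+ c ℤ.*_) T-monic) (ℤ.*-identityʳ (+ c)))) (cT≡xy d)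

        descend : ∀ x′ y′ → mul x y ≃ map (+ p ℤ.*_) (mul x′ y′) → FullDegree x′ ⊎ FullDegree y′
        descend x′ y′ e = rec c₁<c c₁≢0 x′ y′ λ i → ℤ.*-cancelˡ-≡ (+ p) _ _ (begin
          + p ℤ.* (+ c₁ ℤ.* coeff T i)       ≡⟨ ℤ.*-assoc (+ p) (+ c₁) (coeff T i) ⟨
          + p ℤ.* + c₁ ℤ.* coeff T i         ≡⟨ ≡.cong (ℤ._* coeff T i) (ℤ.pos-* p c₁) ⟨
          + (p ℕ.* c₁) ℤ.* coeff T i         ≡⟨ ≡.cong (λ c → + c ℤ.* coeff T i) c≡ ⟨
          + c ℤ.* coeff T i                  ≡⟨ cT≡xy i ⟩
          coeff (mul x y) i                  ≡⟨ scaled i ⟩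
          + p ℤ.* coeff (mul x′ y′) i        ∎)
          where
          open ≡.≡-Reasoning
          scaled : ∀ i → coeff (mul x y) i ≡ + p ℤ.* coeff (mul x′ y′) i
          scaled i = ≡.trans (coeff-≈ e i) (ℤₚ.coeff-scale (+ p) (mul x′ y′) i)
          p∣c : p ℕ∣.∣ c
          p∣c = ℤ∣.∣⇒∣ᵤ (≡.subst p∣_ (≡.sym (≡.trans at-d (scaled d))) (ℤ∣.∣m⇒∣m*n _ ℤ∣.∣-refl))
          c₁ = ℕ∣.quotient p∣c
          c≡ : c ≡ p ℕ.* c₁
          c≡ = ℕ∣.m∣n⇒n≡m*quotient p∣c
          instance
            c-nonZero = c≢0
            p-nonTrivial = prime⇒nonTrivial pp
          c₁≢0 : NonZero c₁
          c₁≢0 = ℕ∣.quotient≢0 p∣c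
          c₁<c : c₁ ℕ.< c
          c₁<c = ℕ∣.quotient-< p∣c

        full-resp : ∀ f f′ → f ≃ map (+ p ℤ.*_) f′ → FullDegree f′ → FullDegree f
        full-resp f f′ e (i , d≤i , nz) = i , d≤i , λ fi≡0 → nz (ℤ.*-cancelˡ-≡ (+ p) _ _
          (≡.trans (≡.sym (≡.trans (coeff-≈ e i) (ℤₚ.coeff-scale (+ p) f′ i))) (≡.trans fi≡0 (≡.sym (ℤ.*-zeroʳ (+ p))))))

        nonzero : ∀ f i → ¬ p∣ coeff f i → coeff f i ≢ 0ℤ
        nonzero f i p∤ eq = p∤ (≡.subst p∣_ (≡.sym eq) p∣0)

        split : (∀ k → p∣ coeff x k) ⊎ ∃[ i ] (¬ p∣ coeff x i × PrefixDivisible x i) →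
                (∀ k → p∣ coeff y k) ⊎ ∃[ i ] (¬ p∣ coeff y i × PrefixDivisible y i) → FullDegree x ⊎ FullDegree y
        split (inj₁ all) _ =
          let x′ , e = divide x all
          in [ inj₁ ∘ full-resp x x′ e , inj₂ ] (descend x′ y (begin
            mul x y                               ≈⟨ ℤₚ-ring.*-congʳ {y} e ⟩
            mul (map (+ p ℤ.*_) x′) y             ≈⟨ ℤₚ-ring.*-congʳ {y} (ℤₚ.const-*ₚ (+ p) x′) ⟨
            mul (mul (+ p ∷ []) x′) y             ≈⟨ ℤₚ-ring.*-assoc (+ p ∷ []) x′ y ⟩
            mul (+ p ∷ []) (mul x′ y)             ≈⟨ ℤₚ.const-*ₚ (+ p) (mul x′ y) ⟩
            map (+ p ℤ.*_) (mul x′ y)             ∎))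
          where open import Relation.Binary.Reasoning.Setoid ℤₚ-ring.setoid
        split (inj₂ _) (inj₁ all) =
          let y′ , e = divide y all
          in [ inj₁ , inj₂ ∘ full-resp y y′ e ] (descend x y′ (begin
            mul x y                               ≈⟨ ℤₚ-ring.*-congˡ {x} e ⟩
            mul x (map (+ p ℤ.*_) y′)             ≈⟨ ℤₚ-ring.*-congˡ {x} (ℤₚ.const-*ₚ (+ p) y′) ⟨
            mul x (mul (+ p ∷ []) y′)             ≈⟨ ℤₚ-ring.*-comm x (mul (+ p ∷ []) y′) ⟩
            mul (mul (+ p ∷ []) y′) x             ≈⟨ ℤₚ-ring.*-assoc (+ p ∷ []) y′ x ⟩
            mul (+ p ∷ []) (mul y′ x)             ≈⟨ ℤₚ-ring.*-congˡ { + p ∷ []} (ℤₚ-ring.*-comm y′ x) ⟩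
            mul (+ p ∷ []) (mul x y′)             ≈⟨ ℤₚ.const-*ₚ (+ p) (mul x y′) ⟩
            map (+ p ℤ.*_) (mul x y′)             ∎))
          where open import Relation.Binary.Reasoning.Setoid ℤₚ-ring.setoid
        -- The lowest coefficients prime to `p` multiply to one of `c T` prime to `p`, and `T` has
        -- such a coefficient only at `d`.
        split (inj₂ (i , p∤xi , pre-x)) (inj₂ (j , p∤yj , pre-y)) = corner i j p∤xi p∤yj pre-x pre-y i+j≡d
          where
          p∤lowest : ¬ p∣ coeff (mul x y) (i ℕ.+ j)
          p∤lowest p∣low =
            let e , eq , p∣e = mul-lowest x y i j pre-x pre-y
            in [ p∤xi , p∤yj ] (p∣-* (coeff x i) (coeff y j) (ℤ∣.∣m+n∣n⇒∣m (≡.subst p∣_ eq p∣low) p∣e))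
          p∤cT : ¬ p∣ + c ℤ.* coeff T (i ℕ.+ j)
          p∤cT d = p∤lowest (≡.subst p∣_ (cT≡xy (i ℕ.+ j)) d)
          i+j≡d : i ℕ.+ j ≡ d
          i+j≡d with i ℕ.+ j ℕ.≟ d
          ... | yes eq  = eq
          ... | no  neq = contradiction (ℤ∣.∣n⇒∣m*n (+ c) (T-low (i ℕ.+ j) neq)) p∤cT
          corner : ∀ i j → ¬ p∣ coeff x i → ¬ p∣ coeff y j → PrefixDivisible x i → PrefixDivisible y j →
                   i ℕ.+ j ≡ d → FullDegree x ⊎ FullDegree y
          corner zero    j       _    p∤yj _ _ eq = inj₂ (j , ℕ.≤-reflexive (≡.sym eq) , nonzero y j p∤yj)
          corner (suc i) zero    p∤xi _    _ _ eq =
            inj₁ (suc i , ℕ.≤-reflexive (≡.trans (≡.sym eq) (ℕ.+-identityʳ _)) , nonzero x (suc i) p∤xi)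
          -- Both constant terms are divisible by `p`, so `p * p` divides `c T₀ = c p` and `p`
          -- divides `c`, hence every coefficient of `c T`.
          corner (suc i) (suc j) _ _ pre-x pre-y _ =
            contradiction (ℤ∣.∣m⇒∣m*n (coeff T _) p∣c) p∤cT
            where
            coeff₀-mul : ∀ x y → coeff (mul x y) 0 ≡ coeff x 0 ℤ.* coeff y 0
            coeff₀-mul []      y = ≡.refl
            coeff₀-mul (x ∷ f) y = ≡.trans (coeff-mul-∷ x f y 0) (ℤ.+-identityʳ _)
            pp∣ : + p ℤ.* + p ℤ∣.∣ + p ℤ.* + c
            pp∣ = ≡.subst (+ p ℤ.* + p ℤ∣.∣_)
              (≡.trans (≡.sym (coeff₀-mul x y)) (≡.trans (≡.sym (cT≡xy 0)) (≡.trans (≡.cong (+ c ℤ.*_) T₀≡p) (ℤ.*-comm (+ c) (+ p)))))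
              (p²∣ (pre-x 0 (s≤s z≤n)) (pre-y 0 (s≤s z≤n)))
              where
              p²∣ : ∀ {a b} → p∣ a → p∣ b → + p ℤ.* + p ℤ∣.∣ a ℤ.* b
              p²∣ (ℤ∣.divides q ≡.refl) (ℤ∣.divides r ≡.refl) = ℤ∣.divides (q ℤ.* r)
                (ℤᵣ.solve 3 (λ q r p → (q ℤᵣ.:* p) ℤᵣ.:* (r ℤᵣ.:* p) ℤᵣ.:= (q ℤᵣ.:* r) ℤᵣ.:* (p ℤᵣ.:* p)) ≡.refl q r (+ p))
            p∣c : p∣ + c
            p∣c = ℤ∣.*-cancelˡ-∣ (+ p) pp∣

-- Passage between ℤ[X] and ℚ[X]

toℚᵘ-toℚ : ∀ a → ℚ.toℚᵘ (toℚ a) ℚᵘ.≃ ℚᵘ.mkℚᵘ a 0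
toℚᵘ-toℚ a = ℚ.toℚᵘ-fromℚᵘ (ℚᵘ.mkℚᵘ a 0)

toℚ-+ : ∀ a b → toℚ (a ℤ.+ b) ≡ toℚ a ℚ.+ toℚ b
toℚ-+ a b = ℚ.toℚᵘ-injective (ℚᵘ.≃-trans (toℚᵘ-toℚ (a ℤ.+ b)) (ℚᵘ.≃-trans
  (ℚᵘ.*≡* (≡.cong (ℤ._* 1ℤ) (≡.sym (≡.cong₂ ℤ._+_ (ℤ.*-identityʳ a) (ℤ.*-identityʳ b)))))
  (ℚᵘ.≃-sym (ℚᵘ.≃-trans (ℚ.toℚᵘ-homo-+ (toℚ a) (toℚ b)) (ℚᵘ.+-cong (toℚᵘ-toℚ a) (toℚᵘ-toℚ b))))))

toℚ-* : ∀ a b → toℚ (a ℤ.* b) ≡ toℚ a ℚ.* toℚ b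
toℚ-* a b = ℚ.toℚᵘ-injective (ℚᵘ.≃-trans (toℚᵘ-toℚ (a ℤ.* b))
  (ℚᵘ.≃-sym (ℚᵘ.≃-trans (ℚ.toℚᵘ-homo-* (toℚ a) (toℚ b)) (ℚᵘ.*-cong (toℚᵘ-toℚ a) (toℚᵘ-toℚ b)))))

toℚ-neg : ∀ a → toℚ (ℤ.- a) ≡ ℚ.- toℚ a
toℚ-neg a = ℚ.toℚᵘ-injective (ℚᵘ.≃-trans (toℚᵘ-toℚ (ℤ.- a))
  (ℚᵘ.≃-sym (ℚᵘ.≃-trans (ℚ.toℚᵘ-homo‿- (toℚ a)) (ℚᵘ.-‿cong (toℚᵘ-toℚ a)))))

toℚ-injective : ∀ {a b} → toℚ a ≡ toℚ b → a ≡ b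
toℚ-injective {a} {b} e with ℚᵘ.≃-trans (ℚᵘ.≃-sym (toℚᵘ-toℚ a)) (ℚᵘ.≃-trans (ℚᵘ.≃-reflexive (≡.cong ℚ.toℚᵘ e)) (toℚᵘ-toℚ b))
... | ℚᵘ.*≡* eq = ≡.trans (≡.sym (ℤ.*-identityʳ a)) (≡.trans eq (ℤ.*-identityʳ b))

toℚ-isHom : IsRingHomomorphism ℤ.+-*-rawRing ℚ.+-*-rawRing toℚ
toℚ-isHom = record
  { isSemiringHomomorphism = record
    { isNearSemiringHomomorphism = record
      { +-isMonoidHomomorphism = record
        { isMagmaHomomorphism = record
          { isRelHomomorphism = record { cong = ≡.cong toℚ }
          ; homo = toℚ-+ }
        ; ε-homo = ≡.refl }
      ; *-homo = toℚ-* }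
    ; 1#-homo = ≡.refl }
  ; -‿homo = toℚ-neg }

ℚ-inverse? : ∀ x → x ≡ 0ℚ ⊎ ∃[ y ] y ℚ.* x ≡ 1ℚ
ℚ-inverse? x with x ℚ.≟ 0ℚ
... | yes x≡0 = inj₁ x≡0
... | no  x≢0 = inj₂ (ℚ.1/ x , ℚ.*-inverseˡ x)
  where instance _ = ℚ.≢-nonZero x≢0

module ℚₚ = FieldPolynomials ℚ-ring ℚ-inverse? (λ ())

coeff-toℚ[X] : ∀ f i → ℚ[X].coeff (toℚ[X] f) i ≡ toℚ (ℤ[X].coeff f i)
coeff-toℚ[X] []      i       = ≡.refl
coeff-toℚ[X] (x ∷ f) zero    = ≡.refl
coeff-toℚ[X] (x ∷ f) (suc i) = coeff-toℚ[X] f i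

toℚ[X]-cong : ∀ {f g} → f ℤₚ.≃ g → toℚ[X] f ℚₚ.≃ toℚ[X] g
toℚ[X]-cong {f} {g} (ℤₚ.coeffs e) = ℚₚ.coeffs λ i →
  ≡.trans (coeff-toℚ[X] f i) (≡.trans (≡.cong toℚ (e i)) (≡.sym (coeff-toℚ[X] g i)))

toℚ[X]-injective : ∀ {f g} → toℚ[X] f ℚₚ.≃ toℚ[X] g → f ℤₚ.≃ g
toℚ[X]-injective {f} {g} (ℚₚ.coeffs e) = ℤₚ.coeffs λ i →
  toℚ-injective (≡.trans (≡.sym (coeff-toℚ[X] f i)) (≡.trans (e i) (coeff-toℚ[X] g i)))

private
  toℚ[X]-add : ∀ f g → toℚ[X] (ℤ[X].add f g) ≡ ℚ[X].add (toℚ[X] f) (toℚ[X] g)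
  toℚ[X]-add []      g       = ≡.refl
  toℚ[X]-add (x ∷ f) []      = ≡.refl
  toℚ[X]-add (x ∷ f) (y ∷ g) = ≡.cong₂ _∷_ (toℚ-+ x y) (toℚ[X]-add f g)

  toℚ[X]-scale : ∀ x f → toℚ[X] (map (x ℤ.*_) f) ≡ map (toℚ x ℚ.*_) (toℚ[X] f)
  toℚ[X]-scale x []      = ≡.refl
  toℚ[X]-scale x (y ∷ f) = ≡.cong₂ _∷_ (toℚ-* x y) (toℚ[X]-scale x f)

  toℚ[X]-neg : ∀ f → toℚ[X] (map (ℤ.-_) f) ≡ map (ℚ.-_) (toℚ[X] f)
  toℚ[X]-neg []      = ≡.refl
  toℚ[X]-neg (x ∷ f) = ≡.cong₂ _∷_ (toℚ-neg x) (toℚ[X]-neg f)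

  toℚ[X]-mul : ∀ f g → toℚ[X] (ℤ[X].mul f g) ≡ ℚ[X].mul (toℚ[X] f) (toℚ[X] g)
  toℚ[X]-mul []      g = ≡.refl
  toℚ[X]-mul (x ∷ f) g = ≡.trans (toℚ[X]-add (map (x ℤ.*_) g) (0ℤ ∷ ℤ[X].mul f g))
    (≡.cong₂ ℚ[X].add (toℚ[X]-scale x g) (≡.cong (0ℚ ∷_) (toℚ[X]-mul f g)))

toℚ[X]-isHom : IsRingHomomorphism (CommutativeRing.rawRing ℤₚ.polynomialRing)
                                  (CommutativeRing.rawRing ℚₚ.polynomialRing) toℚ[X]
toℚ[X]-isHom = record
  { isSemiringHomomorphism = record
    { isNearSemiringHomomorphism = record
      { +-isMonoidHomomorphism = record
        { isMagmaHomomorphism = record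
          { isRelHomomorphism = record { cong = toℚ[X]-cong }
          ; homo = λ f g → ℚₚ.P.reflexive (toℚ[X]-add f g) }
        ; ε-homo = ℚₚ.P.refl }
      ; *-homo = λ f g → ℚₚ.P.reflexive (toℚ[X]-mul f g) }
    ; 1#-homo = ℚₚ.P.refl }
  ; -‿homo = λ f → ℚₚ.P.reflexive (toℚ[X]-neg f) }

module Toℚ = RingHom ℤₚ.polynomialRing ℚₚ.polynomialRing toℚ[X]-isHom

numerator : ∀ q → toℚ (ℚ.↧ q) ℚ.* q ≡ toℚ (ℚ.↥ q)
numerator q@(mkℚ n d-1 _) = ℚ.toℚᵘ-injective (ℚᵘ.≃-trans (ℚ.toℚᵘ-homo-* (toℚ (ℚ.↧ q)) q)
  (ℚᵘ.≃-trans (ℚᵘ.*-cong (toℚᵘ-toℚ (ℚ.↧ q)) (ℚᵘ.≃-refl {ℚ.toℚᵘ q})) (ℚᵘ.≃-trans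
    (ℚᵘ.*≡* (≡.trans (ℤ.*-identityʳ _) (≡.trans (ℤ.*-comm (+ suc d-1) n)
      (≡.cong (λ k → n ℤ.* + k) (≡.sym (ℕ.*-identityˡ (suc d-1)))))))
    (ℚᵘ.≃-sym (toℚᵘ-toℚ n)))))

clear-denominators : ∀ f → ∃[ c ] (NonZero c × ∃[ g ] map (toℚ (+ c) ℚ.*_) f ℚₚ.≃ toℚ[X] g)
clear-denominators []      = 1 , _ , [] , ℚₚ.P.refl
clear-denominators (q ∷ f) with clear-denominators f
... | c , c≢0 , g , e = ℚ.↧ₙ q ℕ.* c , ℕ.m*n≢0 (ℚ.↧ₙ q) c {{_}} {{c≢0}} , (ℚ.↥ q ℤ.* + c ∷ map (ℚ.↧ q ℤ.*_) g) ,
  ℚₚ.coeffs λ { zero → head ; (suc i) → tail i }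
  where
  open ≡.≡-Reasoning
  split : toℚ (+ (ℚ.↧ₙ q ℕ.* c)) ≡ toℚ (ℚ.↧ q) ℚ.* toℚ (+ c)
  split = ≡.trans (≡.cong toℚ (ℤ.pos-* (ℚ.↧ₙ q) c)) (toℚ-* (ℚ.↧ q) (+ c))
  head : toℚ (+ (ℚ.↧ₙ q ℕ.* c)) ℚ.* q ≡ toℚ (ℚ.↥ q ℤ.* + c)
  head = begin
    toℚ (+ (ℚ.↧ₙ q ℕ.* c)) ℚ.* q           ≡⟨ ≡.cong (ℚ._* q) (≡.trans split (ℚ.*-comm (toℚ (ℚ.↧ q)) (toℚ (+ c)))) ⟩
    toℚ (+ c) ℚ.* toℚ (ℚ.↧ q) ℚ.* q        ≡⟨ ℚ.*-assoc (toℚ (+ c)) (toℚ (ℚ.↧ q)) q ⟩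
    toℚ (+ c) ℚ.* (toℚ (ℚ.↧ q) ℚ.* q)      ≡⟨ ≡.cong (toℚ (+ c) ℚ.*_) (numerator q) ⟩
    toℚ (+ c) ℚ.* toℚ (ℚ.↥ q)              ≡⟨ ℚ.*-comm (toℚ (+ c)) (toℚ (ℚ.↥ q)) ⟩
    toℚ (ℚ.↥ q) ℚ.* toℚ (+ c)              ≡⟨ toℚ-* (ℚ.↥ q) (+ c) ⟨
    toℚ (ℚ.↥ q ℤ.* + c)                    ∎
  tail : ∀ i → ℚ[X].coeff (map (toℚ (+ (ℚ.↧ₙ q ℕ.* c)) ℚ.*_) f) i ≡ ℚ[X].coeff (toℚ[X] (map (ℚ.↧ q ℤ.*_) g)) i
  tail i = begin
    ℚ[X].coeff (map (toℚ (+ (ℚ.↧ₙ q ℕ.* c)) ℚ.*_) f) i  ≡⟨ ℚₚ.coeff-scale (toℚ (+ (ℚ.↧ₙ q ℕ.* c))) f i ⟩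
    toℚ (+ (ℚ.↧ₙ q ℕ.* c)) ℚ.* ℚ[X].coeff f i           ≡⟨ ≡.cong (ℚ._* ℚ[X].coeff f i) split ⟩
    toℚ (ℚ.↧ q) ℚ.* toℚ (+ c) ℚ.* ℚ[X].coeff f i        ≡⟨ ℚ.*-assoc (toℚ (ℚ.↧ q)) (toℚ (+ c)) (ℚ[X].coeff f i) ⟩
    toℚ (ℚ.↧ q) ℚ.* (toℚ (+ c) ℚ.* ℚ[X].coeff f i)
      ≡⟨ ≡.cong (toℚ (ℚ.↧ q) ℚ.*_) (≡.trans (≡.sym (ℚₚ.coeff-scale (toℚ (+ c)) f i)) (ℚₚ.coeff-≈ e i)) ⟩
    toℚ (ℚ.↧ q) ℚ.* ℚ[X].coeff (toℚ[X] g) i             ≡⟨ ℚₚ.coeff-scale (toℚ (ℚ.↧ q)) (toℚ[X] g) i ⟨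
    ℚ[X].coeff (map (toℚ (ℚ.↧ q) ℚ.*_) (toℚ[X] g)) i    ≡⟨ ≡.cong (λ h → ℚ[X].coeff h i) (toℚ[X]-scale (ℚ.↧ q) g) ⟨
    ℚ[X].coeff (toℚ[X] (map (ℚ.↧ q ℤ.*_) g)) i          ∎

toℚ[X]-monic : ∀ {d f} → ℤₚ.MonicOfDegree d f → ℚₚ.MonicOfDegree d (toℚ[X] f)
toℚ[X]-monic {d} {f} (fd≡1 , f<) = ≡.trans (coeff-toℚ[X] f d) (≡.cong toℚ fd≡1) ,
  λ i d<i → ≡.trans (coeff-toℚ[X] f i) (≡.cong toℚ (f< i d<i))

-- Writing the degree as `suc d` makes it positive. The constant term is `p` itself, so that
-- `T - X ^ suc d` divided by `p` has constant term 1.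
record EisensteinAt (p : ℕ) (d : ℕ) (T : ℤ[X]) : Set where
  field
    isMonic    : ℤₚ.MonicOfDegree (suc d) T
    others     : ∀ k → k ≢ suc d → + p ℤ∣.∣ ℤ[X].coeff T k
    constant≡p : ℤ[X].coeff T 0 ≡ + p

module EisensteinCriterion {p d T} (pp : Prime p) (T-eis : EisensteinAt p d T) where
  open EisensteinAt T-eis
  open ModPrime pp

  monicℚ : ℚₚ.MonicOfDegree (suc d) (toℚ[X] T)
  monicℚ = toℚ[X]-monic {suc d} {T} isMonic

  split : ∀ x y → toℚ[X] T ℚₚ.≃ ℚ[X].mul x y → x ℚₚ.∣ₚ (1ℚ ∷ []) ⊎ y ℚₚ.∣ₚ (1ℚ ∷ [])
  split x y T≃xy =
    let a , a≢0 , x₁ , ax≃x₁ = clear-denominators x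
        b , b≢0 , y₁ , by≃y₁ = clear-denominators y
    in combine a a≢0 x₁ ax≃x₁ b b≢0 y₁ by≃y₁
    where
    combine : ∀ a → NonZero a → ∀ x₁ → map (toℚ (+ a) ℚ.*_) x ℚₚ.≃ toℚ[X] x₁ →
              ∀ b → NonZero b → ∀ y₁ → map (toℚ (+ b) ℚ.*_) y ℚₚ.≃ toℚ[X] y₁ → _
    -- The swap is there because a factor of full degree makes the other factor the unit.
    combine a a≢0 x₁ ax≃x₁ b b≢0 y₁ by≃y₁ = Sum.swap (Sum.map x-full y-full
      (eisenstein {T} {suc d} (proj₁ isMonic) others constant≡p (a ℕ.* b) (ℕ.m*n≢0 a b {{a≢0}} {{b≢0}}) x₁ y₁
        λ i → toℚ-injective (abT≡ i)))
      where
      full : ∀ c z z₁ → map (toℚ (+ c) ℚ.*_) z ℚₚ.≃ toℚ[X] z₁ → FullDegree {T} {suc d} (proj₁ isMonic) others constant≡p z₁ →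
             ∃[ i ] (suc d ℕ.≤ i × ℚₚ.Nonzero (ℚ[X].coeff z i))
      full c z z₁ cz≃z₁ (i , d<i , nz) = i , d<i , Sum.fromInj₂
        (λ zi≡0 → contradiction (toℚ-injective (z₁i≡0 zi≡0)) nz) (ℚ-inverse? (ℚ[X].coeff z i))
        where
        z₁i≡0 : ℚ[X].coeff z i ≡ 0ℚ → toℚ (ℤ[X].coeff z₁ i) ≡ toℚ 0ℤ
        z₁i≡0 zi≡0 = ≡.trans (≡.sym (coeff-toℚ[X] z₁ i)) (≡.trans (≡.sym (ℚₚ.coeff-≈ cz≃z₁ i))
          (≡.trans (ℚₚ.coeff-scale (toℚ (+ c)) z i) (≡.trans (≡.cong (toℚ (+ c) ℚ.*_) zi≡0) (ℚ.*-zeroʳ (toℚ (+ c))))))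
      x-full = λ fd → ℚₚ.full-degree⇒unit {toℚ[X] T} {suc d} monicℚ x y T≃xy (full a x x₁ ax≃x₁ fd)
      y-full = λ fd → ℚₚ.full-degree⇒unit {toℚ[X] T} {suc d} monicℚ y x
        (ℚₚ.P.trans T≃xy (ℚₚ.P.*-comm x y)) (full b y y₁ by≃y₁ fd)
      abT≃ : map (toℚ (+ (a ℕ.* b)) ℚ.*_) (toℚ[X] T) ℚₚ.≃ toℚ[X] (ℤ[X].mul x₁ y₁)
      abT≃ = begin
        map (toℚ (+ (a ℕ.* b)) ℚ.*_) (toℚ[X] T)
          ≈⟨ ℚₚ.const-*ₚ (toℚ (+ (a ℕ.* b))) (toℚ[X] T) ⟨
        ℚ[X].mul (toℚ (+ (a ℕ.* b)) ∷ []) (toℚ[X] T)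
          ≈⟨ ℚₚ.P.*-cong constants T≃xy ⟩
        ℚ[X].mul (ℚ[X].mul A B) (ℚ[X].mul x y)
          ≈⟨ ℚₚ.P.solve 4 (λ a b x y → (a ℚₚ.P.:* b) ℚₚ.P.:* (x ℚₚ.P.:* y) ℚₚ.P.:= (a ℚₚ.P.:* x) ℚₚ.P.:* (b ℚₚ.P.:* y))
               ℚₚ.P.refl A B x y ⟩
        ℚ[X].mul (ℚ[X].mul A x) (ℚ[X].mul B y)
          ≈⟨ ℚₚ.P.*-cong (ℚₚ.P.trans (ℚₚ.const-*ₚ (toℚ (+ a)) x) ax≃x₁) (ℚₚ.P.trans (ℚₚ.const-*ₚ (toℚ (+ b)) y) by≃y₁) ⟩
        ℚ[X].mul (toℚ[X] x₁) (toℚ[X] y₁)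
          ≈⟨ Toℚ.φ-* x₁ y₁ ⟨
        toℚ[X] (ℤ[X].mul x₁ y₁) ∎
        where
        open import Relation.Binary.Reasoning.Setoid ℚₚ.P.setoid
        A = toℚ (+ a) ∷ []
        B = toℚ (+ b) ∷ []
        constants : (toℚ (+ (a ℕ.* b)) ∷ []) ℚₚ.≃ ℚ[X].mul A B
        constants = ℚₚ.coeffs λ
          { zero    → ≡.trans (≡.cong toℚ (ℤ.pos-* a b)) (≡.trans (toℚ-* (+ a) (+ b)) (≡.sym (ℚ.+-identityʳ _)))
          ; (suc i) → ≡.refl }
      abT≡ : ∀ i → toℚ (+ (a ℕ.* b) ℤ.* ℤ[X].coeff T i) ≡ toℚ (ℤ[X].coeff (ℤ[X].mul x₁ y₁) i)
      abT≡ i = begin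
        toℚ (+ (a ℕ.* b) ℤ.* ℤ[X].coeff T i)                     ≡⟨ toℚ-* (+ (a ℕ.* b)) (ℤ[X].coeff T i) ⟩
        toℚ (+ (a ℕ.* b)) ℚ.* toℚ (ℤ[X].coeff T i)               ≡⟨ ≡.cong (toℚ (+ (a ℕ.* b)) ℚ.*_) (coeff-toℚ[X] T i) ⟨
        toℚ (+ (a ℕ.* b)) ℚ.* ℚ[X].coeff (toℚ[X] T) i            ≡⟨ ℚₚ.coeff-scale (toℚ (+ (a ℕ.* b))) (toℚ[X] T) i ⟨
        ℚ[X].coeff (map (toℚ (+ (a ℕ.* b)) ℚ.*_) (toℚ[X] T)) i   ≡⟨ ℚₚ.coeff-≈ abT≃ i ⟩
        ℚ[X].coeff (toℚ[X] (ℤ[X].mul x₁ y₁)) i                   ≡⟨ coeff-toℚ[X] (ℤ[X].mul x₁ y₁) i ⟩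
        toℚ (ℤ[X].coeff (ℤ[X].mul x₁ y₁) i)                      ∎
        where open ≡.≡-Reasoning

  irreducible : IrreducibleOverℚ T
  irreducible = RawSemiringDefinitions.mkIrred
    (λ { (u RawMagma., e) → contradiction
        (ℚₚ.unit⇒degree-0 (toℚ[X] T) (ℚₚ.monic-degree (toℚ[X] T) monicℚ) (u , ℚₚ.coeffs e)) λ () })
    (λ {x} {y} e → Sum.map (λ (u , e) → u RawMagma., ℚₚ.coeff-≈ e) (λ (u , e) → u RawMagma., ℚₚ.coeff-≈ e)
      (split x y (ℚₚ.coeffs e)))

  bezout : ∀ h → toℚ[X] T ℚₚ.∣ₚ h ⊎ ∃₂ λ u v → ℚ[X].add (ℚ[X].mul u h) (ℚ[X].mul v (toℚ[X] T)) ℚₚ.≃ (1ℚ ∷ [])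
  bezout = ℚₚ.bezout {toℚ[X] T} {suc d} monicℚ split

-- Cyclotomic polynomials

module MonicPolynomials (R : CommutativeRing c ℓ) where
  private
    module R = RingTheory R
  open PolynomialRing R
  open RingTheory polynomialRing

  monic-resp : ∀ {d f g} → f ≃ g → MonicOfDegree d f → MonicOfDegree d g
  monic-resp {d} {f} {g} f≃g (top , below) = R.trans (R.sym (coeff-≈ f≃g d)) top , below-resp {f} {g} f≃g below

  monic-1 : MonicOfDegree 0 1#
  monic-1 = R.refl , λ { (suc i) _ → R.refl }

  monic-X : MonicOfDegree 1 X
  monic-X = R.refl , λ { (suc (suc i)) _ → R.refl ; (suc zero) (s≤s ()) }

  monic-^ : ∀ {a} f → MonicOfDegree a f → ∀ n → MonicOfDegree (n ℕ.* a) (f ^ n)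
  monic-^ f f-monic zero    = monic-1
  monic-^ f f-monic (suc n) = monic-* {f} {f ^ n} f-monic (monic-^ f f-monic n)

  monic-1+ : ∀ {a} f → MonicOfDegree (suc a) f → MonicOfDegree (suc a) (1# + f)
  monic-1+ {a} f (top , below) = R.trans (at a) top , λ { (suc i) le → R.trans (at i) (below (suc i) le) }
    where
    at : ∀ i → coeff (1# + f) (suc i) R.≈ coeff f (suc i)
    at i = R.trans (coeff-add 1# f (suc i)) (R.+-identityˡ _)

  monic-geom : ∀ {a} f → MonicOfDegree (suc a) f → ∀ k → MonicOfDegree (k ℕ.* suc a) (geom (suc k) f)
  monic-geom f f-monic zero    = monic-resp {0} {1#} (sym (trans (+-congˡ {1#} (zeroʳ f)) (+-identityʳ 1#))) monic-1
  monic-geom f f-monic (suc k) = monic-1+ (f * geom (suc k) f)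
    (monic-* {f} {geom (suc k) f} f-monic (monic-geom f f-monic k))

  coeff-X^* : ∀ k f i → coeff (X ^ k * f) (k ℕ.+ i) R.≈ coeff f i
  coeff-X^* zero    f i = coeff-≈ (*-identityˡ f) i
  coeff-X^* (suc k) f i = R.trans
    (coeff-≈ (trans (*-assoc X (X ^ k) f) (sym (shift≃X* (X ^ k * f)))) (suc k ℕ.+ i)) (coeff-X^* k f i)

  coeff-X^-≢ : ∀ k i → i ≢ k → coeff (X ^ k) i R.≈ R.0#
  coeff-X^-≢ zero    zero    i≢k = contradiction ≡.refl i≢k
  coeff-X^-≢ zero    (suc i) i≢k = R.refl
  coeff-X^-≢ (suc k) zero    i≢k = coeff-≈ (sym (shift≃X* (X ^ k))) 0
  coeff-X^-≢ (suc k) (suc i) i≢k = R.trans (coeff-≈ (sym (shift≃X* (X ^ k))) (suc i))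
    (coeff-X^-≢ k i λ i≡k → i≢k (≡.cong suc i≡k))

  1+X* : ∀ f → 1# + X * f ≃ (R.1# ∷ f)
  1+X* f = sym (horner R.1# f)

module _ (R : CommutativeRing c ℓ) {p : ℕ} (pp : Prime p) where
  open RingTheory R

  -- Additivity of Frobenius in the quotient by (p, 0), read back in `R` with an explicit multiple
  -- of `p`.
  freshman : ∀ j v → ∃[ a ] (1# + v) ^ (p ℕ.^ j) ≈ 1# + v ^ (p ℕ.^ j) + p · 1# * a
  freshman j v =
    let a , b , e = conclusion
    in a , trans e (solve 4 (λ x q a b → x :+ (q :* a :+ con (+ 0) :* b) := x :+ q :* a) refl (1# + v ^ Q) (p · 1#) a b)
    where
    module Quot = Quotient R (p · 1#) 0#
    module S = RingTheory Quot.quotient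
    open RingHom R Quot.quotient (quotient-isHom R (p · 1#) 0#)
    open import Relation.Binary.Reasoning.Setoid S.setoid
    p≈0 : p S.· S.1# S.≈ S.0#
    p≈0 = S.trans {p S.· S.1#} {p · 1#} {S.0#} (S.sym {p · 1#} {p S.· S.1#} (φ-· p 1#)) Quot.u∼0
    Q = p ℕ.^ j
    conclusion : (1# + v) ^ Q S.≈ 1# + v ^ Q
    conclusion = begin
      (1# + v) ^ Q              ≈⟨ φ-^ (1# + v) Q ⟩
      (1# + v) S.^ Q            ≈⟨ Frobenius.^pʲ-homo-+ Quot.quotient pp p≈0 j 1# v ⟩
      1# S.^ Q + v S.^ Q        ≈⟨ S.+-cong {1# S.^ Q} {1#} {v S.^ Q} {v ^ Q} (S.1^n≈1 Q) (S.sym {v ^ Q} {v S.^ Q} (φ-^ v Q)) ⟩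
      1# + v ^ Q                ∎

  -- For `U = (1 + v) ^ P` one has `(U - 1) * geom p U = U ^ p - 1`, and modulo `p` the outer terms
  -- `U - 1` and `U ^ p - 1` are `v ^ P` and `v ^ (p P)`. The factor `v ^ P` stays on the left; when
  -- `v` is a power of X it is removed by a shift of coefficients.
  geom-mod-p : ∀ m v → ∃[ a ] v ^ (p ℕ.^ m) * geom p ((1# + v) ^ (p ℕ.^ m)) ≈ v ^ (p ℕ.^ suc m) + p · 1# * a
  geom-mod-p m v = b - a * G , (begin
    W * G
      ≈⟨ linear (- G) U≈ (solve 5 (λ W G U q a → W :* G :+ (:- G) :* (con (+ 1) :+ W :+ q :* a)
           := U :* G :- G :- q :* (a :* G) :+ (:- G) :* U) refl W G U (p · 1#) a) ⟩
    U * G - G - p · 1# * (a * G)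
      ≈⟨ linear 1# (geom-telescope p U) (solve 4 (λ UG G V z → UG :- G :- z :+ con (+ 1) :* (G :+ V)
           := V :- con (+ 1) :- z :+ con (+ 1) :* (UG :+ con (+ 1))) refl (U * G) G (U ^ p) (p · 1# * (a * G))) ⟩
    U ^ p - 1# - p · 1# * (a * G)
      ≈⟨ linear 1# U^p≈ (solve 6 (λ V q a G W b → V :- con (+ 1) :- q :* (a :* G) :+ con (+ 1) :* (con (+ 1) :+ W :+ q :* b)
           := W :+ q :* (b :- a :* G) :+ con (+ 1) :* V) refl (U ^ p) (p · 1#) a G (v ^ (p ℕ.^ suc m)) b) ⟩
    v ^ (p ℕ.^ suc m) + p · 1# * (b - a * G) ∎)
    where
    open import Relation.Binary.Reasoning.Setoid setoid
    P = p ℕ.^ m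
    W = v ^ P
    U = (1# + v) ^ P
    G = geom p U
    a = proj₁ (freshman m v)
    b = proj₁ (freshman (suc m) v)
    U≈ : U ≈ 1# + W + p · 1# * a
    U≈ = proj₂ (freshman m v)
    U^p≈ : U ^ p ≈ 1# + v ^ (p ℕ.^ suc m) + p · 1# * b
    U^p≈ = trans (^-assocʳ (1# + v) P p) (trans (^-congʳ (1# + v) (ℕ.*-comm P p)) (proj₂ (freshman (suc m) v)))

n·1≡+n : ∀ n → n ℤᵣ.· 1ℤ ≡ + n
n·1≡+n zero    = ≡.refl
n·1≡+n (suc n) = ≡.cong (λ z → 1ℤ ℤ.+ z) (n·1≡+n n)

module _ where
  open ℤₚ-ring
  open ℤₚ using (X; _≃_; coeff; coeff-≈; coeffs; MonicOfDegree)
  open MonicPolynomials ℤ-ring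
  private
    module Const = RingHom ℤ-ring ℤₚ.polynomialRing ℤₚ.const-isHomomorphism
    module At0 = Evaluation ℤ-ring ℤ-ring (Identity.isRingHomomorphism (CommutativeRing.rawRing ℤ-ring) ≡.refl)
    module Ev0 = RingHom ℤₚ.polynomialRing ℤ-ring (At0.ev-isHom 0ℤ)

  coeff-n·1* : ∀ n f i → coeff (n · 1# * f) i ≡ + n ℤ.* coeff f i
  coeff-n·1* n f i = ≡.trans
    (coeff-≈ (trans (*-congʳ {f} {n · 1#} {(n ℤᵣ.· 1ℤ) ∷ []} (sym (Const.φ-· n 1ℤ))) (ℤₚ.const-*ₚ (n ℤᵣ.· 1ℤ) f)) i)
    (≡.trans (ℤₚ.coeff-scale (n ℤᵣ.· 1ℤ) f i) (≡.cong (ℤ._* coeff f i) (n·1≡+n n)))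

  coeff₀≡ev0 : ∀ f → coeff f 0 ≡ At0.ev f 0ℤ
  coeff₀≡ev0 []      = ≡.refl
  coeff₀≡ev0 (x ∷ f) = ≡.sym (ℤ.+-identityʳ x)

  -- Φ_{p ^ suc m} at 1 + X ^ (2 ^ n) = Φ_{2 ^ suc n}.
  cyclotomicShift : ℕ → ℕ → ℕ → ℤ[X]
  cyclotomicShift p m n = geom p ((1# + X ^ (2 ℕ.^ n)) ^ (p ℕ.^ m))

  cyclotomicShift-eisenstein : ∀ {p} → Prime p → ∀ m n {T} → T ≃ cyclotomicShift p m n → ∃[ d ] EisensteinAt p d T
  cyclotomicShift-eisenstein {p@(suc (suc k))} pp m n {T} T≃ = ℕ.pred D , record
    { isMonic    = ≡.subst (λ d → MonicOfDegree d T) (≡.sym D≡) (monic-resp {D} {cyclotomicShift p m n} (sym T≃) monic)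
    ; others     = λ i i≢ → ≡.subst (+ p ℤ∣.∣_) (≡.sym (coeff-T i))
        (ℤ∣.∣m∣n⇒∣m+n (≡.subst (+ p ℤ∣.∣_) (≡.sym (coeff-X^-≢ D i (λ i≡D → i≢ (≡.trans i≡D (≡.sym D≡))))) (ℤ∣.divides 0ℤ ≡.refl))
          (ℤ∣.∣m⇒∣m*n _ ℤ∣.∣-refl))
    ; constant≡p = constant }
    where
    N = 2 ℕ.^ n
    P = p ℕ.^ m
    instance
      N≢0 = ℕ.m^n≢0 2 n
      P≢0 = ℕ.m^n≢0 p m
      PN≢0 = ℕ.m*n≢0 P N
    -- Here `p = suc (suc k)`, so this is `(p - 1) P N`.
    D = suc k ℕ.* (P ℕ.* N)
    D≡ : suc (ℕ.pred D) ≡ D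
    D≡ = ℕ.suc-pred D {{ℕ.m*n≢0 (suc k) (P ℕ.* N)}}
    v = X ^ N
    monic-v : MonicOfDegree (suc (ℕ.pred N)) v
    monic-v = ≡.subst (λ d → MonicOfDegree d v) (≡.trans (ℕ.*-identityʳ N) (≡.sym (ℕ.suc-pred N))) (monic-^ X monic-X N)
    monic-U : MonicOfDegree (suc (ℕ.pred (P ℕ.* N))) ((1# + v) ^ P)
    monic-U = ≡.subst (λ d → MonicOfDegree d ((1# + v) ^ P))
      (≡.trans (≡.cong (P ℕ.*_) (ℕ.suc-pred N)) (≡.sym (ℕ.suc-pred (P ℕ.* N)))) (monic-^ (1# + v) (monic-1+ v monic-v) P)
    monic : MonicOfDegree D (cyclotomicShift p m n)
    monic = ≡.subst (λ e → MonicOfDegree (suc k ℕ.* e) (cyclotomicShift p m n)) (ℕ.suc-pred (P ℕ.* N))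
      (monic-geom ((1# + v) ^ P) monic-U (suc k))
    a = proj₁ (geom-mod-p ℤₚ.polynomialRing pp m v)
    mod-p : X ^ (P ℕ.* N) * T ≃ X ^ (P ℕ.* N) * X ^ D + p · 1# * a
    mod-p = begin
      X ^ (P ℕ.* N) * T
        ≈⟨ *-cong (trans (^-congʳ X (ℕ.*-comm P N)) (sym (^-assocʳ X N P))) T≃ ⟩
      v ^ P * cyclotomicShift p m n
        ≈⟨ proj₂ (geom-mod-p ℤₚ.polynomialRing pp m v) ⟩
      v ^ (p ℕ.^ suc m) + p · 1# * a
        ≈⟨ +-congʳ {p · 1# * a} (trans (^-assocʳ X N (p ℕ.* P)) (trans (^-congʳ X exponent) (^-homo-* X (P ℕ.* N) D))) ⟩
      X ^ (P ℕ.* N) * X ^ D + p · 1# * a ∎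
      where
      open import Relation.Binary.Reasoning.Setoid setoid
      exponent : N ℕ.* (p ℕ.* P) ≡ P ℕ.* N ℕ.+ D
      exponent = ≡.trans (ℕ.*-comm N (p ℕ.* P)) (ℕ.*-assoc p P N)
    -- Cancels the common factor `X ^ (P * N)` of `mod-p` by reading coefficients `P * N` places
    -- higher.
    coeff-T : ∀ i → coeff T i ≡ coeff (X ^ D) i ℤ.+ + p ℤ.* coeff a (P ℕ.* N ℕ.+ i)
    coeff-T i = begin
      coeff T i
        ≡⟨ coeff-X^* (P ℕ.* N) T i ⟨
      coeff (X ^ (P ℕ.* N) * T) (P ℕ.* N ℕ.+ i)
        ≡⟨ coeff-≈ mod-p (P ℕ.* N ℕ.+ i) ⟩
      coeff (X ^ (P ℕ.* N) * X ^ D + p · 1# * a) (P ℕ.* N ℕ.+ i)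
        ≡⟨ ℤₚ.coeff-add (X ^ (P ℕ.* N) * X ^ D) (p · 1# * a) (P ℕ.* N ℕ.+ i) ⟩
      coeff (X ^ (P ℕ.* N) * X ^ D) (P ℕ.* N ℕ.+ i) ℤ.+ coeff (p · 1# * a) (P ℕ.* N ℕ.+ i)
        ≡⟨ ≡.cong₂ ℤ._+_ (coeff-X^* (P ℕ.* N) (X ^ D) i) (coeff-n·1* p a (P ℕ.* N ℕ.+ i)) ⟩
      coeff (X ^ D) i ℤ.+ + p ℤ.* coeff a (P ℕ.* N ℕ.+ i) ∎
      where open ≡.≡-Reasoning
    constant : coeff T 0 ≡ + p
    constant = begin
      coeff T 0                                                    ≡⟨ coeff₀≡ev0 T ⟩
      At0.ev T 0ℤ                                                  ≡⟨ Ev0.φ-cong T≃ ⟩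
      At0.ev (cyclotomicShift p m n) 0ℤ                            ≡⟨ Ev0.φ-geom p ((1# + v) ^ P) ⟩
      ℤᵣ.geom p (At0.ev ((1# + v) ^ P) 0ℤ)                         ≡⟨ ℤᵣ.geom-cong p (≡.trans (Ev0.φ-^ (1# + v) P) (≡.trans (ℤᵣ.^-congˡ P v₀) (ℤᵣ.1^n≈1 P))) ⟩
      ℤᵣ.geom p 1ℤ                                                 ≡⟨ ℤᵣ.geom-1 p ⟩
      p ℤᵣ.· 1ℤ                                                    ≡⟨ n·1≡+n p ⟩
      + p                                                          ∎
      where
      open ≡.≡-Reasoning
      v₀ : At0.ev (1# + v) 0ℤ ≡ 1ℤ
      v₀ = ≡.trans (Ev0.φ-+ 1# v) (≡.cong₂ ℤ._+_ Ev0.φ-1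
        (≡.trans (Ev0.φ-^ X N) (≡.trans (ℤᵣ.^-congˡ N {At0.ev X 0ℤ} {0ℤ} ≡.refl) (ℤᵣ.0^n≈0 N))))
  cyclotomicShift-eisenstein {0} pp = contradiction pp λ ()
  cyclotomicShift-eisenstein {1} pp = contradiction pp λ ()

  -- `p` divides every coefficient of `T - X ^ suc d`, and the quotient has constant term 1. That
  -- quotient is the unit modulo θ used at the prime `p`.
  eisenstein-form : ∀ {p d T} → Prime p → EisensteinAt p d T → ∃[ g ] T ≃ X ^ suc d + p · 1# * (1# + X * g)
  eisenstein-form {p} {d} {T} pp T-eis = conclude (divide (T - X ^ suc d) all-divisible)
    where
    open EisensteinAt T-eis
    open ModPrime pp using (divide; p∣_)
    instance _ = prime⇒nonZero pp
    coeff-diff : ∀ i → coeff (T - X ^ suc d) i ≡ coeff T i ℤ.- coeff (X ^ suc d) i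
    coeff-diff i = ≡.trans (ℤₚ.coeff-add T (- X ^ suc d) i) (≡.cong (λ z → coeff T i ℤ.+ z) (ℤₚ.coeff-neg (X ^ suc d) i))
    X^-top : coeff (X ^ suc d) (suc d) ≡ 1ℤ
    X^-top = ≡.subst (λ e → coeff (X ^ suc d) e ≡ 1ℤ) (ℕ.*-identityʳ (suc d)) (proj₁ (monic-^ X monic-X (suc d)))
    all-divisible : ∀ i → p∣ coeff (T - X ^ suc d) i
    all-divisible i with i ℕ.≟ suc d
    ... | yes ≡.refl = ≡.subst p∣_ (≡.sym (≡.trans (coeff-diff (suc d))
                         (≡.trans (≡.cong₂ ℤ._-_ (proj₁ isMonic) X^-top) (ℤ.+-inverseʳ 1ℤ)))) (ℤ∣.divides 0ℤ ≡.refl)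
    ... | no i≢      = ≡.subst p∣_ (≡.sym (≡.trans (coeff-diff i) (≡.trans
                         (≡.cong (λ z → coeff T i ℤ.- z) (coeff-X^-≢ (suc d) i i≢)) (ℤ.+-identityʳ _)))) (others i i≢)
    conclude : (∃[ G ] (T - X ^ suc d) ≃ map (+ p ℤ.*_) G) → ∃[ g ] T ≃ X ^ suc d + p · 1# * (1# + X * g)
    conclude (G , e) = finish G (ℤ.*-cancelˡ-≡ (+ p) _ _ (begin
      + p ℤ.* coeff G 0                 ≡⟨ ℤₚ.coeff-scale (+ p) G 0 ⟨
      coeff (map (+ p ℤ.*_) G) 0        ≡⟨ coeff-≈ e 0 ⟨
      coeff (T - X ^ suc d) 0           ≡⟨ coeff-diff 0 ⟩
      coeff T 0 ℤ.- coeff (X ^ suc d) 0 ≡⟨ ≡.cong₂ ℤ._-_ constant≡p (coeff-X^-≢ (suc d) 0 λ ()) ⟩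
      + p ℤ.- 0ℤ                        ≡⟨ ℤ.+-identityʳ (+ p) ⟩
      + p                               ≡⟨ ℤ.*-identityʳ (+ p) ⟨
      + p ℤ.* 1ℤ                        ∎)) e
      where
      open ≡.≡-Reasoning
      finish : ∀ G → coeff G 0 ≡ 1ℤ → (T - X ^ suc d) ≃ map (+ p ℤ.*_) G → ∃[ g ] T ≃ X ^ suc d + p · 1# * (1# + X * g)
      finish (x ∷ g) ≡.refl e = g , trans
        (solve 2 (λ t x → t := x :+ (t :- x)) refl T (X ^ suc d))
        (+-congˡ {X ^ suc d} (trans e (coeffs λ i → ≡.trans (ℤₚ.coeff-scale (+ p) (1ℤ ∷ g) i)
          (≡.sym (≡.trans (coeff-n·1* p (1# + X * g) i) (≡.cong (+ p ℤ.*_) (coeff-≈ (1+X* g) i)))))))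

-- The substitution of 1 + X for X

eval-natural : ∀ {a} {A : Set a} (S : CommutativeRing c ℓ) (S′ : CommutativeRing c′ ℓ′) {ψ} →
  IsRingHomomorphism (CommutativeRing.rawRing S) (CommutativeRing.rawRing S′) ψ →
  {ι : A → CommutativeRing.Carrier S} {ι′ : A → CommutativeRing.Carrier S′} →
  (∀ a → CommutativeRing._≈_ S′ (ψ (ι a)) (ι′ a)) → ∀ f {y y′} → CommutativeRing._≈_ S′ (ψ y) y′ →
  CommutativeRing._≈_ S′ (ψ (eval (CommutativeRing.rawRing S) ι f y)) (eval (CommutativeRing.rawRing S′) ι′ f y′)
eval-natural S S′ ψ-isHom e []      ey = IsRingHomomorphism.0#-homo ψ-isHom
eval-natural S S′ ψ-isHom e (x ∷ f) ey = S′.trans (φ-+ _ _)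
  (S′.+-cong (e x) (S′.trans (φ-* _ _) (S′.*-cong ey (eval-natural S S′ ψ-isHom e f ey))))
  where
  module S′ = CommutativeRing S′
  open RingHom S S′ ψ-isHom

module Translation where
  open ℚₚ using (_≃_; _∣ₚ_; X; module P)
  open P
  module C = Evaluation ℚ-ring ℚₚ.polynomialRing ℚₚ.const-isHomomorphism

  shift unshift : ℚ[X] → ℚ[X]
  shift f   = C.ev f (1# + X)
  unshift f = C.ev f (X - 1#)

  module Shift   = RingHom ℚₚ.polynomialRing ℚₚ.polynomialRing (C.ev-isHom (1# + X))
  module Unshift = RingHom ℚₚ.polynomialRing ℚₚ.polynomialRing (C.ev-isHom (X - 1#))

  ev-X≃ : ∀ f → C.ev f X ≃ f
  ev-X≃ []      = refl
  ev-X≃ (x ∷ f) = trans (+-congˡ {x ∷ []} (*-congˡ {X} (ev-X≃ f))) (sym (ℚₚ.horner x f))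

  unshift-shift : ∀ f → unshift (shift f) ≃ f
  unshift-shift f = trans (eval-natural ℚₚ.polynomialRing ℚₚ.polynomialRing (C.ev-isHom (X - 1#))
      (C.ev-const (X - 1#)) f {1# + X} {X} unshift-1+X) (ev-X≃ f)
    where
    unshift-1+X : unshift (1# + X) ≃ X
    unshift-1+X = trans (Unshift.φ-+ 1# X) (trans (+-cong Unshift.φ-1 (C.ev-X (X - 1#)))
      (solve 1 (λ x → con (+ 1) :+ (x :- con (+ 1)) := x) refl X))

  unit-unshift : ∀ f → shift f ∣ₚ 1# → f ∣ₚ 1#
  unit-unshift f (u , e) = unshift u , (begin
    unshift u * f                    ≈⟨ *-congˡ {unshift u} (unshift-shift f) ⟨
    unshift u * unshift (shift f)    ≈⟨ Unshift.φ-* u (shift f) ⟨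
    unshift (u * shift f)            ≈⟨ Unshift.φ-cong e ⟩
    unshift 1#                       ≈⟨ Unshift.φ-1 ⟩
    1#                               ∎)
    where open import Relation.Binary.Reasoning.Setoid setoid

-- Extension fields and the identification of cyclotomic polynomials

module ExtensionRing (K : Extension) where
  open Extension K using (isCommutativeRing; ι-isHomomorphism; evalℚ; evalℤ; tight; #⇒invertible; invertible⇒#; #-irrefl; _#_)

  fieldRing : CommutativeRing 0ℓ 0ℓ
  fieldRing = record { isCommutativeRing = isCommutativeRing }

  open RingTheory fieldRing public

  1≉0 : ¬ 1# ≈ 0#
  1≉0 1≈0 = #-irrefl refl (invertible⇒# {0#} {0#} (0# , trans (zeroˡ _) (sym 1≈0) , trans (zeroʳ _) (sym 1≈0)))

  #0⇒inverse : ∀ {x} → x # 0# → ∃[ y ] y * x ≈ 1#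
  #0⇒inverse {x} x#0 =
    let y , e , _ = #⇒invertible x#0
    in y , trans (*-congˡ (sym (trans (+-congˡ -0#≈0#) (+-identityʳ x)))) e

  module Evℚ = Evaluation ℚ-ring fieldRing ι-isHomomorphism

  evalℚ-isHom : ∀ x → IsRingHomomorphism (CommutativeRing.rawRing ℚₚ.polynomialRing) (CommutativeRing.rawRing fieldRing) (λ f → evalℚ f x)
  evalℚ-isHom = Evℚ.ev-isHom

  evalℤ-isHom : ∀ x → IsRingHomomorphism (CommutativeRing.rawRing ℤₚ.polynomialRing) (CommutativeRing.rawRing fieldRing) (λ f → evalℤ f x)
  evalℤ-isHom x = ∘-isRingHom ℤₚ.polynomialRing ℚₚ.polynomialRing fieldRing toℚ[X]-isHom (evalℚ-isHom x)

  no-root-of-unit : ∀ {f x} → evalℚ f x ≈ 0# → ¬ f ℚₚ.∣ₚ (1ℚ ∷ [])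
  no-root-of-unit {f} {x} root (u , e) = 1≉0 (begin
    1#                       ≈⟨ φ-1 ⟨
    evalℚ (1ℚ ∷ []) x        ≈⟨ φ-cong e ⟨
    evalℚ (ℚ[X].mul u f) x   ≈⟨ φ-* u f ⟩
    evalℚ u x * evalℚ f x    ≈⟨ trans (*-congˡ root) (zeroʳ _) ⟩
    0#                       ∎)
    where
    open import Relation.Binary.Reasoning.Setoid setoid
    open RingHom ℚₚ.polynomialRing fieldRing (evalℚ-isHom x)

  -- By tightness it suffices to refute that the sum `G` is apart from 0: then `G` would be
  -- invertible, and `x G = G` would force `x = 1`.
  geom-root : ∀ p {x} → x ^ p ≈ 1# → ¬ x ≈ 1# → geom p x ≈ 0#
  geom-root p {x} x^p≈1 x≉1 = proj₁ (tight (geom p x) 0#) λ G#0 →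
    let y , yG≈1 = #0⇒inverse G#0
    in x≉1 (begin
      x                       ≈⟨ *-identityʳ x ⟨
      x * 1#                  ≈⟨ *-congˡ yG≈1 ⟨
      x * (y * geom p x)      ≈⟨ solve 3 (λ x y g → x :* (y :* g) := y :* (x :* g)) refl x y (geom p x) ⟩
      y * (x * geom p x)      ≈⟨ *-congˡ (+-cancelʳ 1# _ _ (trans (geom-telescope p x) (+-congˡ x^p≈1))) ⟩
      y * geom p x            ≈⟨ yG≈1 ⟩
      1#                      ∎)
    where open import Relation.Binary.Reasoning.Setoid setoid

module _ where
  open ℤₚ-ring using (geom; _^_)

  -- Φ_{p ^ suc m}.
  cyclotomic : ℕ → ℕ → ℤ[X]
  cyclotomic p m = geom p (ℤₚ.X ^ (p ℕ.^ m))

  cyclotomic-monic : ∀ {p} → Prime p → ∀ m → ∃[ d ] ℤₚ.MonicOfDegree d (cyclotomic p m)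
  cyclotomic-monic {zero}  pp m = contradiction pp λ ()
  cyclotomic-monic {suc k} pp m = _ , monic-geom (ℤₚ.X ^ P)
    (≡.subst (λ d → ℤₚ.MonicOfDegree d (ℤₚ.X ^ P)) (≡.trans (ℕ.*-identityʳ P) (≡.sym (ℕ.suc-pred P))) (monic-^ ℤₚ.X monic-X P)) k
    where
    open MonicPolynomials ℤ-ring
    P = suc k ℕ.^ m
    instance _ = ℕ.m^n≢0 (suc k) m

shift-cyclotomic : ∀ p m → Translation.shift (toℚ[X] (cyclotomic p m)) ℚₚ.≃ toℚ[X] (cyclotomicShift p m 0)
shift-cyclotomic p m = begin
  shift (toℚ[X] (cyclotomic p m))                  ≈⟨ Shift.φ-cong (Toℚ.φ-geom p (ℤₚ.X ℤₚ-ring.^ P)) ⟩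
  shift (geom p (toℚ[X] (ℤₚ.X ℤₚ-ring.^ P)))       ≈⟨ Shift.φ-geom p (toℚ[X] (ℤₚ.X ℤₚ-ring.^ P)) ⟩
  geom p (shift (toℚ[X] (ℤₚ.X ℤₚ-ring.^ P)))       ≈⟨ geom-cong p (trans (Shift.φ-cong (Toℚ.φ-^ ℤₚ.X P)) (trans (Shift.φ-^ X P) (^-congˡ P inner))) ⟩
  geom p (toℚ[X] V ^ P)                            ≈⟨ geom-cong p (Toℚ.φ-^ V P) ⟨
  geom p (toℚ[X] (V ℤₚ-ring.^ P))                  ≈⟨ Toℚ.φ-geom p (V ℤₚ-ring.^ P) ⟨
  toℚ[X] (cyclotomicShift p m 0)                   ∎
  where
  open Translation
  open ℚₚ using (X; module P)
  open P
  open import Relation.Binary.Reasoning.Setoid setoid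
  P = p ℕ.^ m
  V = ℤₚ-ring.1# ℤₚ-ring.+ ℤₚ.X ℤₚ-ring.^ 1
  inner : shift X ℚₚ.≃ toℚ[X] V
  inner = trans (C.ev-X (1# + X)) (trans (+-congˡ {1#} (sym (*-identityʳ X)))
    (sym (trans (Toℚ.φ-+ ℤₚ-ring.1# (ℤₚ.X ℤₚ-ring.^ 1)) (+-cong Toℚ.φ-1 (Toℚ.φ-^ ℤₚ.X 1)))))

cyclotomicShift-split : ∀ {p} → Prime p → ∀ m f g → toℚ[X] (cyclotomicShift p m 0) ℚₚ.≃ ℚ[X].mul f g →
                        f ℚₚ.∣ₚ (1ℚ ∷ []) ⊎ g ℚₚ.∣ₚ (1ℚ ∷ [])
cyclotomicShift-split {p} pp m = EisensteinCriterion.split {p} {proj₁ T-eis} {T} pp (proj₂ T-eis)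
  where
  T = cyclotomicShift p m 0
  T-eis : ∃[ d ] EisensteinAt p d T
  T-eis = cyclotomicShift-eisenstein pp m 0 {T} ℤₚ-ring.refl

-- Substituting 1 + X gives `cyclotomicShift p m 0`, the case `N = 1` of the Eisenstein polynomial,
-- and units are carried back by X - 1.
cyclotomic-split : ∀ {p} → Prime p → ∀ m f g → toℚ[X] (cyclotomic p m) ℚₚ.≃ ℚ[X].mul f g →
                   f ℚₚ.∣ₚ (1ℚ ∷ []) ⊎ g ℚₚ.∣ₚ (1ℚ ∷ [])
cyclotomic-split {p} pp m f g e = Sum.map (unit-unshift f) (unit-unshift g)
  (cyclotomicShift-split pp m (shift f) (shift g) e′)
  where
  open Translation using (shift; module Shift; unit-unshift)
  e′ : toℚ[X] (cyclotomicShift p m 0) ℚₚ.≃ ℚ[X].mul (shift f) (shift g)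
  e′ = begin
    toℚ[X] (cyclotomicShift p m 0)     ≈⟨ shift-cyclotomic p m ⟨
    shift (toℚ[X] (cyclotomic p m))    ≈⟨ Shift.φ-cong e ⟩
    shift (ℚ[X].mul f g)               ≈⟨ Shift.φ-* f g ⟩
    ℚ[X].mul (shift f) (shift g)       ∎
    where open import Relation.Binary.Reasoning.Setoid ℚₚ.P.setoid

-- Primitivity gives `ζ ^ P ≠ 1`, so the geometric sum vanishes at ζ and the minimal polynomial
-- divides it. The sum is irreducible and both are monic, which leaves the cofactor 1.
isCyclotomic⇒≃ : ∀ {p} → Prime p → ∀ m {Φ} → IsCyclotomic (p ℕ.^ suc m) Φ → Φ ℤₚ.≃ cyclotomic p m
isCyclotomic⇒≃ {p} pp m {Φ} (L , ζ , (ζ^≈1 , ζ^≉1) , minimal) =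
  toℚ[X]-injective (ℚₚ.P.sym F≃Φ)
  where
  open Extension L using (evalℤ; evalℚ; module IsMinimalPolynomial)
  open IsMinimalPolynomial minimal
  open ExtensionRing L
  module Evℤ = RingHom ℤₚ.polynomialRing fieldRing (evalℤ-isHom ζ)
  instance _ = prime⇒nonZero pp
           _ = prime⇒nonTrivial pp
  P = p ℕ.^ m
  F = cyclotomic p m
  F-root : evalℤ F ζ ≈ 0#
  F-root = trans (Evℤ.φ-geom p (ℤₚ.X ℤₚ-ring.^ P)) (trans
    (geom-cong p (trans (Evℤ.φ-^ ℤₚ.X P) (^-congˡ P (Evℚ.ev-X ζ))))
    (geom-root p (trans (^-assocʳ ζ P p) (trans (^-congʳ ζ (ℕ.*-comm P p)) ζ^≈1))
      (ζ^≉1 P (ℕ.>-nonZero⁻¹ P {{ℕ.m^n≢0 p m}}) (ℕ.^-monoʳ-< p (ℕ.nonTrivial⇒n>1 p) (ℕ.n<1+n m)))))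
  Φ∣F = divide (toℚ[X] F) F-root
  q : ℚ[X]
  q = RawMagma._∣ʳ_.quotient Φ∣F
  F≃qΦ : toℚ[X] F ℚₚ.≃ ℚ[X].mul q (toℚ[X] Φ)
  F≃qΦ = ℚₚ.P.sym (ℚₚ.coeffs (RawMagma._∣ʳ_.equality Φ∣F))
  q-unit : q ℚₚ.∣ₚ (1ℚ ∷ [])
  q-unit = Sum.fromInj₁ (λ Φ-unit → contradiction Φ-unit (no-root-of-unit {toℚ[X] Φ} {ζ} root))
    (cyclotomic-split pp m q (toℚ[X] Φ) F≃qΦ)
  F≃Φ : toℚ[X] F ℚₚ.≃ toℚ[X] Φ
  F≃Φ =
    let a , F-monic = cyclotomic-monic pp m
        b , Φ-monic = monic
    in ℚₚ.monic-associates {a} {b} {toℚ[X] F} {toℚ[X] Φ} q (toℚ[X]-monic {a} {F} F-monic) Φ-monic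
         (ℚₚ.P.trans F≃qΦ (ℚₚ.P.*-comm q (toℚ[X] Φ))) q-unit

open import Data.Nat.Base using (_^_)

-- The ring of integers

module Pullback (A : CommutativeRing c ℓ) (K : CommutativeRing c′ ℓ′)
  {φ : CommutativeRing.Carrier A → CommutativeRing.Carrier K}
  (φ-isHom : IsRingHomomorphism (CommutativeRing.rawRing A) (CommutativeRing.rawRing K) φ) where
  private
    module A = CommutativeRing A
    module K = CommutativeRing K
    module Φ = IsRingHomomorphism φ-isHom

    rawRing : RawRing c ℓ′
    rawRing = record { RawRing A.rawRing hiding (_≈_) ; _≈_ = λ x y → φ x K.≈ φ y }

  φ-isMonomorphism : IsRingMonomorphism rawRing K.rawRing φ
  φ-isMonomorphism = record
    { isRingHomomorphism = record
      { isSemiringHomomorphism = record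
        { isNearSemiringHomomorphism = record
          { +-isMonoidHomomorphism = record
            { isMagmaHomomorphism = record
              { isRelHomomorphism = record { cong = id }
              ; homo = Φ.+-homo }
            ; ε-homo = Φ.0#-homo }
          ; *-homo = Φ.*-homo }
        ; 1#-homo = Φ.1#-homo }
      ; -‿homo = Φ.-‿homo }
    ; injective = id }

  -- A / ker φ, on the carrier of A.
  pullback : CommutativeRing c ℓ′
  pullback = record { isCommutativeRing = RingMonomorphism.isCommutativeRing φ-isMonomorphism K.isCommutativeRing }

  projection-isHom : IsRingHomomorphism A.rawRing (CommutativeRing.rawRing pullback) id
  projection-isHom = record
    { isSemiringHomomorphism = record
      { isNearSemiringHomomorphism = record
        { +-isMonoidHomomorphism = record
          { isMagmaHomomorphism = record
            { isRelHomomorphism = record { cong = Φ.⟦⟧-cong }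
            ; homo = λ _ _ → K.refl }
          ; ε-homo = K.refl }
        ; *-homo = λ _ _ → K.refl }
      ; 1#-homo = K.refl }
    ; -‿homo = λ _ → K.refl }

ℤ[X]-generated : ∀ {ℓ} (P : ℤ[X] → Set ℓ) → (∀ {f g} → f ℤₚ.≃ g → P f → P g) →
  P [] → P (1ℤ ∷ []) → P ℤₚ.X → (∀ {f g} → P f → P g → P (ℤ[X].add f g)) →
  (∀ {f g} → P f → P g → P (ℤ[X].mul f g)) → (∀ {f} → P f → P (map (ℤ.-_) f)) → ∀ f → P f
ℤ[X]-generated P resp P0 P1 PX P+ P* P- = go
  where
  natural : ∀ n → P (+ n ∷ [])
  natural zero    = resp {[]} {0ℤ ∷ []} (ℤₚ.coeffs λ { zero → ≡.refl ; (suc i) → ≡.refl }) P0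
  natural (suc n) = P+ {1ℤ ∷ []} {+ n ∷ []} P1 (natural n)
  constant : ∀ a → P (a ∷ [])
  constant (+ n)    = natural n
  constant -[1+ n ] = P- {+ suc n ∷ []} (natural (suc n))
  go : ∀ f → P f
  go []      = P0
  go (a ∷ f) = resp {ℤ[X].add (a ∷ []) (ℤ[X].mul ℤₚ.X f)} {a ∷ f} (ℤₚ-ring.sym (ℤₚ.horner a f))
    (P+ {a ∷ []} {ℤ[X].mul ℤₚ.X f} (constant a) (P* {ℤₚ.X} {f} PX (go f)))

module _ (K : Extension) where
  private
    module K = ExtensionRing K
  open Extension K hiding (_^_)

  module RingOfIntegers {p : ℕ} (pp : Prime p) (m n : ℕ) {T : ℤ[X]} (T≃ : T ℤₚ.≃ cyclotomicShift p m n)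
    (θ : Carrier) (root : evalℤ T θ ≈ 0#) where

    private
      T-eisenstein : ∃[ d ] EisensteinAt p d T
      T-eisenstein = cyclotomicShift-eisenstein pp m n {T} T≃

      d = proj₁ T-eisenstein

      φ : ℤ[X] → Carrier
      φ f = evalℤ f θ

      open Pullback ℤₚ.polynomialRing K.fieldRing (K.evalℤ-isHom θ)
      module B = RingTheory pullback
      module ToB = RingHom ℤₚ.polynomialRing pullback projection-isHom
      φ-isHom = IsRingMonomorphism.isRingHomomorphism φ-isMonomorphism
      module Φ = RingHom pullback K.fieldRing φ-isHom
      module Φℚ = RingHom ℚₚ.polynomialRing K.fieldRing (K.evalℚ-isHom θ)
      module Ι = RingHom ℚ-ring K.fieldRing ι-isHomomorphism

      -- Equality in `pullback` is by definition equality of values at θ, so `id` proves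
      -- injectivity.
      open Saturation K.fieldRing pullback φ-isHom id

      dichotomyℚ : ∀ h → evalℚ h θ ≈ 0# ⊎ ∃[ u ] evalℚ u θ * evalℚ h θ ≈ 1#
      dichotomyℚ h = Sum.map divisible coprime (EisensteinCriterion.bezout pp (proj₂ T-eisenstein) h)
        where
        open import Relation.Binary.Reasoning.Setoid K.setoid
        divisible : toℚ[X] T ℚₚ.∣ₚ h → evalℚ h θ ≈ 0#
        divisible (q , e) = begin
          evalℚ h θ                          ≈⟨ Φℚ.φ-cong e ⟨
          evalℚ (ℚ[X].mul q (toℚ[X] T)) θ    ≈⟨ Φℚ.φ-* q (toℚ[X] T) ⟩
          evalℚ q θ * evalℤ T θ              ≈⟨ trans (*-congˡ root) (zeroʳ _) ⟩
          0#                                 ∎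
        coprime : (∃₂ λ u v → ℚ[X].add (ℚ[X].mul u h) (ℚ[X].mul v (toℚ[X] T)) ℚₚ.≃ (1ℚ ∷ [])) →
                  ∃[ u ] evalℚ u θ * evalℚ h θ ≈ 1#
        coprime (u , v , e) = u , (begin
          evalℚ u θ * evalℚ h θ
            ≈⟨ +-identityʳ _ ⟨
          evalℚ u θ * evalℚ h θ + 0#
            ≈⟨ +-congˡ (trans (*-congˡ root) (zeroʳ _)) ⟨
          evalℚ u θ * evalℚ h θ + evalℚ v θ * evalℤ T θ
            ≈⟨ +-cong (Φℚ.φ-* u h) (Φℚ.φ-* v (toℚ[X] T)) ⟨
          evalℚ (ℚ[X].mul u h) θ + evalℚ (ℚ[X].mul v (toℚ[X] T)) θ
            ≈⟨ Φℚ.φ-+ (ℚ[X].mul u h) (ℚ[X].mul v (toℚ[X] T)) ⟨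
          evalℚ (ℚ[X].add (ℚ[X].mul u h) (ℚ[X].mul v (toℚ[X] T))) θ
            ≈⟨ Φℚ.φ-cong e ⟩
          evalℚ (1ℚ ∷ []) θ
            ≈⟨ Φℚ.φ-1 ⟩
          1# ∎)

      dichotomy : ∀ f → φ f ≈ 0# ⊎ Invertible (φ f)
      dichotomy f = Sum.map₂ (λ (u , e) → evalℚ u θ , e) (dichotomyℚ (toℚ[X] f))

      T≈0 : T B.≈ B.0#
      T≈0 = root

      geom-in-B : B.geom p ((B.1# B.+ ℤₚ.X B.^ (2 ^ n)) B.^ (p ^ m)) B.≈ B.0#
      geom-in-B = begin
        B.geom p ((B.1# B.+ ℤₚ.X B.^ N) B.^ P)
          ≈⟨ B.geom-cong p {V ℤₚ-ring.^ P} {(B.1# B.+ ℤₚ.X B.^ N) B.^ P} inner ⟨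
        B.geom p (V ℤₚ-ring.^ P)
          ≈⟨ ToB.φ-geom p (V ℤₚ-ring.^ P) ⟨
        cyclotomicShift p m n
          ≈⟨ ToB.φ-cong T≃ ⟨
        T
          ≈⟨ T≈0 ⟩
        B.0# ∎
        where
        open import Relation.Binary.Reasoning.Setoid B.setoid
        N = 2 ^ n
        P = p ^ m
        V = ℤₚ-ring.1# ℤₚ-ring.+ ℤₚ.X ℤₚ-ring.^ N
        inner : V ℤₚ-ring.^ P B.≈ (B.1# B.+ ℤₚ.X B.^ N) B.^ P
        inner = begin
          V ℤₚ-ring.^ P                   ≈⟨ ToB.φ-^ V P ⟩
          V B.^ P                         ≈⟨ B.^-congˡ P {V} {B.1# B.+ ℤₚ.X B.^ N}
                                               (B.+-congˡ {B.1#} {ℤₚ.X ℤₚ-ring.^ N} {ℤₚ.X B.^ N} (ToB.φ-^ ℤₚ.X N)) ⟩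
          (B.1# B.+ ℤₚ.X B.^ N) B.^ P     ∎

      eisenstein-in-B : ∃[ g ] ℤₚ.X B.^ suc d B.+ p B.· B.1# B.* (B.1# B.+ ℤₚ.X B.* g) B.≈ B.0#
      eisenstein-in-B = proj₁ form , (begin
        ℤₚ.X B.^ suc d B.+ p B.· B.1# B.* H
          ≈⟨ B.+-cong {ℤₚ.X ℤₚ-ring.^ suc d} {ℤₚ.X B.^ suc d} {p ℤₚ-ring.· B.1# B.* H} {p B.· B.1# B.* H}
               (ToB.φ-^ ℤₚ.X (suc d)) (B.*-congʳ {H} {p ℤₚ-ring.· B.1#} {p B.· B.1#} (ToB.φ-· p B.1#)) ⟨
        ℤₚ.X ℤₚ-ring.^ suc d ℤₚ-ring.+ p ℤₚ-ring.· ℤₚ-ring.1# ℤₚ-ring.* H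
          ≈⟨ ToB.φ-cong (proj₂ form) ⟨
        T
          ≈⟨ T≈0 ⟩
        B.0# ∎)
        where
        open import Relation.Binary.Reasoning.Setoid B.setoid
        form = eisenstein-form pp (proj₂ T-eisenstein)
        H = B.1# B.+ ℤₚ.X B.* proj₁ form

      φ-n·1 : ∀ n → φ (n B.· B.1#) ≈ ι (toℚ (+ n))
      φ-n·1 n = begin
        φ (n B.· B.1#)        ≈⟨ Φ.φ-· n B.1# ⟩
        n K.· φ B.1#          ≈⟨ K.×-congʳ n (trans Φ.φ-1 (sym Ι.φ-1)) ⟩
        n K.· ι 1ℚ            ≈⟨ Ι.φ-· n 1ℚ ⟨
        ι (n ℚᵣ.· 1ℚ)         ≈⟨ Ι.φ-cong (≡.trans (≡.sym (RingHom.φ-· ℤ-ring ℚ-ring toℚ-isHom n 1ℤ)) (≡.cong toℚ (n·1≡+n n))) ⟩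
        ι (toℚ (+ n))         ∎
        where
        open import Relation.Binary.Reasoning.Setoid K.setoid
        module ℚᵣ = RingTheory ℚ-ring

      n·1-invertible : ∀ n .{{_ : NonZero n}} → Invertible (φ (n B.· B.1#))
      n·1-invertible n@(suc _) = inverse (Sum.fromInj₂
          (λ n≡0 → contradiction (toℚ-injective {+ n} {0ℤ} n≡0) λ ()) (ℚ-inverse? (toℚ (+ n))))
        where
        open import Relation.Binary.Reasoning.Setoid K.setoid
        inverse : (∃[ y ] y ℚ.* toℚ (+ n) ≡ 1ℚ) → Invertible (φ (n B.· B.1#))
        inverse (y , e) = ι y , (begin
          ι y * φ (n B.· B.1#)    ≈⟨ *-congˡ (φ-n·1 n) ⟩
          ι y * ι (toℚ (+ n))     ≈⟨ Ι.φ-* y (toℚ (+ n)) ⟨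
          ι (y ℚ.* toℚ (+ n))     ≈⟨ Ι.φ-cong e ⟩
          ι 1ℚ                    ≈⟨ Ι.φ-1 ⟩
          1#                      ∎)

      saturated-at : ∀ {q} → Prime q → ∀ β → Integralˡ β → ∀ g → φ (q B.· B.1#) * β ≈ φ g → InImage β
      saturated-at {q} pq = LocalIntegrality.saturated-at-prime K.fieldRing pullback φ-isHom id dichotomy ℤₚ.X
        (λ P resp → ℤ[X]-generated P (λ {f} {g} f≃g → resp {f} {g} (ToB.φ-cong f≃g)))
        pp m n d (proj₁ eisenstein-in-B) geom-in-B (proj₂ eisenstein-in-B) pq (n·1-invertible q {{prime⇒nonZero pq}})

      -- One prime `q` is removed at a time: with `R` the product of the others, `R β` is still
      -- integral in the sense of `Integralˡ`, so `q (R β)` in the image puts `R β` there.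
      saturated-at-product : ∀ {qs} → All Prime qs → ∀ β → Integralˡ β → InImage (φ (product qs B.· B.1#) * β) → InImage β
      saturated-at-product []                        β β-int (g , e) = g ,
        trans (sym (trans (*-congʳ (trans (Φ.φ-cong {B.1# B.+ B.0#} {B.1#} (B.+-identityʳ B.1#)) Φ.φ-1)) (*-identityˡ β))) e
      saturated-at-product {q ∷ qs} (q-prime ∷ primes) β β-int (g , e) =
        saturated-at-product primes β β-int (saturated-at q-prime (φ R * β) (Integralˡ-* {β} R β-int) g (begin
          φ Q * (φ R * β)                              ≈⟨ *-assoc _ _ _ ⟨
          φ Q * φ R * β                                ≈⟨ *-congʳ (Φ.φ-* Q R) ⟨
          φ (Q B.* R) * β                              ≈⟨ *-congʳ (Φ.φ-cong {(q ℕ.* product qs) B.· B.1#} {Q B.* R} (B.×1-homo-* q (product qs))) ⟨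
          φ ((q ℕ.* product qs) B.· B.1#) * β          ≈⟨ e ⟩
          φ g                                          ∎))
        where
        open import Relation.Binary.Reasoning.Setoid K.setoid
        Q = q B.· B.1#
        R = product qs B.· B.1#

      saturated-at-ℕ : ∀ c → NonZero c → ∀ β → Integralˡ β → InImage (φ (c B.· B.1#) * β) → InImage β
      saturated-at-ℕ c c≢0 β β-int =
        ≡.subst (λ k → InImage (φ (k B.· B.1#) * β) → InImage β) (≡.sym isFactorisation) (saturated-at-product factorsPrime β β-int)
        where
        instance _ = c≢0
        open PrimeFactorisation (factorise c)

      -- Multiplication by `D ^ e` turns the term of degree i of h(α) into its coefficient times
      -- `D ^ (e - i) * y ^ i`, a multiple of `D` unless i = e. The induction follows Horner's
      -- scheme.
      homogenize : ∀ {α D y} → φ D * α ≈ φ y → ∀ e h → ℤₚ.Below h (suc e) →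
        ∃[ t ] φ (D B.^ e) * evalℤ h α ≈ ι (toℚ (ℤ[X].coeff h e)) * φ (y B.^ e) + φ D * φ t
      homogenize {α} {D} {y} Dα e []      h< = [] , trans (zeroʳ _)
        (sym (trans (+-cong (trans (*-congʳ Ι.φ-0) (zeroˡ _)) (zeroʳ _)) (+-identityˡ 0#)))
      homogenize {α} {D} {y} Dα zero (x ∷ f) h< = [] , (begin
        φ B.1# * (ι (toℚ x) + α * evalℤ f α)
          ≈⟨ *-congˡ (trans (+-congˡ (trans (*-congˡ f[α]≈0) (zeroʳ α))) (+-identityʳ _)) ⟩
        φ B.1# * ι (toℚ x)
          ≈⟨ K.solve 3 (λ o x d → o K.:* x K.:= x K.:* o K.:+ d K.:* K.con 0ℤ) refl (φ B.1#) (ι (toℚ x)) (φ D) ⟩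
        ι (toℚ x) * φ B.1# + φ D * 0# ∎)
        where
        open import Relation.Binary.Reasoning.Setoid K.setoid
        f[α]≈0 : evalℤ f α ≈ 0#
        f[α]≈0 = K.Evℚ.ev-zero α (toℚ[X] f) (toℚ[X]-cong {f} {[]} (ℤₚ.coeffs λ i → h< (suc i) (s≤s z≤n)))
      homogenize {α} {D} {y} Dα (suc e) (x ∷ f) h< =
        Dᵉ B.* (x ∷ []) B.+ y B.* t , (begin
          φ (D B.* Dᵉ) * (ι (toℚ x) + α * F)
            ≈⟨ *-congʳ (Φ.φ-* D Dᵉ) ⟩
          φ D * φ Dᵉ * (ι (toℚ x) + α * F)
            ≈⟨ K.solve 5 (λ d de x a f → d K.:* de K.:* (x K.:+ a K.:* f) K.:= d K.:* (de K.:* x) K.:+ (d K.:* a) K.:* (de K.:* f))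
                 refl (φ D) (φ Dᵉ) (ι (toℚ x)) α F ⟩
          φ D * (φ Dᵉ * ι (toℚ x)) + φ D * α * (φ Dᵉ * F)
            ≈⟨ +-congˡ (*-cong Dα (proj₂ tail)) ⟩
          φ D * (φ Dᵉ * ι (toℚ x)) + φ y * (k * φ (y B.^ e) + φ D * φ t)
            ≈⟨ K.solve 6 (λ d z y c ye t → d K.:* z K.:+ y K.:* (c K.:* ye K.:+ d K.:* t) K.:= c K.:* (y K.:* ye) K.:+ d K.:* (z K.:+ y K.:* t))
                 refl (φ D) (φ Dᵉ * ι (toℚ x)) (φ y) k (φ (y B.^ e)) (φ t) ⟩
          k * (φ y * φ (y B.^ e)) + φ D * (φ Dᵉ * ι (toℚ x) + φ y * φ t)
            ≈⟨ +-cong (*-congˡ (Φ.φ-* y (y B.^ e))) (*-congˡ expand) ⟨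
          k * φ (y B.* y B.^ e) + φ D * φ (Dᵉ B.* (x ∷ []) B.+ y B.* t) ∎)
        where
        open import Relation.Binary.Reasoning.Setoid K.setoid
        tail = homogenize {α} {D} {y} Dα e f (λ i e<i → h< (suc i) (s≤s e<i))
        t = proj₁ tail
        Dᵉ = D B.^ e
        F = evalℤ f α
        k = ι (toℚ (ℤ[X].coeff f e))
        expand : φ (Dᵉ B.* (x ∷ []) B.+ y B.* t) ≈ φ Dᵉ * ι (toℚ x) + φ y * φ t
        expand = trans (Φ.φ-+ (Dᵉ B.* (x ∷ [])) (y B.* t))
          (+-cong (trans (Φ.φ-* Dᵉ (x ∷ [])) (*-congˡ (K.Evℚ.ev-const θ (toℚ x)))) (Φ.φ-* y t))

      integral⇒Integralˡ : ∀ {α} → Integral α → Integralˡ α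
      integral⇒Integralˡ {α} (h , (e , hₑ≡1 , h<) , h[α]≈0) D y Dα = e , B.- t , (begin
        φ (y B.^ e)
          ≈⟨ K.linear 1# total (K.solve 2 (λ z w → z K.:+ K.con 1ℤ K.:* K.con 0ℤ K.:= K.:- w K.:+ K.con 1ℤ K.:* (z K.:+ w))
               refl (φ (y B.^ e)) (φ D * φ t)) ⟩
        - (φ D * φ t)
          ≈⟨ K.-‿distribʳ-* (φ D) (φ t) ⟩
        φ D * - φ t
          ≈⟨ *-congˡ (Φ.φ-neg t) ⟨
        φ D * φ (B.- t)
          ≈⟨ Φ.φ-* D (B.- t) ⟨
        φ (D B.* B.- t) ∎)
        where
        open import Relation.Binary.Reasoning.Setoid K.setoid
        homogenized = homogenize {α} {D} {y} Dα e h h<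
        t = proj₁ homogenized
        total : φ (y B.^ e) + φ D * φ t ≈ 0#
        total = begin
          φ (y B.^ e) + φ D * φ t
            ≈⟨ +-congʳ (trans (*-congʳ (trans (Ι.φ-cong (≡.cong toℚ hₑ≡1)) Ι.φ-1)) (*-identityˡ _)) ⟨
          ι (toℚ (ℤ[X].coeff h e)) * φ (y B.^ e) + φ D * φ t
            ≈⟨ proj₂ homogenized ⟨
          φ (D B.^ e) * evalℤ h α
            ≈⟨ trans (*-congˡ h[α]≈0) (zeroʳ _) ⟩
          0# ∎

      -- By `dichotomyℚ` the denominator has an inverse that is itself a polynomial in θ, so
      -- fractions reduce to polynomials with rational coefficients.
      ℚ⟨θ⟩⇒evalℚ : ∀ {α} → ℚ⟨ θ ⟩ α → ∃[ f ] α ≈ evalℚ f θ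
      ℚ⟨θ⟩⇒evalℚ {α} (g , h , h#0 , αh≈g) = conclude (Sum.fromInj₂
        (λ h≈0 → contradiction h#0 (#-irrefl h≈0)) (dichotomyℚ h))
        where
        open import Relation.Binary.Reasoning.Setoid K.setoid
        conclude : (∃[ u ] evalℚ u θ * evalℚ h θ ≈ 1#) → ∃[ f ] α ≈ evalℚ f θ
        conclude (u , uh≈1) = ℚ[X].mul u g , (begin
          α                                  ≈⟨ *-identityˡ α ⟨
          1# * α                             ≈⟨ *-congʳ uh≈1 ⟨
          evalℚ u θ * evalℚ h θ * α          ≈⟨ trans (*-assoc _ _ _) (*-congˡ (*-comm _ α)) ⟩
          evalℚ u θ * (α * evalℚ h θ)        ≈⟨ *-congˡ αh≈g ⟩
          evalℚ u θ * evalℚ g θ              ≈⟨ Φℚ.φ-* u g ⟨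
          evalℚ (ℚ[X].mul u g) θ             ∎)

    𝒪⊆ℤ⟨θ⟩ : 𝒪⟨ θ ⟩ ⊆ ℤ⟨ θ ⟩
    𝒪⊆ℤ⟨θ⟩ {α} (α∈ℚ⟨θ⟩ , α-integral) =
      let f , α≈f             = ℚ⟨θ⟩⇒evalℚ {α} α∈ℚ⟨θ⟩
          c , c≢0 , r , cf≃r  = clear-denominators f
      in saturated-at-ℕ c c≢0 α (integral⇒Integralˡ {α} α-integral) (r , (begin
        φ (c B.· B.1#) * α                    ≈⟨ *-cong (φ-n·1 c) α≈f ⟩
        ι (toℚ (+ c)) * evalℚ f θ             ≈⟨ K.Evℚ.ev-scale θ (toℚ (+ c)) f ⟨
        evalℚ (map (toℚ (+ c) ℚ.*_) f) θ      ≈⟨ Φℚ.φ-cong cf≃r ⟩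
        evalℤ r θ                             ∎))
      where open import Relation.Binary.Reasoning.Setoid K.setoid

-- The composite of the two cyclotomic polynomials

∘ₚ-cyclotomicShift : ∀ {p} → Prime p → ∀ m n {Φ Ψ} → IsCyclotomic (p ^ suc m) Φ → IsCyclotomic (2 ^ suc n) Ψ →
                     (Φ ∘ₚ Ψ) ℤₚ.≃ cyclotomicShift p m n
∘ₚ-cyclotomicShift {p} pp m n {Φ} {Ψ} Φ-cyc Ψ-cyc = begin
  C.ev Φ Ψ                          ≈⟨ C.ev-cong Ψ Φ (cyclotomic p m) (isCyclotomic⇒≃ pp m Φ-cyc) ⟩
  C.ev (cyclotomic p m) Ψ           ≈⟨ At.φ-geom p (ℤₚ.X ^ₚ P) ⟩
  geom p (C.ev (ℤₚ.X ^ₚ P) Ψ)       ≈⟨ geom-cong p (trans (At.φ-^ ℤₚ.X P) (^-congˡ P (trans (C.ev-X Ψ) Ψ≃))) ⟩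
  cyclotomicShift p m n             ∎
  where
  open ℤₚ-ring renaming (_^_ to _^ₚ_)
  module C = Evaluation ℤ-ring ℤₚ.polynomialRing ℤₚ.const-isHomomorphism
  module At = RingHom ℤₚ.polynomialRing ℤₚ.polynomialRing (C.ev-isHom Ψ)
  open import Relation.Binary.Reasoning.Setoid setoid
  P = p ^ m
  V = ℤₚ.X ^ₚ (2 ^ n)
  Ψ≃ : Ψ ℤₚ.≃ (1# + V)
  -- For the prime 2 the geometric sum has just the two terms 1 and `V`.
  Ψ≃ = trans (isCyclotomic⇒≃ prime[2] n Ψ-cyc)
    (solve 1 (λ v → con 1ℤ :+ v :* (con 1ℤ :+ v :* con 0ℤ) := con 1ℤ :+ v) refl V)

theorem1p1 : ∀ (m n p : ℕ) .{{_ : NonZero m}} .{{_ : NonZero n}} → Prime p →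
    ∀ (Φ Ψ : ℤ[X]) → IsCyclotomic (p ^ m) Φ → IsCyclotomic (2 ^ n) Ψ →
    IrreducibleOverℚ (Φ ∘ₚ Ψ) × Monogenic (Φ ∘ₚ Ψ)
theorem1p1 (suc m) (suc n) p pp Φ Ψ Φ-cyc Ψ-cyc = irreducible , record
  { monic       = suc d , isMonic
  ; irreducible = irreducible
  ; index-one   = λ K θ root → RingOfIntegers.𝒪⊆ℤ⟨θ⟩ K pp m n {Φ ∘ₚ Ψ} T≃ θ root }
  where
  T≃ : (Φ ∘ₚ Ψ) ℤₚ.≃ cyclotomicShift p m n
  T≃ = ∘ₚ-cyclotomicShift pp m n {Φ} {Ψ} Φ-cyc Ψ-cyc
  T-eisenstein = cyclotomicShift-eisenstein pp m n {Φ ∘ₚ Ψ} T≃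
  d = proj₁ T-eisenstein
  open EisensteinAt (proj₂ T-eisenstein) using (isMonic)
  open EisensteinCriterion {p} {d} {Φ ∘ₚ Ψ} pp (proj₂ T-eisenstein) using (irreducible)
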